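{- Let $P$ be a pinwheel tiling, regarded as an infinite planar graph. Then its chromatic number is $\chi(P)=3$.
   Context: Pinwheel substitution. The prototile $K$ is the right triangle with side lengths $1,2,\sqrt5$. The substitution $\omega$ expands a tile by $\sqrt5$ and dissects it into five tiles: the expanded tile, placed as the triangle with vertices $(0,0)$ (right angle), $(2,-1)$, $(2,4)$, is dissected into the triangles with vertices $\{(2,-1),(2,0),(0,0)\}$, $\{(0,0),(1,0),(1,2)\}$, $\{(1,0),(2,0),(1,2)\}$, $\{(2,0),(2,2),(1,2)\}$, $\{(1,2),(2,2),(2,4)\}$. The rule is extended to all congruent copies of $K$ (including reflections) and to collections of tiles covariantly. A pinwheel tiling is a tiling $P$ of $\mathbb{R}^2$ by congruent copies of $K$ such that every finite set of tiles of $P$ is contained in a congruent copy of $\omega^n(K)$ for some $n\ge0$. Graph: the vertices are all points that are a corner of at least one tile; the edges are the segments, contained in tile boundaries, joining consecutive vertices (so a tile side containing vertices in its interior is subdivided by them). -}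

module Defs where

open import Algebra.Bundles using (CommutativeRing)
open import Data.Fin using (Fin)
open import Data.Fin.Patterns using (0F; 1F; 2F; 3F; 4F)
open import Data.List using (List)
open import Data.List.Relation.Unary.All using (All)
open import Data.Nat as ℕ using (ℕ; zero; suc)
open import Data.Product using (Σ; ∃; ∃-syntax; Σ-syntax; _×_; _,_; proj₁)
open import Data.Product.Relation.Binary.Pointwise.NonDependent using (×-setoid)
open import Function using (_on_)
open import Function.Bundles using (Func; _⟶ₛ_; _⟨$⟩_)
open import Level using (0ℓ) renaming (suc to lsuc)
open import Relation.Binary using (Rel; Setoid; IsStrictTotalOrder; _Respects_)
import Relation.Binary.Construct.On as On
import Relation.Binary.Construct.StrictToNonStrict as ToNonStrict
open import Relation.Binary.PropositionalEquality as ≡ using (_≢_)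
open import Relation.Nullary using (¬_)
open import Relation.Unary using (Pred)

-- The real numbers, axiomatised classically; they are unique up to
-- isomorphism, so a statement about ℝ is a statement about every such field.
record CompleteOrderedField : Set (lsuc 0ℓ) where
  infix 4 _<_
  field
    commutativeRing : CommutativeRing 0ℓ 0ℓ

  open CommutativeRing commutativeRing public

  field
    _<_                : Rel Carrier 0ℓ
    isStrictTotalOrder : IsStrictTotalOrder _≈_ _<_
    0<1                : 0# < 1#
    +-monoˡ-<          : ∀ {x y} z → x < y → x + z < y + z
    *-pos              : ∀ {x y} → 0# < x → 0# < y → 0# < x * y
    inverse            : ∀ x → ¬ (x ≈ 0#) → ∃[ y ] x * y ≈ 1#

  open ToNonStrict _≈_ _<_ public using (_≤_)

  UpperBound : Pred Carrier 0ℓ → Pred Carrier 0ℓ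
  UpperBound S b = ∀ x → S x → x ≤ b

  field
    supremum : ∀ (S : Pred Carrier 0ℓ) → ∃ S → ∃ (UpperBound S) →
               ∃[ s ] UpperBound S s × (∀ b → UpperBound S b → s ≤ b)

record Graph : Set (lsuc 0ℓ) where
  field
    vertices : Setoid 0ℓ 0ℓ
    Adjacent : Rel (Setoid.Carrier vertices) 0ℓ

Colourable : Graph → ℕ → Set
Colourable G k =
  Σ[ c ∈ vertices ⟶ₛ ≡.setoid (Fin k) ]
    (∀ u v → Adjacent u v → c ⟨$⟩ u ≢ c ⟨$⟩ v)
  where open Graph G

HasChromaticNumber : Graph → ℕ → Set
HasChromaticNumber G k =
  Colourable G k × (∀ m → m ℕ.< k → ¬ Colourable G m)

module Pinwheel (ℝ : CompleteOrderedField) where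
  open CompleteOrderedField ℝ

  infix  4 _≈ₜ_ _∈ω_
  infixl 6 _⊕_
  infixr 7 _·_

  2# 4# : Carrier
  2# = 1# + 1#
  4# = 2# + 2#

  pointSetoid : Setoid 0ℓ 0ℓ
  pointSetoid = ×-setoid setoid setoid

  open Setoid pointSetoid public using () renaming (Carrier to Point; _≈_ to _≈ₚ_)

  _⊕_ : Point → Point → Point
  (x , y) ⊕ (x′ , y′) = x + x′ , y + y′

  _·_ : Carrier → Point → Point
  r · (x , y) = r * x , r * y

  InSegment : Point → Point → Pred Point 0ℓ
  InSegment p q x =
    ∃[ s ] ∃[ t ] 0# ≤ s × 0# ≤ t × s + t ≈ 1# × x ≈ₚ s · p ⊕ t · q

  StrictlyBetween : Point → Point → Pred Point 0ℓ
  StrictlyBetween p q x =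
    ∃[ s ] ∃[ t ] 0# < s × 0# < t × s + t ≈ 1# × x ≈ₚ s · p ⊕ t · q

  -- A triangle carries the roles of its corners: the right angle, the end of
  -- the short leg, the end of the long leg.  Because K is scalene, a congruent
  -- copy of K, as a subset of the plane, has exactly one such labelling.
  record Triangle : Set where
    constructor △
    field
      right short long : Point

  open Triangle

  corner : Triangle → Fin 3 → Point
  corner T 0F = right T
  corner T 1F = short T
  corner T 2F = long T

  _≈ₜ_ : Rel Triangle 0ℓ
  T ≈ₜ U = ∀ i → corner T i ≈ₚ corner U i

  mapT : (Point → Point) → Triangle → Triangle
  mapT f (△ p q r) = △ (f p) (f q) (f r)

  InTriangle : Triangle → Pred Point 0ℓ
  InTriangle (△ p q r) x =
    ∃[ a ] ∃[ b ] ∃[ c ] 0# ≤ a × 0# ≤ b × 0# ≤ c × (a + b) + c ≈ 1# ×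
      x ≈ₚ a · p ⊕ b · q ⊕ c · r

  InInterior : Triangle → Pred Point 0ℓ
  InInterior (△ p q r) x =
    ∃[ a ] ∃[ b ] ∃[ c ] 0# < a × 0# < b × 0# < c × (a + b) + c ≈ 1# ×
      x ≈ₚ a · p ⊕ b · q ⊕ c · r

  -- x ↦ A x + τ with A orthogonal (reflections included); e₁ and e₂ are the
  -- columns of A.
  record Isometry : Set where
    field
      e₁ e₂ τ : Point

    _∙_ : Point → Point → Carrier
    (x , y) ∙ (x′ , y′) = x * x′ + y * y′

    field
      e₁-unit    : e₁ ∙ e₁ ≈ 1#
      e₂-unit    : e₂ ∙ e₂ ≈ 1#
      orthogonal : e₁ ∙ e₂ ≈ 0#

    apply : Point → Point
    apply (x , y) = x · e₁ ⊕ y · e₂ ⊕ τ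

  moveT : Isometry → Triangle → Triangle
  moveT g = mapT (Isometry.apply g)

  K : Triangle
  K = △ (0# , 0#) (1# , 0#) (0# , 2#)

  -- √5 times a rotation.  The rotation puts the expanded prototile in the
  -- position in which its dissection is given, expand K being placedK; it has
  -- no effect on ωⁿ(K) up to congruence.
  expand : Point → Point
  expand (x , y) = 2# * x + y , - x + 2# * y

  placedK : Triangle
  placedK = △ (0# , 0#) (2# , - 1#) (2# , 4#)

  piece : Fin 5 → Triangle
  piece 0F = △ (2# , 0#) (2# , - 1#) (0# , 0#)
  piece 1F = △ (1# , 0#) (0# , 0#)   (1# , 2#)
  piece 2F = △ (1# , 0#) (2# , 0#)   (1# , 2#)
  piece 3F = △ (2# , 2#) (1# , 2#)   (2# , 0#)
  piece 4F = △ (2# , 2#) (1# , 2#)   (2# , 4#)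

  -- The covariant extension: if h places the model triangle on the expanded
  -- tile, the tiles of the dissection are the h-images of the model pieces.
  _∈ω_ : Triangle → Triangle → Set
  U ∈ω T = ∃[ h ] moveT h placedK ≈ₜ mapT expand T × ∃[ i ] U ≈ₜ moveT h (piece i)

  -- The collections of tiles ωⁿ(K).
  ωⁿK : ℕ → Pred Triangle 0ℓ
  ωⁿK zero    U = U ≈ₜ K
  ωⁿK (suc n) U = ∃[ T ] ωⁿK n T × U ∈ω T

  record IsTiling (P : Pred Triangle 0ℓ) : Set where
    field
      respects : P Respects _≈ₜ_
      copies   : ∀ T → P T → ∃[ g ] T ≈ₜ moveT g K
      covers   : ∀ x → ∃[ T ] P T × InTriangle T x
      packs    : ∀ T U x → P T → P U → InInterior T x → InInterior U x → T ≈ₜ U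

  record IsPinwheelTiling (P : Pred Triangle 0ℓ) : Set where
    field
      isTiling : IsTiling P
      patches  : ∀ (F : List Triangle) → All P F →
                 ∃[ n ] ∃[ g ] All (λ T → ∃[ U ] ωⁿK n U × T ≈ₜ moveT g U) F

  module _ (P : Pred Triangle 0ℓ) where

    IsVertex : Pred Point 0ℓ
    IsVertex x = ∃[ T ] P T × ∃[ i ] x ≈ₚ corner T i

    OnCommonSide : Rel Point 0ℓ
    OnCommonSide x y =
      ∃[ T ] P T × ∃[ i ] ∃[ j ] i ≢ j ×
        InSegment (corner T i) (corner T j) x × InSegment (corner T i) (corner T j) y

    Consecutive : Rel Point 0ℓ
    Consecutive x y =
      ¬ (x ≈ₚ y) × (∀ z → IsVertex z → ¬ StrictlyBetween x y z)

    tilingGraph : Graph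
    tilingGraph = record
      { vertices = On.setoid pointSetoid (proj₁ {B = IsVertex})
      ; Adjacent = λ (x , _) (y , _) → OnCommonSide x y × Consecutive x y
      }

{-# OPTIONS --safe #-}
module Submission where

-- A patch is an affine image of the n-fold subdivision of K, so every statement about
-- patches is one about barycentric coordinates in tenths.  A segment of a tile (a short
-- leg, half a long leg, a hypotenuse) inside a patch is a segment of a second tile beyond
-- it, in one of twelve relative positions: each segment of a piece is either common to two
-- pieces or part of a segment of the parent, so this is a finite check.  As two tiles fill
-- a neighbourhood of the inside of their common segment, the vertices on a side of a tile
-- are its ends and, possibly, the midpoint of a long leg.  So the edges have length 1, √5
-- or 2, the last for undivided long legs.
--
-- The corners have coordinates with odd denominators, hence the squared distance from a
-- fixed vertex has a parity, which changes along edges of length 1 and √5.  An undivided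
-- long leg separates two mirror images, and at its right angle u all tiles have right
-- angles, except perhaps one whose long leg has midpoint u.  These vertices u are
-- independent, so they can take the third colour.  Conversely, pieces 1 and 2 share an
-- undivided long leg, which gives a triangle in the graph.

open import Defs
open import Axiom.ExcludedMiddle using (ExcludedMiddle)
open import Level using (0ℓ)
open import Relation.Unary using (Pred)

open import Algebra.Solver.Ring.AlmostCommutativeRing using (fromCommutativeRing; _-Raw-AlmostCommutative⟶_)
import Algebra.Solver.Ring
open import Data.Empty using (⊥; ⊥-elim)
open import Data.Fin as Fin using (Fin)
open import Data.Fin.Patterns using (0F; 1F; 2F; 3F; 4F; 5F; 6F; 7F; 8F; 9F)
import Data.Fin.Properties as Fin
open import Data.Fin.Properties using (all?; any?)
open import Data.Integer as ℤ using (ℤ; +_; -[1+_]; 0ℤ)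
import Data.Integer.DivMod as ℤ
import Data.Integer.Properties as ℤ
open import Data.Integer.Tactic.RingSolver using (solve-∀)
open import Data.List as List using (List; []; _∷_; _++_)
open import Data.List.Relation.Unary.All as All using (All; []; _∷_)
import Data.List.Relation.Unary.All.Properties as All
import Data.Maybe as Maybe
open import Data.Nat as ℕ using (ℕ; zero; suc)
import Data.Nat.Properties as ℕ
open import Data.Product using (∃; ∃₂; ∃-syntax; Σ-syntax; _×_; _,_; proj₁; proj₂)
open import Data.Sum using (_⊎_; inj₁; inj₂; [_,_]′)
open import Data.Vec using (Vec; []; _∷_; lookup)
open import Function.Bundles using (_⟨$⟩_)
open import Relation.Binary using (Setoid; IsStrictTotalOrder; Tri; tri<; tri≈; tri>)
import Relation.Binary.Construct.StrictToNonStrict as ToNonStrict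
open import Relation.Binary.PropositionalEquality as ≡ using (_≡_; _≢_)
open import Relation.Nullary using (¬_; Dec; yes; no; ¬?; _×-dec_; _⊎-dec_; _→-dec_)
open import Relation.Nullary.Decidable using (dec⇒maybe; from-yes)

-- `patches` places finitely many tiles of P in a patch; it does not say that the other tiles of
-- that patch belong to P. To find the neighbours of a tile T in P, the candidates are therefore
-- fixed beforehand: the twelve possible neighbours of T, together with tiles of P that cover their
-- centres. In a patch containing T and these tiles, a candidate that is a tile of the patch
-- overlaps the tile covering its centre, so both coincide and the candidate lies in P. As the
-- centres lie in the patch, no segment of T is on its boundary.
--
-- Coordinates are never global. Each patch comes with its own isometry, whose entries may be
-- irrational, so only inner products of differences of vertices are compared; pulled back to a
-- patch, they have odd denominators.
--
-- The exceptional tile at a special vertex u, whose long leg has its midpoint at u, threatens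
-- independence, since its own right angle might be special too. It is not: this right angle is the
-- short end of a tile, and no special vertex is one.

-- Ordered fields: integers, ring solver, signs

module FieldProperties (ℝ : CompleteOrderedField) where
  open CompleteOrderedField ℝ

  open IsStrictTotalOrder isStrictTotalOrder public
    using (compare; <-resp-≈; <-respʳ-≈; <-respˡ-≈)
    renaming (irrefl to <-irrefl; trans to <-trans; asym to <-asym)
  open import Algebra.Properties.Semiring.Mult.TCOptimised semiring
    using (×1-homo-*; ×-homo-+; 1+×) renaming (_×_ to _×ⁿ_)
  open import Algebra.Properties.Ring ring
    using (-‿distribˡ-*; -‿distribʳ-*; -‿involutive; -0#≈0#; -‿+-comm)
  open import Relation.Binary.Reasoning.Setoid setoid

  -- With the optimised multiple, `⟦ + 1 ⟧` and `⟦ + 2 ⟧` reduce to `1#` and `2#`, so solver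
  -- constants match those of `Pinwheel` definitionally; `4#` is bracketed differently and is
  -- converted by `4#≈⟦4⟧`.
  ⟦_⟧ : ℤ → Carrier
  ⟦ + n ⟧      = n ×ⁿ 1#
  ⟦ -[1+ n ] ⟧ = - (suc n ×ⁿ 1#)

  ⟦⟧-⊖ : ∀ m n → ⟦ m ℤ.⊖ n ⟧ ≈ m ×ⁿ 1# + - (n ×ⁿ 1#)
  ⟦⟧-⊖ zero    zero    = sym (-‿inverseʳ 0#)
  ⟦⟧-⊖ zero    (suc n) = sym (+-identityˡ _)
  ⟦⟧-⊖ (suc m) zero    = sym (trans (+-congˡ -0#≈0#) (+-identityʳ _))
  ⟦⟧-⊖ (suc m) (suc n) = begin
    ⟦ suc m ℤ.⊖ suc n ⟧                    ≡⟨ ≡.cong ⟦_⟧ (ℤ.[1+m]⊖[1+n]≡m⊖n m n) ⟩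
    ⟦ m ℤ.⊖ n ⟧                            ≈⟨ ⟦⟧-⊖ m n ⟩
    a + - b                                ≈⟨ +-identityˡ _ ⟨
    0# + (a + - b)                         ≈⟨ +-congʳ (-‿inverseʳ 1#) ⟨
    1# + - 1# + (a + - b)                  ≈⟨ +-assoc _ _ _ ⟩
    1# + (- 1# + (a + - b))                ≈⟨ +-congˡ (trans (sym (+-assoc _ _ _)) (trans (+-congʳ (+-comm _ _)) (+-assoc _ _ _))) ⟩
    1# + (a + (- 1# + - b))                ≈⟨ +-assoc _ _ _ ⟨
    1# + a + (- 1# + - b)                  ≈⟨ +-cong (sym (1+× m 1#)) (trans (-‿+-comm _ _) (-‿cong (sym (1+× n 1#)))) ⟩
    suc m ×ⁿ 1# + - (suc n ×ⁿ 1#)          ∎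
    where a = m ×ⁿ 1#
          b = n ×ⁿ 1#

  ⟦⟧-neg : ∀ i → ⟦ ℤ.- i ⟧ ≈ - ⟦ i ⟧
  ⟦⟧-neg (+ zero)   = sym -0#≈0#
  ⟦⟧-neg (+ suc n)  = refl
  ⟦⟧-neg (-[1+ n ]) = sym (-‿involutive _)

  ⟦⟧-+ : ∀ i j → ⟦ i ℤ.+ j ⟧ ≈ ⟦ i ⟧ + ⟦ j ⟧
  ⟦⟧-+ (+ m)    (+ n)    = ×-homo-+ 1# m n
  ⟦⟧-+ (+ m)    -[1+ n ] = ⟦⟧-⊖ m (suc n)
  ⟦⟧-+ -[1+ m ] (+ n)    = trans (⟦⟧-⊖ n (suc m)) (+-comm _ _)
  ⟦⟧-+ -[1+ m ] -[1+ n ] = begin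
    - (suc (suc (m ℕ.+ n)) ×ⁿ 1#)            ≡⟨ ≡.cong (λ k → - (k ×ⁿ 1#)) (≡.cong suc (≡.sym (ℕ.+-suc m n))) ⟩
    - ((suc m ℕ.+ suc n) ×ⁿ 1#)              ≈⟨ -‿cong (×-homo-+ 1# (suc m) (suc n)) ⟩
    - (suc m ×ⁿ 1# + suc n ×ⁿ 1#)            ≈⟨ -‿+-comm _ _ ⟨
    - (suc m ×ⁿ 1#) + - (suc n ×ⁿ 1#)        ∎

  ⟦⟧-* : ∀ i j → ⟦ i ℤ.* j ⟧ ≈ ⟦ i ⟧ * ⟦ j ⟧
  ⟦⟧-*-+ : ∀ m j → ⟦ + m ℤ.* j ⟧ ≈ ⟦ + m ⟧ * ⟦ j ⟧
  ⟦⟧-*-+ m (+ n) = begin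
    ⟦ + m ℤ.* + n ⟧      ≡⟨ ≡.cong ⟦_⟧ (≡.sym (ℤ.pos-* m n)) ⟩
    (m ℕ.* n) ×ⁿ 1#      ≈⟨ ×1-homo-* m n ⟩
    m ×ⁿ 1# * (n ×ⁿ 1#)  ∎
  ⟦⟧-*-+ m -[1+ n ] = begin
    ⟦ + m ℤ.* (ℤ.- (+ suc n)) ⟧  ≡⟨ ≡.cong ⟦_⟧ (≡.sym (ℤ.neg-distribʳ-* (+ m) (+ suc n))) ⟩
    ⟦ ℤ.- (+ m ℤ.* + suc n) ⟧    ≈⟨ ⟦⟧-neg (+ m ℤ.* + suc n) ⟩
    - ⟦ + m ℤ.* + suc n ⟧        ≈⟨ -‿cong (⟦⟧-*-+ m (+ suc n)) ⟩
    - (⟦ + m ⟧ * ⟦ + suc n ⟧)    ≈⟨ -‿distribʳ-* _ _ ⟩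
    ⟦ + m ⟧ * - ⟦ + suc n ⟧      ∎
  ⟦⟧-* (+ m) j = ⟦⟧-*-+ m j
  ⟦⟧-* -[1+ m ] j = begin
    ⟦ (ℤ.- (+ suc m)) ℤ.* j ⟧  ≡⟨ ≡.cong ⟦_⟧ (≡.sym (ℤ.neg-distribˡ-* (+ suc m) j)) ⟩
    ⟦ ℤ.- (+ suc m ℤ.* j) ⟧    ≈⟨ ⟦⟧-neg (+ suc m ℤ.* j) ⟩
    - ⟦ + suc m ℤ.* j ⟧        ≈⟨ -‿cong (⟦⟧-*-+ (suc m) j) ⟩
    - (⟦ + suc m ⟧ * ⟦ j ⟧)    ≈⟨ -‿distribˡ-* _ _ ⟩
    - ⟦ + suc m ⟧ * ⟦ j ⟧      ∎

  ⟦⟧-homomorphism : ℤ.+-*-rawRing -Raw-AlmostCommutative⟶ fromCommutativeRing commutativeRing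
  ⟦⟧-homomorphism = record
    { ⟦_⟧    = ⟦_⟧
    ; +-homo = ⟦⟧-+
    ; *-homo = ⟦⟧-*
    ; -‿homo = ⟦⟧-neg
    ; 0-homo = refl
    ; 1-homo = refl
    }

  -- The coefficients are integers because their equality test computes; that of the abstract field
  -- does not.
  module RingSolver = Algebra.Solver.Ring ℤ.+-*-rawRing (fromCommutativeRing commutativeRing) ⟦⟧-homomorphism
    (λ i j → Maybe.map (λ i≡j → reflexive (≡.cong ⟦_⟧ i≡j)) (dec⇒maybe (i ℤ.≟ j)))
  open RingSolver public using (solve; _:=_; _:+_; _:*_; _:-_; :-_; con)

  -- The certificate x - y = c (l - r), with the terms moved so that no subtraction occurs.
  linear₁ : ∀ {x y l r} c → l ≈ r → x + c * r ≈ y + c * l → x ≈ y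
  linear₁ {x} {y} {l} {r} c l≈r eq = begin
    x                            ≈⟨ solve 2 (λ x u → x := x :+ u :- u) refl x (c * r) ⟩
    x + c * r + - (c * r)        ≈⟨ +-congʳ eq ⟩
    y + c * l + - (c * r)        ≈⟨ +-congʳ (+-congˡ (*-congˡ l≈r)) ⟩
    y + c * r + - (c * r)        ≈⟨ solve 2 (λ x u → x := x :+ u :- u) refl y (c * r) ⟨
    y                            ∎

  linear₂ : ∀ {x y l r l′ r′} c c′ → l ≈ r → l′ ≈ r′ →
            x + (c * r + c′ * r′) ≈ y + (c * l + c′ * l′) → x ≈ y
  linear₂ {x} {y} {l} {r} {l′} {r′} c c′ l≈r l′≈r′ eq =
    linear₁ 1# (+-cong (*-congˡ {c} l≈r) (*-congˡ {c′} l′≈r′))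
      (trans (+-congˡ (*-identityˡ _)) (trans eq (+-congˡ (sym (*-identityˡ _)))))

  +-monoʳ-< : ∀ {x y} z → x < y → z + x < z + y
  +-monoʳ-< z x<y = <-respʳ-≈ (+-comm _ z) (<-respˡ-≈ (+-comm _ z) (+-monoˡ-< z x<y))

  0<+ : ∀ {x y} → 0# < x → 0# < y → 0# < x + y
  0<+ {x} {y} p q = <-trans p (<-respˡ-≈ (+-identityʳ x) (+-monoʳ-< x q))

  0<⇒-<0 : ∀ {x} → 0# < x → - x < 0#
  0<⇒-<0 {x} p = <-respʳ-≈ (-‿inverseʳ x) (<-respˡ-≈ (+-identityˡ (- x)) (+-monoˡ-< (- x) p))

  <0⇒0<- : ∀ {x} → x < 0# → 0# < - x
  <0⇒0<- {x} p = <-respʳ-≈ (+-identityˡ (- x)) (<-respˡ-≈ (-‿inverseʳ x) (+-monoˡ-< (- x) p))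

  <⇒0<- : ∀ {x y} → x < y → 0# < y + - x
  <⇒0<- {x} {y} p = <-respˡ-≈ (-‿inverseʳ x) (+-monoˡ-< (- x) p)

  ≤-resp : ∀ {x y} → x ≈ y → 0# ≤ x → 0# ≤ y
  ≤-resp x≈y (inj₁ 0<x) = inj₁ (<-respʳ-≈ x≈y 0<x)
  ≤-resp x≈y (inj₂ 0≈x) = inj₂ (trans 0≈x x≈y)

  0≤+ : ∀ {x y} → 0# ≤ x → 0# ≤ y → 0# ≤ x + y
  0≤+ (inj₁ p) (inj₁ q) = inj₁ (0<+ p q)
  0≤+ (inj₁ p) (inj₂ q) = inj₁ (<-respʳ-≈ (trans (sym (+-identityʳ _)) (+-congˡ q)) p)
  0≤+ (inj₂ p) q        = ≤-resp (trans (sym (+-identityˡ _)) (+-congʳ p)) q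

  0≤* : ∀ {x y} → 0# ≤ x → 0# ≤ y → 0# ≤ x * y
  0≤* (inj₁ p) (inj₁ q) = inj₁ (*-pos p q)
  0≤* (inj₁ p) (inj₂ q) = inj₂ (trans (sym (zeroʳ _)) (*-congˡ q))
  0≤* (inj₂ p) _        = inj₂ (trans (sym (zeroˡ _)) (*-congʳ p))

  0<+≤ : ∀ {x y} → 0# < x → 0# ≤ y → 0# < x + y
  0<+≤ p (inj₁ q) = 0<+ p q
  0<+≤ p (inj₂ q) = <-respʳ-≈ (trans (sym (+-identityʳ _)) (+-congˡ q)) p

  0≤+< : ∀ {x y} → 0# ≤ x → 0# < y → 0# < x + y
  0≤+< p q = <-respʳ-≈ (+-comm _ _) (0<+≤ q p)

  0<⇒≉0 : ∀ {x} → 0# < x → ¬ (x ≈ 0#)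
  0<⇒≉0 p x≈0 = <-irrefl (sym x≈0) p

  0<⇒≮0 : ∀ {x} → 0# ≤ x → ¬ (x < 0#)
  0<⇒≮0 (inj₁ p) q = <-irrefl refl (<-trans p q)
  0<⇒≮0 (inj₂ p) q = <-irrefl (sym p) q

  *-neg : ∀ {x y} → 0# < x → y < 0# → x * y < 0#
  *-neg {x} {y} p q = <-respˡ-≈ (solve 2 (λ x y → :- (x :* (:- y)) := x :* y) refl x y)
    (0<⇒-<0 (*-pos p (<0⇒0<- q)))

  *-pos-cancelˡ : ∀ {x y} → 0# < x → 0# < x * y → 0# < y
  *-pos-cancelˡ {x} {y} p q with compare 0# y
  ... | tri< r _ _ = r
  ... | tri≈ _ r _ = ⊥-elim (<-irrefl (trans (sym (zeroʳ x)) (*-congˡ r)) q)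
  ... | tri> _ _ r = ⊥-elim (<-asym q (*-neg p r))

  *-≈0-cancelˡ : ∀ {x y} → ¬ (x ≈ 0#) → x * y ≈ 0# → y ≈ 0#
  *-≈0-cancelˡ {x} {y} x≉0 xy≈0 with x⁻¹ , xx⁻¹≈1 ← inverse x x≉0 = begin
    y              ≈⟨ *-identityʳ y ⟨
    y * 1#         ≈⟨ *-congˡ xx⁻¹≈1 ⟨
    y * (x * x⁻¹)  ≈⟨ solve 3 (λ x y z → y :* (x :* z) := (x :* y) :* z) refl x y x⁻¹ ⟩
    x * y * x⁻¹    ≈⟨ *-congʳ xy≈0 ⟩
    0# * x⁻¹       ≈⟨ zeroˡ x⁻¹ ⟩
    0#             ∎

  *-cancelˡ : ∀ {x y z} → ¬ (x ≈ 0#) → x * y ≈ x * z → y ≈ z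
  *-cancelˡ {x} {y} {z} x≉0 eq = linear₁ 1# (*-≈0-cancelˡ {x} {y + - z} x≉0
      (trans (solve 3 (λ x y z → x :* (y :- z) := x :* y :- x :* z) refl x y z)
        (trans (+-congʳ eq) (-‿inverseʳ _))))
    (solve 2 (λ y z → y :+ con (+ 1) :* con (+ 0) := z :+ con (+ 1) :* (y :- z)) refl y z)

  *-≤-cancelˡ : ∀ {x y} → 0# < x → 0# ≤ x * y → 0# ≤ y
  *-≤-cancelˡ p (inj₁ q) = inj₁ (*-pos-cancelˡ p q)
  *-≤-cancelˡ p (inj₂ q) = inj₂ (sym (*-≈0-cancelˡ (0<⇒≉0 p) (sym q)))

  inverse-pos : ∀ {x} → 0# < x → ∃[ y ] 0# < y × x * y ≈ 1#
  inverse-pos {x} p with y , xy≈1 ← inverse x (0<⇒≉0 p) = y , *-pos-cancelˡ p (<-respʳ-≈ (sym xy≈1) 0<1) , xy≈1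

  0<⟦⟧ : ∀ n → 0# < ⟦ + suc n ⟧
  0<⟦⟧ zero    = 0<1
  0<⟦⟧ (suc n) = 0<+ (0<⟦⟧ n) 0<1

  0≤⟦⟧ : ∀ {i} → + 0 ℤ.≤ i → 0# ≤ ⟦ i ⟧
  0≤⟦⟧ {+ zero}  _ = inj₂ refl
  0≤⟦⟧ {+ suc n} _ = inj₁ (0<⟦⟧ n)

  0<⟦⟧′ : ∀ {i} → + 0 ℤ.< i → 0# < ⟦ i ⟧
  0<⟦⟧′ {+ suc n} _ = 0<⟦⟧ n
  0<⟦⟧′ {+ zero} (ℤ.+<+ ())

  ⟦⟧<0 : ∀ {i} → i ℤ.< + 0 → ⟦ i ⟧ < 0#
  ⟦⟧<0 { -[1+ n ]} _ = 0<⇒-<0 (0<⟦⟧ n)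
  ⟦⟧<0 {+ n} (ℤ.+<+ ())

  ⟦⟧-injective : ∀ i j → ⟦ i ⟧ ≈ ⟦ j ⟧ → i ≡ j
  ⟦⟧-injective i j eq = ℤ.i-j≡0⇒i≡j i j (nonzero (i ℤ.- j)
    (trans (⟦⟧-+ i (ℤ.- j)) (trans (+-congˡ (⟦⟧-neg j)) (trans (+-congʳ eq) (-‿inverseʳ _)))))
    where
    nonzero : ∀ k → ⟦ k ⟧ ≈ 0# → k ≡ + 0
    nonzero (+ zero)   _ = ≡.refl
    nonzero (+ suc n)  p = ⊥-elim (0<⇒≉0 (0<⟦⟧ n) p)
    nonzero (-[1+ n ]) p = ⊥-elim (<-irrefl p (0<⇒-<0 (0<⟦⟧ n)))

-- Barycentric coordinates

module Barycentric (ℝ : CompleteOrderedField) where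
  open CompleteOrderedField ℝ
  open FieldProperties ℝ
  open Pinwheel ℝ
  open Triangle
  open import Relation.Binary.Reasoning.Setoid setoid
  open Setoid pointSetoid public using () renaming (refl to ≈ₚ-refl; sym to ≈ₚ-sym; trans to ≈ₚ-trans)

  ⊕-cong : ∀ {p p′ q q′} → p ≈ₚ p′ → q ≈ₚ q′ → p ⊕ q ≈ₚ p′ ⊕ q′
  ⊕-cong (a , b) (c , d) = +-cong a c , +-cong b d

  ·-cong : ∀ {r r′ p p′} → r ≈ r′ → p ≈ₚ p′ → r · p ≈ₚ r′ · p′
  ·-cong e (a , b) = *-cong e a , *-cong e b

  Weights : Set
  Weights = Fin 3 → Carrier

  total : Weights → Carrier
  total w = w 0F + w 1F + w 2F

  lin : Weights → (Fin 3 → Carrier) → Carrier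
  lin w f = w 0F * f 0F + w 1F * f 1F + w 2F * f 2F

  comb : Triangle → Weights → Point
  comb T w = w 0F · right T ⊕ w 1F · short T ⊕ w 2F · long T

  forFin3 : ∀ {ℓ} {Q : Fin 3 → Set ℓ} → Q 0F → Q 1F → Q 2F → ∀ i → Q i
  forFin3 a b c 0F = a
  forFin3 a b c 1F = b
  forFin3 a b c 2F = c

  weights : Carrier → Carrier → Carrier → Weights
  weights = forFin3

  lin-congˡ : ∀ {v w} f → (∀ i → v i ≈ w i) → lin v f ≈ lin w f
  lin-congˡ f e = +-cong (+-cong (*-congʳ (e 0F)) (*-congʳ (e 1F))) (*-congʳ (e 2F))

  lin-congʳ : ∀ v {f g} → (∀ i → f i ≈ g i) → lin v f ≈ lin v g
  lin-congʳ v e = +-cong (+-cong (*-congˡ (e 0F)) (*-congˡ (e 1F))) (*-congˡ (e 2F))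

  comb-congˡ : ∀ {T U} v → T ≈ₜ U → comb T v ≈ₚ comb U v
  comb-congˡ v t = ⊕-cong (⊕-cong (·-cong refl (t 0F)) (·-cong refl (t 1F))) (·-cong refl (t 2F))

  comb-congʳ : ∀ T {v w} → (∀ i → v i ≈ w i) → comb T v ≈ₚ comb T w
  comb-congʳ T e = ⊕-cong (⊕-cong (·-cong (e 0F) ≈ₚ-refl) (·-cong (e 1F) ≈ₚ-refl)) (·-cong (e 2F) ≈ₚ-refl)

  ≈ₜ-refl : ∀ {T} → T ≈ₜ T
  ≈ₜ-refl i = ≈ₚ-refl

  ≈ₜ-sym : ∀ {T U} → T ≈ₜ U → U ≈ₜ T
  ≈ₜ-sym e i = ≈ₚ-sym (e i)

  ≈ₜ-trans : ∀ {T U V} → T ≈ₜ U → U ≈ₜ V → T ≈ₜ V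
  ≈ₜ-trans e f i = ≈ₚ-trans (e i) (f i)

  record Coordinates (T : Triangle) (x : Point) : Set where
    field
      w     : Weights
      sum≈1 : total w ≈ 1#
      at    : x ≈ₚ comb T w

  open Coordinates public

  coordinates-resp : ∀ {T U x y} → T ≈ₜ U → x ≈ₚ y → Coordinates T x → Coordinates U y
  coordinates-resp t e c = record { w = w c ; sum≈1 = sum≈1 c
    ; at = ≈ₚ-trans (≈ₚ-sym e) (≈ₚ-trans (at c) (comb-congˡ (w c) t)) }

  inTriangle⁻ : ∀ {T x} → InTriangle T x → Σ[ c ∈ Coordinates T x ] (∀ i → 0# ≤ w c i)
  inTriangle⁻ (a , b , c , pa , pb , pc , s , e) =
    record { w = weights a b c ; sum≈1 = s ; at = e } , forFin3 pa pb pc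

  inTriangle⁺ : ∀ {T x} (c : Coordinates T x) → (∀ i → 0# ≤ w c i) → InTriangle T x
  inTriangle⁺ c p = w c 0F , w c 1F , w c 2F , p 0F , p 1F , p 2F , sum≈1 c , at c

  inInterior⁻ : ∀ {T x} → InInterior T x → Σ[ c ∈ Coordinates T x ] (∀ i → 0# < w c i)
  inInterior⁻ (a , b , c , pa , pb , pc , s , e) =
    record { w = weights a b c ; sum≈1 = s ; at = e } , forFin3 pa pb pc

  inInterior⁺ : ∀ {T x} (c : Coordinates T x) → (∀ i → 0# < w c i) → InInterior T x
  inInterior⁺ c p = w c 0F , w c 1F , w c 2F , p 0F , p 1F , p 2F , sum≈1 c , at c

  inTriangle-resp : ∀ {T U x y} → T ≈ₜ U → x ≈ₚ y → InTriangle T x → InTriangle U y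
  inTriangle-resp {T} t e h = let c , p = inTriangle⁻ {T} h in inTriangle⁺ (coordinates-resp t e c) p

  area : Triangle → Carrier
  area (△ (px , py) (qx , qy) (rx , ry)) = (qx + - px) * (ry + - py) + - ((qy + - py) * (rx + - px))

  NonDegenerate : Triangle → Set
  NonDegenerate T = ¬ (area T ≈ 0#)

  -- The coordinates of x with respect to T, multiplied by the area of T; s is
  -- the total weight, so that the expression is linear in (s , x).
  cramer : Triangle → Carrier → Point → Weights
  cramer (△ (px , py) (qx , qy) (rx , ry)) s (x , y) = weights (s * a + - β + - γ) β γ
    where
    a = (qx + - px) * (ry + - py) + - ((qy + - py) * (rx + - px))
    β = (x + - (s * px)) * (ry + - py) + - ((y + - (s * py)) * (rx + - px))
    γ = (qx + - px) * (y + - (s * py)) + - ((qy + - py) * (x + - (s * px)))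

  cramer-cong : ∀ T {s s′ x x′} → s ≈ s′ → x ≈ₚ x′ → ∀ i → cramer T s x i ≈ cramer T s′ x′ i
  cramer-cong (△ (px , py) (qx , qy) (rx , ry)) {s} {s′} {x , y} {x′ , y′} es (ex , ey) =
    forFin3 (+-cong (+-cong (*-congʳ es) (-‿cong β)) (-‿cong γ)) β γ
    where
    dx = +-cong ex (-‿cong (*-congʳ {px} es))
    dy = +-cong ey (-‿cong (*-congʳ {py} es))
    β = +-cong (*-congʳ dx) (-‿cong (*-congʳ dy))
    γ = +-cong (*-congˡ dy) (-‿cong (*-congˡ dx))

  cramer-comb : ∀ T v i → cramer T (total v) (comb T v) i ≈ v i * area T
  cramer-comb (△ (px , py) (qx , qy) (rx , ry)) v = forFin3
    (solve 9 (λ px py qx qy rx ry a b c →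
        let s = a :+ b :+ c ; X = a :* px :+ b :* qx :+ c :* rx ; Y = a :* py :+ b :* qy :+ c :* ry
            A = (qx :- px) :* (ry :- py) :- (qy :- py) :* (rx :- px) in
        s :* A :- ((X :- s :* px) :* (ry :- py) :- (Y :- s :* py) :* (rx :- px))
               :- ((qx :- px) :* (Y :- s :* py) :- (qy :- py) :* (X :- s :* px)) := a :* A)
      refl px py qx qy rx ry (v 0F) (v 1F) (v 2F))
    (solve 9 (λ px py qx qy rx ry a b c →
        let s = a :+ b :+ c ; X = a :* px :+ b :* qx :+ c :* rx ; Y = a :* py :+ b :* qy :+ c :* ry
            A = (qx :- px) :* (ry :- py) :- (qy :- py) :* (rx :- px) in
        (X :- s :* px) :* (ry :- py) :- (Y :- s :* py) :* (rx :- px) := b :* A)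
      refl px py qx qy rx ry (v 0F) (v 1F) (v 2F))
    (solve 9 (λ px py qx qy rx ry a b c →
        let s = a :+ b :+ c ; X = a :* px :+ b :* qx :+ c :* rx ; Y = a :* py :+ b :* qy :+ c :* ry
            A = (qx :- px) :* (ry :- py) :- (qy :- py) :* (rx :- px) in
        (qx :- px) :* (Y :- s :* py) :- (qy :- py) :* (X :- s :* px) := c :* A)
      refl px py qx qy rx ry (v 0F) (v 1F) (v 2F))

  weights-unique : ∀ {T} → NonDegenerate T → ∀ {v v′} → total v ≈ total v′ → comb T v ≈ₚ comb T v′ →
                   ∀ i → v i ≈ v′ i
  weights-unique {T} nd {v} {v′} es ec i = *-cancelˡ nd (begin
    area T * v i                       ≈⟨ *-comm _ _ ⟩
    v i * area T                       ≈⟨ cramer-comb T v i ⟨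
    cramer T (total v) (comb T v) i    ≈⟨ cramer-cong T es ec i ⟩
    cramer T (total v′) (comb T v′) i  ≈⟨ cramer-comb T v′ i ⟩
    v′ i * area T                      ≈⟨ *-comm _ _ ⟩
    area T * v′ i                      ∎)

  coordinates-unique : ∀ {T x y} → NonDegenerate T → (c : Coordinates T x) (d : Coordinates T y) →
                       x ≈ₚ y → ∀ i → w c i ≈ w d i
  coordinates-unique nd c d e = weights-unique nd (trans (sum≈1 c) (sym (sum≈1 d)))
    (≈ₚ-trans (≈ₚ-sym (at c)) (≈ₚ-trans e (at d)))

  coordinates : ∀ {T} → NonDegenerate T → ∀ x → Coordinates T x
  coordinates {T@(△ (px , py) (qx , qy) (rx , ry))} nd P@(x , y) with δ , eq ← inverse (area T) nd = record
    { w     = λ i → δ * cramer T 1# P i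
    ; sum≈1 = trans (solve 4 (λ δ A b c → δ :* (con (+ 1) :* A :- b :- c) :+ δ :* b :+ δ :* c := A :* δ)
                refl δ (area T) (cramer T 1# P 1F) (cramer T 1# P 2F)) eq
    ; at    = sym (coordinate px qx rx x (solve 8 (λ px py qx qy rx ry x y →
                let A = (qx :- px) :* (ry :- py) :- (qy :- py) :* (rx :- px)
                    B = (x :- con (+ 1) :* px) :* (ry :- py) :- (y :- con (+ 1) :* py) :* (rx :- px)
                    C = (qx :- px) :* (y :- con (+ 1) :* py) :- (qy :- py) :* (x :- con (+ 1) :* px)
                in (con (+ 1) :* A :- B :- C) :* px :+ B :* qx :+ C :* rx := A :* x)
                refl px py qx qy rx ry x y))
            , sym (coordinate py qy ry y (solve 8 (λ px py qx qy rx ry x y →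
                let A = (qx :- px) :* (ry :- py) :- (qy :- py) :* (rx :- px)
                    B = (x :- con (+ 1) :* px) :* (ry :- py) :- (y :- con (+ 1) :* py) :* (rx :- px)
                    C = (qx :- px) :* (y :- con (+ 1) :* py) :- (qy :- py) :* (x :- con (+ 1) :* px)
                in (con (+ 1) :* A :- B :- C) :* py :+ B :* qy :+ C :* ry := A :* y)
                refl px py qx qy rx ry x y))
    }
    where
    κ : Weights
    κ = cramer T 1# P
    coordinate : ∀ a b c t → κ 0F * a + κ 1F * b + κ 2F * c ≈ area T * t →
                 δ * κ 0F * a + δ * κ 1F * b + δ * κ 2F * c ≈ t
    coordinate a b c t e = begin
      δ * κ 0F * a + δ * κ 1F * b + δ * κ 2F * c
        ≈⟨ solve 7 (λ δ k l m a b c → δ :* k :* a :+ δ :* l :* b :+ δ :* m :* c := δ :* (k :* a :+ l :* b :+ m :* c))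
             refl δ (κ 0F) (κ 1F) (κ 2F) a b c ⟩
      δ * (κ 0F * a + κ 1F * b + κ 2F * c)  ≈⟨ *-congˡ e ⟩
      δ * (area T * t)                      ≈⟨ solve 3 (λ δ A t → δ :* (A :* t) := A :* δ :* t) refl δ (area T) t ⟩
      area T * δ * t                        ≈⟨ *-congʳ eq ⟩
      1# * t                                ≈⟨ *-identityˡ t ⟩
      t                                     ∎

  mix : Carrier → Carrier → Carrier → Carrier
  mix ε a b = (1# + - ε) * a + ε * b

  mixₚ : Carrier → Point → Point → Point
  mixₚ ε (x , y) (x′ , y′) = mix ε x x′ , mix ε y y′

  mix-coordinates : ∀ ε {T x y} → Coordinates T x → Coordinates T y → Coordinates T (mixₚ ε x y)
  mix-coordinates ε {T} c d = record
    { w     = λ i → mix ε (w c i) (w d i)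
    ; sum≈1 = begin
        total (λ i → mix ε (w c i) (w d i))
          ≈⟨ solve 7 (λ e a b c k l m → let f = con (+ 1) :- e in
               (f :* a :+ e :* k) :+ (f :* b :+ e :* l) :+ (f :* c :+ e :* m) := f :* (a :+ b :+ c) :+ e :* (k :+ l :+ m))
             refl ε (w c 0F) (w c 1F) (w c 2F) (w d 0F) (w d 1F) (w d 2F) ⟩
        mix ε (total (w c)) (total (w d))  ≈⟨ +-cong (*-congˡ (sum≈1 c)) (*-congˡ (sum≈1 d)) ⟩
        mix ε 1# 1#                        ≈⟨ solve 1 (λ e → (con (+ 1) :- e) :* con (+ 1) :+ e :* con (+ 1) := con (+ 1)) refl ε ⟩
        1#                                 ∎
    ; at    = coordinate (λ i → proj₁ (corner T i)) (proj₁ (at c)) (proj₁ (at d))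
            , coordinate (λ i → proj₂ (corner T i)) (proj₂ (at c)) (proj₂ (at d))
    }
    where
    coordinate : ∀ f {x y} → x ≈ lin (w c) f → y ≈ lin (w d) f →
                 mix ε x y ≈ lin (λ i → mix ε (w c i) (w d i)) f
    coordinate f {x} {y} p q = begin
      mix ε x y                              ≈⟨ +-cong (*-congˡ p) (*-congˡ q) ⟩
      mix ε (lin (w c) f) (lin (w d) f)
        ≈⟨ solve 10 (λ e a b c k l m x y z → let f = con (+ 1) :- e in
             f :* (a :* x :+ b :* y :+ c :* z) :+ e :* (k :* x :+ l :* y :+ m :* z)
             := (f :* a :+ e :* k) :* x :+ (f :* b :+ e :* l) :* y :+ (f :* c :+ e :* m) :* z)
           refl ε (w c 0F) (w c 1F) (w c 2F) (w d 0F) (w d 1F) (w d 2F) (f 0F) (f 1F) (f 2F) ⟩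
      lin (λ i → mix ε (w c i) (w d i)) f    ∎

  abstract
    half : Carrier
    half = proj₁ (inverse-pos (0<⟦⟧ 1))

    0<half : 0# < half
    0<half = proj₁ (proj₂ (inverse-pos (0<⟦⟧ 1)))

    2*half : 2# * half ≈ 1#
    2*half = proj₂ (proj₂ (inverse-pos (0<⟦⟧ 1)))

  half+half : half + half ≈ 1#
  half+half = trans (solve 1 (λ h → h :+ h := con (+ 2) :* h) refl half) 2*half

  0<1-half : 0# < 1# + - half
  0<1-half = <-respʳ-≈ (linear₁ 1# half+half
    (solve 1 (λ h → h :+ con (+ 1) :* con (+ 1) := con (+ 1) :- h :+ con (+ 1) :* (h :+ h)) refl half)) 0<half

  Small : Carrier → Set
  Small ε = 0# < ε × 0# < 1# + - ε

  -- Asking for all `η ≤ ε` rather than for one value makes the notion stable under conjunction: the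
  -- smaller bound serves both properties.
  EventuallySmall : (Carrier → Set) → Set
  EventuallySmall Q = ∃[ ε ] Small ε × (∀ η → 0# < η → η ≤ ε → Q η)

  ≤⇒0≤- : ∀ {x y} → x ≤ y → 0# ≤ y + - x
  ≤⇒0≤- (inj₁ p) = inj₁ (<⇒0<- p)
  ≤⇒0≤- (inj₂ p) = inj₂ (sym (trans (+-congˡ (-‿cong p)) (-‿inverseʳ _)))

  small-below : ∀ {ε ε′} → Small ε → ε′ ≤ ε → 0# < 1# + - ε′
  small-below {ε} {ε′} (_ , p) q = <-respʳ-≈
    (solve 2 (λ e f → (con (+ 1) :- e) :+ (e :- f) := con (+ 1) :- f) refl ε ε′) (0<+≤ p (≤⇒0≤- q))

  positive-near : ∀ {a b} → 0# < a ⊎ (a ≈ 0# × 0# < b) → EventuallySmall (λ η → 0# < mix η a b)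
  positive-near {a} {b} (inj₂ (a≈0 , 0<b)) = half , (0<half , 0<1-half) , λ ε p _ →
    <-respʳ-≈ (trans (solve 2 (λ e b → e :* b := (con (+ 1) :- e) :* con (+ 0) :+ e :* b) refl ε b)
                (+-congʳ (*-congˡ (sym a≈0)))) (*-pos p 0<b)
  positive-near {a} {b} (inj₁ 0<a) with compare 0# b
  ... | tri< 0<b _ _ = half , (0<half , 0<1-half) , λ ε p q →
    0<+ (*-pos (small-below (0<half , 0<1-half) q) 0<a) (*-pos p 0<b)
  ... | tri≈ _ 0≈b _ = half , (0<half , 0<1-half) , λ ε p q →
    0<+≤ (*-pos (small-below (0<half , 0<1-half) q) 0<a) (0≤* (inj₁ p) (inj₂ 0≈b))
  ... | tri> _ _ b<0 with D⁻¹ , 0<D⁻¹ , DD⁻¹≈1 ← inverse-pos (0<+ 0<a (<0⇒0<- b<0)) =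
    ε , (*-pos 0<half (*-pos 0<a 0<D⁻¹) , 0<1-ε) , λ ε′ _ q → <-respʳ-≈ (expansion ε′)
      (0<+≤ (*-pos 0<1-half 0<a) (0≤* (≤⇒0≤- q) (inj₁ (0<+ 0<a (<0⇒0<- b<0)))))
    where
    -- Half of the zero `a / (a - b)` of the decreasing linear function `η ↦ mix η a b`; at this
    -- point half of `a` is left.
    ε = half * (a * D⁻¹)
    0<1-ε : 0# < 1# + - ε
    0<1-ε = <-respʳ-≈ (linear₂ 1# (a * D⁻¹) DD⁻¹≈1 half+half
      (solve 4 (λ h a b d → :- b :* d :+ (h :* (a :* d)) :+ (con (+ 1) :* con (+ 1) :+ a :* d :* con (+ 1))
        := con (+ 1) :- h :* (a :* d) :+ (con (+ 1) :* ((a :- b) :* d) :+ a :* d :* (h :+ h))) refl half a b D⁻¹))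
      (0<+ (*-pos (<0⇒0<- b<0) 0<D⁻¹) (*-pos 0<half (*-pos 0<a 0<D⁻¹)))
    expansion : ∀ ε′ → (1# + - half) * a + (ε + - ε′) * (a + - b) ≈ mix ε′ a b
    expansion ε′ = linear₁ (half * a) DD⁻¹≈1
      (solve 5 (λ h a b d e → (con (+ 1) :- h) :* a :+ (h :* (a :* d) :- e) :* (a :- b) :+ h :* a :* con (+ 1)
        := (con (+ 1) :- e) :* a :+ e :* b :+ h :* a :* ((a :- b) :* d)) refl half a b D⁻¹ ε′)

  eventually-× : ∀ {Q R} → EventuallySmall Q → EventuallySmall R → EventuallySmall (λ η → Q η × R η)
  eventually-× (ε , s , p) (ε′ , s′ , p′) with compare ε ε′
  ... | tri< ε<ε′ _ _ = ε , s , λ η r q → p η r q , p′ η r (≤-trans q (inj₁ ε<ε′))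
    where ≤-trans = ToNonStrict.trans _≈_ _<_ isEquivalence <-resp-≈ <-trans
  ... | tri≈ _ ε≈ε′ _ = ε , s , λ η r q → p η r q , p′ η r (≤-trans q (inj₂ ε≈ε′))
    where ≤-trans = ToNonStrict.trans _≈_ _<_ isEquivalence <-resp-≈ <-trans
  ... | tri> _ _ ε′<ε = ε′ , s′ , λ η r q → p η r (≤-trans q (inj₁ ε′<ε)) , p′ η r q
    where ≤-trans = ToNonStrict.trans _≈_ _<_ isEquivalence <-resp-≈ <-trans

  -- z lies in the closed triangle V and y in its interior, so the points of the
  -- segment from z to y, except z, are inside V; near z they are also inside N.
  interiors-meet : ∀ {N V z y} (c : Coordinates N z) (d : Coordinates N y) →
    (∀ i → 0# < w c i ⊎ (w c i ≈ 0# × 0# < w d i)) → InTriangle V z → InInterior V y →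
    ∃[ x ] InInterior N x × InInterior V x
  interiors-meet {N} {V} c d cone zV yV
    with ε , s@(0<ε , 0<1-ε) , p ← eventually-× (positive-near (cone 0F))
                                     (eventually-× (positive-near (cone 1F)) (positive-near (cone 2F)))
       | a , 0≤a ← inTriangle⁻ {V} zV
       | b , 0<b ← inInterior⁻ {V} yV
    with p₀ , p₁ , p₂ ← p ε 0<ε (inj₂ refl) = _
    , inInterior⁺ (mix-coordinates ε c d) (forFin3 p₀ p₁ p₂)
    , inInterior⁺ (mix-coordinates ε a b) (λ i → 0≤+< (0≤* (inj₁ 0<1-ε) (0≤a i)) (*-pos 0<ε (0<b i)))

  -- The rows of A are the barycentric coordinates of the corners.
  opaque
    tri : (Fin 3 → Weights) → Triangle → Triangle
    tri A T = △ (comb T (A 0F)) (comb T (A 1F)) (comb T (A 2F))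

    corner-tri : ∀ A T i → corner (tri A T) i ≈ₚ comb T (A i)
    corner-tri A T = forFin3 ≈ₚ-refl ≈ₚ-refl ≈ₚ-refl

  infixl 7 _∙_
  _∙_ : Weights → (Fin 3 → Weights) → Weights
  (v ∙ A) j = lin v (λ i → A i j)

  lin-∙ : ∀ v A f → lin (v ∙ A) f ≈ lin v (λ i → lin (A i) f)
  lin-∙ v A f = solve 15 (λ v₀ v₁ v₂ a b c d e f g h i x y z →
      (v₀ :* a :+ v₁ :* d :+ v₂ :* g) :* x :+ (v₀ :* b :+ v₁ :* e :+ v₂ :* h) :* y :+ (v₀ :* c :+ v₁ :* f :+ v₂ :* i) :* z
      := v₀ :* (a :* x :+ b :* y :+ c :* z) :+ v₁ :* (d :* x :+ e :* y :+ f :* z) :+ v₂ :* (g :* x :+ h :* y :+ i :* z))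
    refl (v 0F) (v 1F) (v 2F) (A 0F 0F) (A 0F 1F) (A 0F 2F) (A 1F 0F) (A 1F 1F) (A 1F 2F)
    (A 2F 0F) (A 2F 1F) (A 2F 2F) (f 0F) (f 1F) (f 2F)

  opaque
    unfolding tri

    comb-tri : ∀ A T v → comb (tri A T) v ≈ₚ comb T (v ∙ A)
    comb-tri A T v = sym (lin-∙ v A (λ i → proj₁ (corner T i))) , sym (lin-∙ v A (λ i → proj₂ (corner T i)))

  tri-cong : ∀ A {T U} → T ≈ₜ U → tri A T ≈ₜ tri A U
  tri-cong A {T} {U} t i = ≈ₚ-trans (corner-tri A T i) (≈ₚ-trans (comb-congˡ (A i) t) (≈ₚ-sym (corner-tri A U i)))

  Affine : (Fin 3 → Weights) → Set
  Affine A = ∀ i → total (A i) ≈ 1#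

  total-∙ : ∀ A → Affine A → ∀ v → total (v ∙ A) ≈ total v
  total-∙ A s v = begin
    total (v ∙ A)                ≈⟨ solve 12 (λ v₀ v₁ v₂ a b c d e f g h i →
        (v₀ :* a :+ v₁ :* d :+ v₂ :* g) :+ (v₀ :* b :+ v₁ :* e :+ v₂ :* h) :+ (v₀ :* c :+ v₁ :* f :+ v₂ :* i)
        := v₀ :* (a :+ b :+ c) :+ v₁ :* (d :+ e :+ f) :+ v₂ :* (g :+ h :+ i))
      refl (v 0F) (v 1F) (v 2F) (A 0F 0F) (A 0F 1F) (A 0F 2F) (A 1F 0F) (A 1F 1F) (A 1F 2F) (A 2F 0F) (A 2F 1F) (A 2F 2F) ⟩
    lin v (λ i → total (A i))    ≈⟨ lin-congʳ v s ⟩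
    lin v (λ _ → 1#)             ≈⟨ +-cong (+-cong (*-identityʳ _) (*-identityʳ _)) (*-identityʳ _) ⟩
    total v                      ∎

  coordinates-tri : ∀ A → Affine A → ∀ {T x} → Coordinates (tri A T) x → Coordinates T x
  coordinates-tri A s {T} c = record
    { w     = w c ∙ A
    ; sum≈1 = trans (total-∙ A s (w c)) (sum≈1 c)
    ; at    = ≈ₚ-trans (at c) (comb-tri A T (w c))
    }

  det₂ : (Fin 3 → Weights) → Carrier
  det₂ A = (A 1F 1F + - A 0F 1F) * (A 2F 2F + - A 0F 2F) + - ((A 1F 2F + - A 0F 2F) * (A 2F 1F + - A 0F 1F))

  opaque
    unfolding tri

    -- As the rows have total 1, the edge vectors of `tri A T` are combinations of those of `T`,
    -- with the entries of the determinant `det₂ A` as coefficients.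
    area-tri : ∀ A → Affine A → ∀ T → area (tri A T) ≈ det₂ A * area T
    area-tri A s T@(△ (px , py) (qx , qy) (rx , ry)) = begin
      area (tri A T)
        ≈⟨ +-cong (*-cong (difference 1F px qx rx) (difference 2F py qy ry))
                  (-‿cong (*-cong (difference 1F py qy ry) (difference 2F px qx rx))) ⟩
      (b * u₁ + c * v₁) * (d * u₂ + e * v₂) + - ((b * u₂ + c * v₂) * (d * u₁ + e * v₁))
        ≈⟨ solve 8 (λ b c d e u₁ u₂ v₁ v₂ →
             (b :* u₁ :+ c :* v₁) :* (d :* u₂ :+ e :* v₂) :- (b :* u₂ :+ c :* v₂) :* (d :* u₁ :+ e :* v₁)
             := (b :* e :- c :* d) :* (u₁ :* v₂ :- u₂ :* v₁)) refl b c d e u₁ u₂ v₁ v₂ ⟩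
      det₂ A * area T ∎
      where
      b c d e u₁ u₂ v₁ v₂ : Carrier
      b = A 1F 1F + - A 0F 1F
      c = A 1F 2F + - A 0F 2F
      d = A 2F 1F + - A 0F 1F
      e = A 2F 2F + - A 0F 2F
      u₁ = qx + - px
      u₂ = qy + - py
      v₁ = rx + - px
      v₂ = ry + - py
      difference : ∀ i x y z → lin (A i) (weights x y z) + - lin (A 0F) (weights x y z) ≈
                   (A i 1F + - A 0F 1F) * (y + - x) + (A i 2F + - A 0F 2F) * (z + - x)
      difference i x y z = linear₂ x (- x) (s i) (s 0F)
        (solve 9 (λ a b c d e f x y z →
          a :* x :+ b :* y :+ c :* z :- (d :* x :+ e :* y :+ f :* z) :+ (x :* con (+ 1) :+ :- x :* con (+ 1))
          := (b :- e) :* (y :- x) :+ (c :- f) :* (z :- x) :+ (x :* (a :+ b :+ c) :+ :- x :* (d :+ e :+ f)))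
         refl (A i 0F) (A i 1F) (A i 2F) (A 0F 0F) (A 0F 1F) (A 0F 2F) x y z)

  nonDegenerate-tri : ∀ A → Affine A → ¬ (det₂ A ≈ 0#) → ∀ {T} → NonDegenerate T → NonDegenerate (tri A T)
  nonDegenerate-tri A s d {T} nd p = nd (*-≈0-cancelˡ d (trans (sym (area-tri A s T)) p))

  area-cong : ∀ {T U} → T ≈ₜ U → area T ≈ area U
  area-cong t = +-cong (*-cong (+-cong (proj₁ (t 1F)) (-‿cong (proj₁ (t 0F)))) (+-cong (proj₂ (t 2F)) (-‿cong (proj₂ (t 0F)))))
    (-‿cong (*-cong (+-cong (proj₂ (t 1F)) (-‿cong (proj₂ (t 0F)))) (+-cong (proj₁ (t 2F)) (-‿cong (proj₁ (t 0F))))))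

  nonDegenerate-resp : ∀ {T U} → T ≈ₜ U → NonDegenerate T → NonDegenerate U
  nonDegenerate-resp t nd p = nd (trans (area-cong t) p)

  barycentric : ∀ {T} → NonDegenerate T → Point → Weights
  barycentric nd x = w (coordinates nd x)

  barycentric-mix : ∀ {T} (nd : NonDegenerate T) ε x y i →
                    barycentric nd (mixₚ ε x y) i ≈ mix ε (barycentric nd x i) (barycentric nd y i)
  barycentric-mix nd ε x y = coordinates-unique nd (coordinates nd _)
    (mix-coordinates ε (coordinates nd x) (coordinates nd y)) ≈ₚ-refl

  vertexWeights : Fin 3 → Weights
  vertexWeights = forFin3 (weights 1# 0# 0#) (weights 0# 1# 0#) (weights 0# 0# 1#)

  vertexWeights-refl : ∀ i → vertexWeights i i ≈ 1#
  vertexWeights-refl = forFin3 refl refl refl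

  corner-coordinates : ∀ T i → Coordinates T (corner T i)
  corner-coordinates T i = record { w = vertexWeights i ; sum≈1 = sums i ; at = places i }
    where
    sums : ∀ i → total (vertexWeights i) ≈ 1#
    sums = forFin3 (trans (+-congʳ (+-identityʳ _)) (+-identityʳ _)) (trans (+-congʳ (+-identityˡ _)) (+-identityʳ _))
             (trans (+-congʳ (+-identityˡ _)) (+-identityˡ _))
    select : ∀ i f → f i ≈ lin (vertexWeights i) f
    select = forFin3
      (λ f → solve 3 (λ a b c → a := con (+ 1) :* a :+ con (+ 0) :* b :+ con (+ 0) :* c) refl (f 0F) (f 1F) (f 2F))
      (λ f → solve 3 (λ a b c → b := con (+ 0) :* a :+ con (+ 1) :* b :+ con (+ 0) :* c) refl (f 0F) (f 1F) (f 2F))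
      (λ f → solve 3 (λ a b c → c := con (+ 0) :* a :+ con (+ 0) :* b :+ con (+ 1) :* c) refl (f 0F) (f 1F) (f 2F))
    places : ∀ i → corner T i ≈ₚ comb T (vertexWeights i)
    places i = select i (λ k → proj₁ (corner T k)) , select i (λ k → proj₂ (corner T k))

  ≈0? : ∀ x → (x ≈ 0#) ⊎ ¬ (x ≈ 0#)
  ≈0? x with compare x 0#
  ... | tri< _ p _ = inj₂ p
  ... | tri≈ _ p _ = inj₁ p
  ... | tri> _ p _ = inj₂ p

  -- Not the centroid, but an interior point whose weights need only `half`.
  centreWeights : Weights
  centreWeights = weights half (half * half) (half * half)

  centre-coordinates : ∀ T → Coordinates T (comb T centreWeights)
  centre-coordinates T = record { w = centreWeights
    ; sum≈1 = linear₁ (1# + half) half+half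
        (solve 1 (λ h → h :+ h :* h :+ h :* h :+ (con (+ 1) :+ h) :* con (+ 1)
                     := con (+ 1) :+ (con (+ 1) :+ h) :* (h :+ h)) refl half)
    ; at = ≈ₚ-refl }

  0<centreWeights : ∀ i → 0# < centreWeights i
  0<centreWeights = forFin3 0<half (*-pos 0<half 0<half) (*-pos 0<half 0<half)

  -- If the centre of `V` lies on the line, a small step towards corner `i` of `T` leaves the line,
  -- because that corner has weight 1, and stays inside `V`.
  interior-off-line : ∀ {T V} (nd : NonDegenerate T) → NonDegenerate V → ∀ i →
                      ∃[ y ] InInterior V y × ¬ (barycentric nd y i ≈ 0#)
  interior-off-line {T} {V} nd ndV i with ≈0? (barycentric nd (comb V centreWeights) i)
  ... | inj₂ p = _ , inInterior⁺ (centre-coordinates V) 0<centreWeights , p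
  ... | inj₁ p
    with d ← coordinates ndV (corner T i)
    with ε , (0<ε , _) , q ← eventually-× (positive-near {b = w d 0F} (inj₁ (0<centreWeights 0F)))
           (eventually-× (positive-near {b = w d 1F} (inj₁ (0<centreWeights 1F)))
                         (positive-near {b = w d 2F} (inj₁ (0<centreWeights 2F))))
    with q₀ , q₁ , q₂ ← q ε 0<ε (inj₂ refl) =
    _ , inInterior⁺ (mix-coordinates ε (centre-coordinates V) d) (forFin3 q₀ q₁ q₂)
      , λ r → 0<⇒≉0 0<ε (begin
        ε                  ≈⟨ solve 1 (λ e → e := (con (+ 1) :- e) :* con (+ 0) :+ e :* con (+ 1)) refl ε ⟩
        mix ε 0# 1#        ≈⟨ +-cong (*-congˡ p) (*-congˡ (trans (coordinates-unique nd (coordinates nd (corner T i))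
                                (corner-coordinates T i) ≈ₚ-refl i) (vertexWeights-refl i))) ⟨
        mix ε _ _          ≈⟨ barycentric-mix nd ε _ _ i ⟨
        barycentric nd (mixₚ ε (comb V centreWeights) (corner T i)) i  ≈⟨ r ⟩
        0#                 ∎)

  -- If `y` is off the first line only and `z` off the second only, each of the two weights of their
  -- midpoint is half of a nonzero one.
  interior-off-lines : ∀ {T V} (nd : NonDegenerate T) → NonDegenerate V → ∀ i j →
                       ∃[ y ] InInterior V y × ¬ (barycentric nd y i ≈ 0#) × ¬ (barycentric nd y j ≈ 0#)
  interior-off-lines {T} {V} nd ndV i j
    with y , yV , p ← interior-off-line nd ndV i
       | z , zV , q ← interior-off-line nd ndV j
    with ≈0? (barycentric nd y j) | ≈0? (barycentric nd z i)
  ... | inj₂ r | _ = y , yV , p , r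
  ... | inj₁ _ | inj₂ r = z , zV , r , q
  ... | inj₁ r | inj₁ s
    with c , 0<c ← inInterior⁻ {V} yV | d , 0<d ← inInterior⁻ {V} zV =
    _ , inInterior⁺ (mix-coordinates half c d) (λ k → 0<+ (*-pos 0<1-half (0<c k)) (*-pos 0<half (0<d k)))
      , (λ e → p (*-≈0-cancelˡ (0<⇒≉0 0<1-half) (trans (sym (+-identityʳ _)) (trans (+-congˡ (sym (trans (*-congˡ s) (zeroʳ _))))
          (trans (sym (barycentric-mix nd half y z i)) e)))))
      , (λ e → q (*-≈0-cancelˡ (0<⇒≉0 0<half) (trans (sym (+-identityˡ _)) (trans (+-congʳ (sym (trans (*-congˡ r) (zeroʳ _))))
          (trans (sym (barycentric-mix nd half y z j)) e)))))

-- Integer matrices of relative positions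

-- A row holds barycentric coordinates in tenths, a matrix the three corners of
-- a triangle (right, short, long) in the coordinates of another one.
Row Matrix : Set
Row    = Fin 3 → ℤ
Matrix = Fin 3 → Row

row : ℤ → ℤ → ℤ → Row
row a b c = lookup (a ∷ b ∷ c ∷ [])

matrix : Row → Row → Row → Matrix
matrix a b c = lookup (a ∷ b ∷ c ∷ [])

dot : Row → Row → ℤ
dot a b = a 0F ℤ.* b 0F ℤ.+ a 1F ℤ.* b 1F ℤ.+ a 2F ℤ.* b 2F

column : Matrix → Fin 3 → Row
column M j i = M i j

infixl 7 _⊠_ _⊡_
_⊡_ : Row → Matrix → Row
(a ⊡ M) j = dot a (column M j)

-- The product is not divided by ten, so its entries are hundredths. Equations therefore compare
-- products with two factors on each side, and `identity`, ten times the unit matrix, fills in where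
-- a factor is missing.
_⊠_ : Matrix → Matrix → Matrix
(M ⊠ N) i = M i ⊡ N

Normalised : Row → Set
Normalised a = a 0F ℤ.+ a 1F ℤ.+ a 2F ≡ + 10

normalised? : ∀ a → Dec (Normalised a)
normalised? a = _ ℤ.≟ _

infix 4 _≐_ _≐?_
_≐_ : Matrix → Matrix → Set
M ≐ N = ∀ i j → M i j ≡ N i j

_≐?_ : ∀ M N → Dec (M ≐ N)
M ≐? N = all? λ i → all? λ j → M i j ℤ.≟ N i j

atRight atShort atLong : Row
atRight = row (+ 10) (+ 0) (+ 0)
atShort = row (+ 0) (+ 10) (+ 0)
atLong  = row (+ 0) (+ 0) (+ 10)

-- The corners and the midpoint of the long leg.
spot : Fin 4 → Row
spot = lookup (atRight ∷ atShort ∷ atLong ∷ row (+ 5) (+ 0) (+ 5) ∷ [])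

pattern mid = 3F

identity : Matrix
identity = matrix atRight atShort atLong

-- placedK has corners (0,0), (2,-1), (2,4), hence (x , y) has the weights
-- (2x - y)/5 and (x + 2y)/10 at the last two.
opaque
  pieceMatrix : Fin 5 → Matrix
  pieceMatrix = lookup
    ( matrix (row (+ 0) (+ 8) (+ 2)) (row (+ 0) (+ 10) (+ 0)) (row (+ 10) (+ 0) (+ 0))
    ∷ matrix (row (+ 5) (+ 4) (+ 1)) (row (+ 10) (+ 0) (+ 0)) (row (+ 5) (+ 0) (+ 5))
    ∷ matrix (row (+ 5) (+ 4) (+ 1)) (row (+ 0) (+ 8) (+ 2)) (row (+ 5) (+ 0) (+ 5))
    ∷ matrix (row (+ 0) (+ 4) (+ 6)) (row (+ 5) (+ 0) (+ 5)) (row (+ 0) (+ 8) (+ 2))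
    ∷ matrix (row (+ 0) (+ 4) (+ 6)) (row (+ 5) (+ 0) (+ 5)) (row (+ 0) (+ 0) (+ 10))
    ∷ [])

-- The long leg counts as two segments: the short leg, the half of the long leg
-- at the right angle, the other half, the hypotenuse.
Segment : Set
Segment = Fin 4

pattern shortLeg   = 0F
pattern innerHalf  = 1F
pattern outerHalf  = 2F
pattern hypotenuse = 3F

startOf endOf : Segment → Fin 4
startOf = lookup (0F ∷ 0F ∷ 3F ∷ 1F ∷ [])
endOf   = lookup (1F ∷ 3F ∷ 2F ∷ 2F ∷ [])

opposite : Segment → Fin 3
opposite = lookup (2F ∷ 1F ∷ 1F ∷ 0F ∷ [])

-- Floor division; that it is exact on the entries in question is among the finite checks.
halve quarter : ℤ → ℤ
halve i   = i ℤ./ℕ 2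
quarter i = i ℤ./ℕ 4

-- Not weights: each row lists one coordinate of the three corners of `placedK`. `rowK` does the
-- same for `K`.
placedRow : Fin 2 → Row
placedRow = lookup (row (+ 0) (+ 2) (+ 2) ∷ row (+ 0) -[1+ 0 ] (+ 4) ∷ [])

pieceCoordinates : Fin 5 → Fin 3 → Fin 2 → ℤ
pieceCoordinates i l = lookup (lookup (lookup
  ( ((+ 2 ∷ + 0 ∷ []) ∷ (+ 2 ∷ -[1+ 0 ] ∷ []) ∷ (+ 0 ∷ + 0 ∷ []) ∷ [])
  ∷ ((+ 1 ∷ + 0 ∷ []) ∷ (+ 0 ∷ + 0 ∷ []) ∷ (+ 1 ∷ + 2 ∷ []) ∷ [])
  ∷ ((+ 1 ∷ + 0 ∷ []) ∷ (+ 2 ∷ + 0 ∷ []) ∷ (+ 1 ∷ + 2 ∷ []) ∷ [])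
  ∷ ((+ 2 ∷ + 2 ∷ []) ∷ (+ 1 ∷ + 2 ∷ []) ∷ (+ 2 ∷ + 0 ∷ []) ∷ [])
  ∷ ((+ 2 ∷ + 2 ∷ []) ∷ (+ 1 ∷ + 2 ∷ []) ∷ (+ 2 ∷ + 4 ∷ []) ∷ [])
  ∷ []) i) l)

spotK : Fin 4 → Fin 2 → ℤ
spotK k = lookup (lookup ((+ 0 ∷ + 0 ∷ []) ∷ (+ 1 ∷ + 0 ∷ []) ∷ (+ 0 ∷ + 2 ∷ []) ∷ (+ 0 ∷ + 1 ∷ []) ∷ []) k)

rowK : Fin 2 → Row
rowK = lookup (row (+ 0) (+ 1) (+ 0) ∷ row (+ 0) (+ 0) (+ 2) ∷ [])

quadranceK : Fin 4 → Fin 4 → ℤ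
quadranceK a b = square (spotK a 0F ℤ.- spotK b 0F) ℤ.+ square (spotK a 1F ℤ.- spotK b 1F)
  where
  square : ℤ → ℤ
  square n = n ℤ.* n

-- A way in which a tile T can share a segment with a tile N beyond it: N in the
-- coordinates of T, the spots of N at the start and the end of the segment of T,
-- and the corner of N opposite to it.
record Move : Set where
  constructor move
  field
    segment            : Segment
    startSpot endSpot  : Fin 4
    apex               : Fin 3
    neighbour          : Matrix

open Move public

-- The moves which occur in ωⁿ(K): the closure of those inside one dissection under
-- the dissection of two neighbours.
moves : Fin 12 → Move
moves = lookup
  ( move shortLeg   0F 1F 2F (matrix (row (+ 10) (+ 0) (+ 0)) (row (+ 0) (+ 10) (+ 0)) (row (+ 20) (+ 0) -[1+ 9 ]))
  ∷ move shortLeg   3F 0F 1F (matrix (row (+ 0) (+ 10) (+ 0)) (row (+ 5) (+ 10) -[1+ 4 ]) (row (+ 20) -[1+ 9 ] (+ 0)))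
  ∷ move shortLeg   3F 2F 1F (matrix (row (+ 20) -[1+ 9 ] (+ 0)) (row (+ 25) -[1+ 9 ] -[1+ 4 ]) (row (+ 0) (+ 10) (+ 0)))
  ∷ move innerHalf  0F 3F 1F (matrix (row (+ 10) (+ 0) (+ 0)) (row (+ 20) -[1+ 9 ] (+ 0)) (row (+ 0) (+ 0) (+ 10)))
  ∷ move innerHalf  3F 0F 1F (matrix (row (+ 5) (+ 0) (+ 5)) (row (+ 15) -[1+ 9 ] (+ 5)) (row (+ 15) (+ 0) -[1+ 4 ]))
  ∷ move innerHalf  3F 2F 1F (matrix (row (+ 15) (+ 0) -[1+ 4 ]) (row (+ 25) -[1+ 9 ] -[1+ 4 ]) (row (+ 5) (+ 0) (+ 5)))
  ∷ move innerHalf  1F 0F 2F (matrix (row (+ 5) (+ 0) (+ 5)) (row (+ 10) (+ 0) (+ 0)) (row (+ 25) -[1+ 19 ] (+ 5)))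
  ∷ move outerHalf  3F 2F 1F (matrix (row (+ 10) (+ 0) (+ 0)) (row (+ 20) -[1+ 9 ] (+ 0)) (row (+ 0) (+ 0) (+ 10)))
  ∷ move outerHalf  0F 3F 1F (matrix (row (+ 5) (+ 0) (+ 5)) (row (+ 15) -[1+ 9 ] (+ 5)) (row -[1+ 4 ] (+ 0) (+ 15)))
  ∷ move outerHalf  0F 1F 2F (matrix (row (+ 5) (+ 0) (+ 5)) (row (+ 0) (+ 0) (+ 10)) (row (+ 25) -[1+ 19 ] (+ 5)))
  ∷ move hypotenuse 1F 2F 0F (matrix (row -[1+ 9 ] (+ 16) (+ 4)) (row (+ 0) (+ 10) (+ 0)) (row (+ 0) (+ 0) (+ 10)))
  ∷ move hypotenuse 2F 1F 0F (matrix (row -[1+ 9 ] (+ 10) (+ 10)) (row (+ 0) (+ 0) (+ 10)) (row (+ 0) (+ 10) (+ 0)))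
  ∷ [])

-- For two points on the side opposite `k`. That each other weight is positive at one of the two
-- ends at least makes it positive strictly between them.
Meets : Row → Row → Fin 3 → Set
Meets p q k = ∀ l → (l ≡ k × p l ≡ 0ℤ × q l ≡ 0ℤ) ⊎ (l ≢ k × 0ℤ ℤ.≤ p l × 0ℤ ℤ.≤ q l × (0ℤ ℤ.< p l ⊎ 0ℤ ℤ.< q l))

meets? : ∀ p q k → Dec (Meets p q k)
meets? p q k = all? λ l → (l Fin.≟ k ×-dec p l ℤ.≟ 0ℤ ×-dec q l ℤ.≟ 0ℤ) ⊎-dec
  (¬? (l Fin.≟ k) ×-dec 0ℤ ℤ.≤? p l ×-dec 0ℤ ℤ.≤? q l ×-dec (0ℤ ℤ.<? p l ⊎-dec 0ℤ ℤ.<? q l))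

-- Meant for `c` a column of the matrix of N, which holds the weights of the corners of N at one
-- corner of T: two corners of N lie on the line of the opposite side of T, and the corner `k` on
-- its far side. `Within` is the same with corner `k` on the near side.
Beyond : Fin 3 → Row → Set
Beyond k c = ∀ l → (l ≡ k × c l ℤ.< 0ℤ) ⊎ (l ≢ k × c l ≡ 0ℤ)

Within : Fin 3 → Row → Set
Within k c = ∀ l → (l ≡ k × 0ℤ ℤ.< c l) ⊎ (l ≢ k × c l ≡ 0ℤ)

-- If the second parent is in position `A` relative to the first, then its piece `j` is the
-- neighbour, by move `m`, of piece `i` of the first. With `A` the identity, both are pieces of one
-- parent.
Occurs : Fin 5 → Segment → Matrix → Set
Occurs i s A = ∃₂ λ j m → segment (moves m) ≡ s × neighbour (moves m) ⊠ pieceMatrix i ≐ pieceMatrix j ⊠ A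

occurs? : ∀ i s A → Dec (Occurs i s A)
occurs? i s A = any? λ j → any? λ m → segment (moves m) Fin.≟ s ×-dec
  neighbour (moves m) ⊠ pieceMatrix i ≐? pieceMatrix j ⊠ A

-- Meant for a segment `s` of the piece inside a segment `s′` of the parent: the two lie on one line
-- with piece and parent on the same side, and whatever tile the parent has across `s′`, one of its
-- pieces is a neighbour of the piece across `s`.
Inherited : Fin 5 → Segment → Segment → Set
Inherited i s s′ = Within (opposite s) (column (pieceMatrix i) (opposite s′)) ×
  (∀ m → segment (moves m) ≡ s′ → Occurs i s (neighbour (moves m)))

inherited? : ∀ i s s′ → Dec (Inherited i s s′)
inherited? i s s′ =
  (all? λ l → (l Fin.≟ opposite s ×-dec 0ℤ ℤ.<? pieceMatrix i l (opposite s′)) ⊎-dec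
     (¬? (l Fin.≟ opposite s) ×-dec pieceMatrix i l (opposite s′) ℤ.≟ 0ℤ))
  ×-dec all? λ m → segment (moves m) Fin.≟ s′ →-dec occurs? i s (neighbour (moves m))

-- The forms y, x - 1, y - 2, 2x + y - 4 and their negatives, each given by its values at the
-- corners of `placedK`. Their zero lines carry the four cuts of the dissection.
separators : Fin 8 → Row
separators = lookup
  ( row (+ 0) -[1+ 0 ] (+ 4) ∷ row -[1+ 0 ] (+ 1) (+ 1) ∷ row -[1+ 1 ] -[1+ 2 ] (+ 2) ∷ row -[1+ 3 ] -[1+ 0 ] (+ 4)
  ∷ row (+ 0) (+ 1) -[1+ 3 ] ∷ row (+ 1) -[1+ 0 ] -[1+ 0 ] ∷ row (+ 2) (+ 3) -[1+ 1 ] ∷ row (+ 4) (+ 1) -[1+ 3 ] ∷ [])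

-- One strict inequality at a corner is enough for `f` to be positive in the whole interior of the
-- triangle of `M`.
Separates : Row → Matrix → Matrix → Set
Separates f M N = (∀ l → 0ℤ ℤ.≤ dot (M l) f) × (∃[ l ] 0ℤ ℤ.< dot (M l) f) × (∀ l → dot (N l) f ℤ.≤ 0ℤ)

separates? : ∀ f M N → Dec (Separates f M N)
separates? f M N = (all? λ l → 0ℤ ℤ.≤? dot (M l) f) ×-dec (any? λ l → 0ℤ ℤ.<? dot (M l) f) ×-dec
  (all? λ l → dot (N l) f ℤ.≤? 0ℤ)

det₂ℤ : Matrix → ℤ
det₂ℤ M = (M 1F 1F ℤ.- M 0F 1F) ℤ.* (M 2F 2F ℤ.- M 0F 2F) ℤ.- (M 1F 2F ℤ.- M 0F 2F) ℤ.* (M 2F 1F ℤ.- M 0F 1F)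

-- From each piece to one whose mirror image in the long leg is also a piece.
opaque
  toMirrored : Fin 5 → Matrix
  toMirrored = lookup
    ( neighbour (moves (Fin.# 9)) ∷ identity ∷ identity ∷ neighbour (moves (Fin.# 11))
    ∷ matrix (row (+ 10) (+ 10) -[1+ 9 ]) (row (+ 20) (+ 0) -[1+ 9 ]) (row (+ 0) (+ 10) (+ 0)) ∷ [])

mirror : Matrix
mirror = neighbour (moves 3F)

-- Finite checks

opaque
  unfolding pieceMatrix toMirrored

  pieces-affine : ∀ i l → Normalised (pieceMatrix i l)
  pieces-affine = from-yes (all? λ i → all? λ l → normalised? (pieceMatrix i l))

  pieces-placed : ∀ i l k → dot (pieceMatrix i l) (placedRow k) ≡ + 10 ℤ.* pieceCoordinates i l k
  pieces-placed = from-yes (all? λ i → all? λ l → all? λ k → dot (pieceMatrix i l) (placedRow k) ℤ.≟ + 10 ℤ.* pieceCoordinates i l k)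

  spots-K : ∀ k c → dot (spot k) (rowK c) ≡ + 10 ℤ.* spotK k c
  spots-K = from-yes (all? λ k → all? λ c → dot (spot k) (rowK c) ℤ.≟ + 10 ℤ.* spotK k c)

  pieces-halves : ∀ i l → pieceMatrix i l 1F ≡ + 2 ℤ.* halve (pieceMatrix i l 1F)
  pieces-halves = from-yes (all? λ i → all? λ l → pieceMatrix i l 1F ℤ.≟ + 2 ℤ.* halve (pieceMatrix i l 1F))

  -- Divisibility by four at the short end and by two at the long end makes the long leg of a piece
  -- twice a vector with odd denominators: weights are tenths, and the long leg of the parent is
  -- already even.
  pieces-longLeg : ∀ i → pieceMatrix i 2F 1F ≡ pieceMatrix i 0F 1F ℤ.+ + 4 ℤ.* quarter (pieceMatrix i 2F 1F ℤ.- pieceMatrix i 0F 1F)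
                       × pieceMatrix i 2F 2F ≡ pieceMatrix i 0F 2F ℤ.+ + 2 ℤ.* halve (pieceMatrix i 2F 2F ℤ.- pieceMatrix i 0F 2F)
  pieces-longLeg = from-yes (all? λ i →
    pieceMatrix i 2F 1F ℤ.≟ pieceMatrix i 0F 1F ℤ.+ + 4 ℤ.* quarter (pieceMatrix i 2F 1F ℤ.- pieceMatrix i 0F 1F) ×-dec
    pieceMatrix i 2F 2F ℤ.≟ pieceMatrix i 0F 2F ℤ.+ + 2 ℤ.* halve (pieceMatrix i 2F 2F ℤ.- pieceMatrix i 0F 2F))

  pieces-nonnegative : ∀ i l j → 0ℤ ℤ.≤ pieceMatrix i l j
  pieces-nonnegative = from-yes (all? λ i → all? λ l → all? λ j → 0ℤ ℤ.≤? pieceMatrix i l j)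

  pieces-positive : ∀ i j → ∃[ l ] 0ℤ ℤ.< pieceMatrix i l j
  pieces-positive = from-yes (all? λ i → all? λ j → any? λ l → 0ℤ ℤ.<? pieceMatrix i l j)

  pieces-nondegenerate : ∀ i → det₂ℤ (pieceMatrix i) ≢ 0ℤ
  pieces-nondegenerate = from-yes (all? λ i → ¬? (det₂ℤ (pieceMatrix i) ℤ.≟ 0ℤ))

  pieces-separated : ∀ i j → i ≡ j ⊎ ∃[ k ] Separates (separators k) (pieceMatrix i) (pieceMatrix j)
  pieces-separated = from-yes (all? λ i → all? λ j → i Fin.≟ j ⊎-dec
    any? λ k → separates? (separators k) (pieceMatrix i) (pieceMatrix j))

  neighbours-affine : ∀ m l → Normalised (neighbour (moves m) l)
  neighbours-affine = from-yes (all? λ m → all? λ l → normalised? (neighbour (moves m) l))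

  spots-affine : ∀ k → Normalised (spot k)
  spots-affine = from-yes (all? λ k → normalised? (spot k))

  startSpots : ∀ m j → (spot (startSpot (moves m)) ⊡ neighbour (moves m)) j ≡ (spot (startOf (segment (moves m))) ⊡ identity) j
  startSpots = from-yes (all? λ m → all? λ j →
    (spot (startSpot (moves m)) ⊡ neighbour (moves m)) j ℤ.≟ (spot (startOf (segment (moves m))) ⊡ identity) j)

  endSpots : ∀ m j → (spot (endSpot (moves m)) ⊡ neighbour (moves m)) j ≡ (spot (endOf (segment (moves m))) ⊡ identity) j
  endSpots = from-yes (all? λ m → all? λ j →
    (spot (endSpot (moves m)) ⊡ neighbour (moves m)) j ℤ.≟ (spot (endOf (segment (moves m))) ⊡ identity) j)

  segments-meet : ∀ s → Meets (spot (startOf s)) (spot (endOf s)) (opposite s)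
  segments-meet = from-yes (all? λ s → meets? (spot (startOf s)) (spot (endOf s)) (opposite s))

  moves-meet : ∀ m → Meets (spot (startSpot (moves m))) (spot (endSpot (moves m))) (apex (moves m))
  moves-meet = from-yes (all? λ m → meets? (spot (startSpot (moves m))) (spot (endSpot (moves m))) (apex (moves m)))

  moves-beyond : ∀ m → Beyond (apex (moves m)) (column (neighbour (moves m)) (opposite (segment (moves m))))
  moves-beyond = from-yes (all? λ m → all? λ l →
    (l Fin.≟ apex (moves m) ×-dec neighbour (moves m) l (opposite (segment (moves m))) ℤ.<? 0ℤ) ⊎-dec
    (¬? (l Fin.≟ apex (moves m)) ×-dec neighbour (moves m) l (opposite (segment (moves m))) ℤ.≟ 0ℤ))

  segments-moves : ∀ s → ∃[ m ] segment (moves m) ≡ s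
  segments-moves = from-yes (all? λ s → any? λ m → segment (moves m) Fin.≟ s)

  -- The induction step of the search for neighbours, and at the same time the check that `moves` is
  -- closed under dissection.
  pieces-segments : ∀ i s → Occurs i s identity ⊎ ∃[ s′ ] Inherited i s s′
  pieces-segments = from-yes (all? λ i → all? λ s → occurs? i s identity ⊎-dec any? λ s′ → inherited? i s s′)

  spots-distinct : ∀ i j → (∀ l → spot i l ≡ spot j l) → i ≡ j
  spots-distinct = from-yes (all? λ i → all? λ j → (all? λ l → spot i l ℤ.≟ spot j l) →-dec i Fin.≟ j)

  longLeg-meets : Meets atRight atLong 1F
  longLeg-meets = from-yes (meets? atRight atLong 1F)

  third : ∀ (i j : Fin 3) → ∃[ k ] k ≢ i × k ≢ j
  third = from-yes (all? {n = 3} λ i → all? {n = 3} λ j → any? λ k → ¬? (k Fin.≟ i) ×-dec ¬? (k Fin.≟ j))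

  -- Pieces 1 and 2 are mirror images in their common long leg, and every `toMirrored i` leads to
  -- one of them.
  pieces-mirrored : ∀ i → ∃₂ λ j k → toMirrored i ⊠ pieceMatrix i ≐ pieceMatrix j ⊠ identity ×
                                      mirror ⊠ pieceMatrix j ≐ pieceMatrix k ⊠ identity
  pieces-mirrored = from-yes (all? λ i → any? λ j → any? λ k →
    toMirrored i ⊠ pieceMatrix i ≐? pieceMatrix j ⊠ identity ×-dec mirror ⊠ pieceMatrix j ≐? pieceMatrix k ⊠ identity)

-- Iterated subdivision and the patches ωⁿ(K)

module Patches (ℝ : CompleteOrderedField) where
  open CompleteOrderedField ℝ
  open FieldProperties ℝ
  open Barycentric ℝ
  open Pinwheel ℝ
  open Triangle
  open import Relation.Binary.Reasoning.Setoid setoid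

  abstract
    tenth : Carrier
    tenth = proj₁ (inverse-pos (0<⟦⟧ 9))

    0<tenth : 0# < tenth
    0<tenth = proj₁ (proj₂ (inverse-pos (0<⟦⟧ 9)))

    10*tenth : ⟦ + 10 ⟧ * tenth ≈ 1#
    10*tenth = proj₂ (proj₂ (inverse-pos (0<⟦⟧ 9)))

  tenth*10 : tenth * ⟦ + 10 ⟧ ≈ 1#
  tenth*10 = trans (*-comm _ _) 10*tenth

  ⟨_⟩ : Row → Weights
  ⟨ a ⟩ i = tenth * ⟦ a i ⟧

  ⟪_⟫ : Matrix → Fin 3 → Weights
  ⟪ M ⟫ i = ⟨ M i ⟩

  ⟨⟩-total : ∀ {a} → Normalised a → total ⟨ a ⟩ ≈ 1#
  ⟨⟩-total {a} n = begin
    total ⟨ a ⟩                                  ≈⟨ solve 4 (λ t a b c → t :* a :+ t :* b :+ t :* c := t :* (a :+ b :+ c))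
                                                     refl tenth ⟦ a 0F ⟧ ⟦ a 1F ⟧ ⟦ a 2F ⟧ ⟩
    tenth * (⟦ a 0F ⟧ + ⟦ a 1F ⟧ + ⟦ a 2F ⟧)    ≈⟨ *-congˡ (+-congʳ (⟦⟧-+ (a 0F) (a 1F))) ⟨
    tenth * (⟦ a 0F ℤ.+ a 1F ⟧ + ⟦ a 2F ⟧)      ≈⟨ *-congˡ (⟦⟧-+ (a 0F ℤ.+ a 1F) (a 2F)) ⟨
    tenth * ⟦ a 0F ℤ.+ a 1F ℤ.+ a 2F ⟧          ≡⟨ ≡.cong (λ k → tenth * ⟦ k ⟧) n ⟩
    tenth * ⟦ + 10 ⟧                             ≈⟨ tenth*10 ⟩
    1#                                           ∎

  lin-⟦⟧ : ∀ a b → lin ⟨ a ⟩ (λ i → ⟦ b i ⟧) ≈ tenth * ⟦ dot a b ⟧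
  lin-⟦⟧ a b = begin
    lin ⟨ a ⟩ (λ i → ⟦ b i ⟧)
      ≈⟨ solve 7 (λ t a b c x y z → t :* a :* x :+ t :* b :* y :+ t :* c :* z := t :* (a :* x :+ b :* y :+ c :* z))
           refl tenth ⟦ a 0F ⟧ ⟦ a 1F ⟧ ⟦ a 2F ⟧ ⟦ b 0F ⟧ ⟦ b 1F ⟧ ⟦ b 2F ⟧ ⟩
    tenth * (⟦ a 0F ⟧ * ⟦ b 0F ⟧ + ⟦ a 1F ⟧ * ⟦ b 1F ⟧ + ⟦ a 2F ⟧ * ⟦ b 2F ⟧)
      ≈⟨ *-congˡ (+-cong (+-cong (⟦⟧-* (a 0F) (b 0F)) (⟦⟧-* (a 1F) (b 1F))) (⟦⟧-* (a 2F) (b 2F))) ⟨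
    tenth * (⟦ a 0F ℤ.* b 0F ⟧ + ⟦ a 1F ℤ.* b 1F ⟧ + ⟦ a 2F ℤ.* b 2F ⟧)
      ≈⟨ *-congˡ (+-congʳ (⟦⟧-+ (a 0F ℤ.* b 0F) (a 1F ℤ.* b 1F))) ⟨
    tenth * (⟦ a 0F ℤ.* b 0F ℤ.+ a 1F ℤ.* b 1F ⟧ + ⟦ a 2F ℤ.* b 2F ⟧)
      ≈⟨ *-congˡ (⟦⟧-+ (a 0F ℤ.* b 0F ℤ.+ a 1F ℤ.* b 1F) (a 2F ℤ.* b 2F)) ⟨
    tenth * ⟦ dot a b ⟧ ∎

  lin-integral : ∀ a b {n} → dot a b ≡ + 10 ℤ.* n → lin ⟨ a ⟩ (λ i → ⟦ b i ⟧) ≈ ⟦ n ⟧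
  lin-integral a b {n} e = begin
    lin ⟨ a ⟩ (λ i → ⟦ b i ⟧)      ≈⟨ lin-⟦⟧ a b ⟩
    tenth * ⟦ dot a b ⟧            ≡⟨ ≡.cong (λ k → tenth * ⟦ k ⟧) e ⟩
    tenth * ⟦ + 10 ℤ.* n ⟧         ≈⟨ *-congˡ (⟦⟧-* (+ 10) n) ⟩
    tenth * (⟦ + 10 ⟧ * ⟦ n ⟧)     ≈⟨ *-assoc _ _ _ ⟨
    tenth * ⟦ + 10 ⟧ * ⟦ n ⟧       ≈⟨ *-congʳ tenth*10 ⟩
    1# * ⟦ n ⟧                     ≈⟨ *-identityˡ _ ⟩
    ⟦ n ⟧                          ∎

  lin-scale : ∀ v t f → lin v (λ i → t * f i) ≈ t * lin v f
  lin-scale v t f = solve 7 (λ t a b c x y z → a :* (t :* x) :+ b :* (t :* y) :+ c :* (t :* z) := t :* (a :* x :+ b :* y :+ c :* z))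
           refl t (v 0F) (v 1F) (v 2F) (f 0F) (f 1F) (f 2F)

  ⟨⟩-∙ : ∀ a B j → (⟨ a ⟩ ∙ ⟪ B ⟫) j ≈ tenth * (tenth * ⟦ (a ⊡ B) j ⟧)
  ⟨⟩-∙ a B j = trans (lin-scale ⟨ a ⟩ tenth (λ i → ⟦ B i j ⟧)) (*-congˡ (lin-⟦⟧ a (column B j)))

  ⟨⟩-∙-cong : ∀ a B a′ B′ → (∀ j → (a ⊡ B) j ≡ (a′ ⊡ B′) j) → ∀ j → (⟨ a ⟩ ∙ ⟪ B ⟫) j ≈ (⟨ a′ ⟩ ∙ ⟪ B′ ⟫) j
  ⟨⟩-∙-cong a B a′ B′ e j = trans (⟨⟩-∙ a B j)
    (trans (reflexive (≡.cong (λ k → tenth * (tenth * ⟦ k ⟧)) (e j))) (sym (⟨⟩-∙ a′ B′ j)))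

  comb-⟨⟩-cong : ∀ a B a′ B′ → (∀ j → (a ⊡ B) j ≡ (a′ ⊡ B′) j) →
                 ∀ T → comb (tri ⟪ B ⟫ T) ⟨ a ⟩ ≈ₚ comb (tri ⟪ B′ ⟫ T) ⟨ a′ ⟩
  comb-⟨⟩-cong a B a′ B′ e T = ≈ₚ-trans (comb-tri ⟪ B ⟫ T ⟨ a ⟩)
    (≈ₚ-trans (comb-congʳ T (⟨⟩-∙-cong a B a′ B′ e)) (≈ₚ-sym (comb-tri ⟪ B′ ⟫ T ⟨ a′ ⟩)))

  tri-≐ : ∀ M N M′ N′ → M ⊠ N ≐ M′ ⊠ N′ → ∀ T → tri ⟪ M ⟫ (tri ⟪ N ⟫ T) ≈ₜ tri ⟪ M′ ⟫ (tri ⟪ N′ ⟫ T)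
  tri-≐ M N M′ N′ e T i = ≈ₚ-trans (corner-tri ⟪ M ⟫ (tri ⟪ N ⟫ T) i)
    (≈ₚ-trans (comb-⟨⟩-cong (M i) N (M′ i) N′ (e i) T) (≈ₚ-sym (corner-tri ⟪ M′ ⟫ (tri ⟪ N′ ⟫ T) i)))

  ⟨⟩-corners : ∀ i → ∀ j → ⟨ identity i ⟩ j ≈ vertexWeights i j
  ⟨⟩-corners = forFin3 (forFin3 tenth*10 (zeroʳ _) (zeroʳ _)) (forFin3 (zeroʳ _) tenth*10 (zeroʳ _))
    (forFin3 (zeroʳ _) (zeroʳ _) tenth*10)

  corner≈comb : ∀ T i → corner T i ≈ₚ comb T ⟨ identity i ⟩
  corner≈comb T i = ≈ₚ-trans (at (corner-coordinates T i)) (≈ₚ-sym (comb-congʳ T (⟨⟩-corners i)))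

  tri-identity : ∀ T → tri ⟪ identity ⟫ T ≈ₜ T
  tri-identity T i = ≈ₚ-trans (corner-tri ⟪ identity ⟫ T i) (≈ₚ-sym (corner≈comb T i))

  ⟪⟫-affine : ∀ {M} → (∀ l → Normalised (M l)) → Affine ⟪ M ⟫
  ⟪⟫-affine {M} n i = ⟨⟩-total {M i} (n i)

  part : Fin 5 → Triangle → Triangle
  part i = tri ⟪ pieceMatrix i ⟫

  part-affine : ∀ i → Affine ⟪ pieceMatrix i ⟫
  part-affine i = ⟪⟫-affine {pieceMatrix i} (pieces-affine i)

  -- The head of an address is the finest subdivision, so recursion on the address passes from a
  -- tile to its parent.
  tileAt : ∀ {n} → Vec (Fin 5) n → Triangle → Triangle
  tileAt []      S = S
  tileAt (i ∷ a) S = part i (tileAt a S)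

  det₂-⟪⟫ : ∀ M → det₂ ⟪ M ⟫ ≈ tenth * tenth * ⟦ det₂ℤ M ⟧
  det₂-⟪⟫ M = begin
    det₂ ⟪ M ⟫
      ≈⟨ solve 7 (λ t a b c d e f → (t :* a :- t :* b) :* (t :* c :- t :* d) :- (t :* e :- t :* d) :* (t :* f :- t :* b)
             := t :* t :* ((a :- b) :* (c :- d) :- (e :- d) :* (f :- b)))
           refl tenth ⟦ M 1F 1F ⟧ ⟦ M 0F 1F ⟧ ⟦ M 2F 2F ⟧ ⟦ M 0F 2F ⟧ ⟦ M 1F 2F ⟧ ⟦ M 2F 1F ⟧ ⟩
    tenth * tenth * ((⟦ M 1F 1F ⟧ + - ⟦ M 0F 1F ⟧) * (⟦ M 2F 2F ⟧ + - ⟦ M 0F 2F ⟧)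
                     + - ((⟦ M 1F 2F ⟧ + - ⟦ M 0F 2F ⟧) * (⟦ M 2F 1F ⟧ + - ⟦ M 0F 1F ⟧)))
      ≈⟨ *-congˡ (trans (⟦⟧-- ((M 1F 1F ℤ.- M 0F 1F) ℤ.* (M 2F 2F ℤ.- M 0F 2F)) ((M 1F 2F ℤ.- M 0F 2F) ℤ.* (M 2F 1F ℤ.- M 0F 1F))) (+-cong (trans (⟦⟧-* (M 1F 1F ℤ.- M 0F 1F) (M 2F 2F ℤ.- M 0F 2F)) (*-cong (⟦⟧-- (M 1F 1F) (M 0F 1F)) (⟦⟧-- (M 2F 2F) (M 0F 2F))))
           (-‿cong (trans (⟦⟧-* (M 1F 2F ℤ.- M 0F 2F) (M 2F 1F ℤ.- M 0F 1F)) (*-cong (⟦⟧-- (M 1F 2F) (M 0F 2F)) (⟦⟧-- (M 2F 1F) (M 0F 1F))))))) ⟨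
    tenth * tenth * ⟦ det₂ℤ M ⟧ ∎
    where
    ⟦⟧-- : ∀ i j → ⟦ i ℤ.- j ⟧ ≈ ⟦ i ⟧ + - ⟦ j ⟧
    ⟦⟧-- i j = trans (⟦⟧-+ i (ℤ.- j)) (+-congˡ (⟦⟧-neg j))

  nonDegenerate-part : ∀ i {T} → NonDegenerate T → NonDegenerate (part i T)
  nonDegenerate-part i = nonDegenerate-tri ⟪ pieceMatrix i ⟫ (part-affine i) λ p →
    pieces-nondegenerate i (⟦⟧-injective _ 0ℤ (*-≈0-cancelˡ (0<⇒≉0 (*-pos 0<tenth 0<tenth))
      (trans (sym (det₂-⟪⟫ (pieceMatrix i))) p)))

  nonDegenerate-tileAt : ∀ {n} (a : Vec (Fin 5) n) {S} → NonDegenerate S → NonDegenerate (tileAt a S)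
  nonDegenerate-tileAt []      nd = nd
  nonDegenerate-tileAt (i ∷ a) nd = nonDegenerate-part i (nonDegenerate-tileAt a nd)

  ⟨⟩-nonneg : ∀ {k} → 0ℤ ℤ.≤ k → 0# ≤ tenth * ⟦ k ⟧
  ⟨⟩-nonneg p = 0≤* (inj₁ 0<tenth) (0≤⟦⟧ p)

  ⟨⟩-pos : ∀ {k} → 0ℤ ℤ.< k → 0# < tenth * ⟦ k ⟧
  ⟨⟩-pos p = *-pos 0<tenth (0<⟦⟧′ p)

  lin-nonneg : ∀ {v f} → (∀ i → 0# ≤ v i) → (∀ i → 0# ≤ f i) → 0# ≤ lin v f
  lin-nonneg p q = 0≤+ (0≤+ (0≤* (p 0F) (q 0F)) (0≤* (p 1F) (q 1F))) (0≤* (p 2F) (q 2F))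

  lin-pos : ∀ {v f} → (∀ i → 0# < v i) → (∀ i → 0# ≤ f i) → ∀ k → 0# < f k → 0# < lin v f
  lin-pos p q 0F r = 0<+≤ (0<+≤ (*-pos (p 0F) r) (0≤* (inj₁ (p 1F)) (q 1F))) (0≤* (inj₁ (p 2F)) (q 2F))
  lin-pos p q 1F r = 0<+≤ (0≤+< (0≤* (inj₁ (p 0F)) (q 0F)) (*-pos (p 1F) r)) (0≤* (inj₁ (p 2F)) (q 2F))
  lin-pos p q 2F r = 0≤+< (0≤+ (0≤* (inj₁ (p 0F)) (q 0F)) (0≤* (inj₁ (p 1F)) (q 1F))) (*-pos (p 2F) r)

  part⊆ : ∀ i {T x} → InTriangle (part i T) x → InTriangle T x
  part⊆ i {T} h = let c , p = inTriangle⁻ {part i T} h in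
    inTriangle⁺ (coordinates-tri ⟪ pieceMatrix i ⟫ (part-affine i) c)
      (λ j → lin-nonneg p (λ l → ⟨⟩-nonneg (pieces-nonnegative i l j)))

  part⊆-interior : ∀ i {T x} → InInterior (part i T) x → InInterior T x
  part⊆-interior i {T} h = let c , p = inInterior⁻ {part i T} h in
    inInterior⁺ (coordinates-tri ⟪ pieceMatrix i ⟫ (part-affine i) c)
      (λ j → let l , q = pieces-positive i j in
        lin-pos p (λ l → ⟨⟩-nonneg (pieces-nonnegative i l j)) l (⟨⟩-pos q))

  tileAt⊆ : ∀ {n} (a : Vec (Fin 5) n) {S x} → InTriangle (tileAt a S) x → InTriangle S x
  tileAt⊆ []      h = h
  tileAt⊆ (i ∷ a) {S} h = tileAt⊆ a {S} (part⊆ i {tileAt a S} h)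

  part-functional : ∀ i {T x} (c : Coordinates (part i T) x) f →
    lin (w c ∙ ⟪ pieceMatrix i ⟫) (λ j → ⟦ f j ⟧) ≈ lin (w c) (λ l → tenth * ⟦ dot (pieceMatrix i l) f ⟧)
  part-functional i c f = trans (lin-∙ (w c) ⟪ pieceMatrix i ⟫ (λ j → ⟦ f j ⟧))
    (lin-congʳ (w c) (λ l → lin-⟦⟧ (pieceMatrix i l) f))

  -- At a common interior point the separator is positive when evaluated through part `i` and at
  -- most zero through part `j`, while uniqueness of coordinates makes both values equal.
  parts-disjoint : ∀ {T} → NonDegenerate T → ∀ i j {x} → InInterior (part i T) x → InInterior (part j T) x → i ≡ j
  parts-disjoint {T} nd i j p q with pieces-separated i j
  ... | inj₁ e = e
  ... | inj₂ (k , nonneg , (l , pos) , nonpos)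
    with c , 0<c ← inInterior⁻ {part i T} p | d , 0<d ← inInterior⁻ {part j T} q =
    ⊥-elim (0<⇒≮0 negative (0<⇒-<0 (<-respʳ-≈ agree (lin-pos 0<c (λ l → ⟨⟩-nonneg (nonneg l)) l (⟨⟩-pos pos)))))
    where
    f : Row
    f = separators k
    agree : lin (w c) (λ l → tenth * ⟦ dot (pieceMatrix i l) f ⟧) ≈ lin (w d) (λ l → tenth * ⟦ dot (pieceMatrix j l) f ⟧)
    agree = trans (sym (part-functional i c f)) (trans
      (lin-congˡ {w c ∙ ⟪ pieceMatrix i ⟫} {w d ∙ ⟪ pieceMatrix j ⟫} (λ j → ⟦ f j ⟧)
        (coordinates-unique nd (coordinates-tri ⟪ pieceMatrix i ⟫ (part-affine i) c)
           (coordinates-tri ⟪ pieceMatrix j ⟫ (part-affine j) d) ≈ₚ-refl))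
      (part-functional j d f))
    negative : 0# ≤ - lin (w d) (λ l → tenth * ⟦ dot (pieceMatrix j l) f ⟧)
    negative = ≤-resp (trans (lin-scale (w d) (- 1#) (λ l → tenth * ⟦ dot (pieceMatrix j l) f ⟧))
        (solve 1 (λ x → :- con (+ 1) :* x := :- x) refl _))
      (lin-nonneg (λ l → inj₁ (0<d l)) (λ l → ≤-resp
        (trans (*-congˡ (⟦⟧-neg (dot (pieceMatrix j l) f)))
          (solve 2 (λ t x → t :* (:- x) := :- con (+ 1) :* (t :* x)) refl tenth ⟦ dot (pieceMatrix j l) f ⟧))
        (⟨⟩-nonneg (ℤ.neg-mono-≤ (nonpos l)))))

  -- The interior of a piece lies in that of its parent, so the parents agree by induction, and what
  -- remains are two pieces of one parent.
  tiles-disjoint : ∀ {n} (a b : Vec (Fin 5) n) {S x} → NonDegenerate S →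
                   InInterior (tileAt a S) x → InInterior (tileAt b S) x → a ≡ b
  tiles-disjoint []      []      nd p q = ≡.refl
  tiles-disjoint (i ∷ a) (j ∷ b) {S} {x} nd p q = ≡.cong₂ _∷_ i≡j a≡b
    where
    a≡b : a ≡ b
    a≡b = tiles-disjoint a b {S} nd (part⊆-interior i {tileAt a S} p) (part⊆-interior j {tileAt b S} q)
    i≡j : i ≡ j
    i≡j = parts-disjoint {tileAt a S} (nonDegenerate-tileAt a nd) i j p
      (≡.subst (λ c → InInterior (part j (tileAt c S)) x) (≡.sym a≡b) q)

  -- S lies on the same side as T of the line through the side of T opposite to k.
  OnBoundary : Triangle → Triangle → Fin 3 → Set
  OnBoundary S T k = ∀ {x} → InTriangle S x → (c : Coordinates T x) → 0# ≤ w c k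

  lin-single : ∀ v f k → (∀ l → l ≢ k → f l ≈ 0#) → lin v f ≈ v k * f k
  lin-single v f 0F z = trans (+-cong (+-congˡ (trans (*-congˡ (z 1F λ ())) (zeroʳ _))) (trans (*-congˡ (z 2F λ ())) (zeroʳ _)))
    (trans (+-identityʳ _) (+-identityʳ _))
  lin-single v f 1F z = trans (+-cong (+-congʳ (trans (*-congˡ (z 0F λ ())) (zeroʳ _))) (trans (*-congˡ (z 2F λ ())) (zeroʳ _)))
    (trans (+-identityʳ _) (+-identityˡ _))
  lin-single v f 2F z = trans (+-congʳ (trans (+-cong (trans (*-congˡ (z 0F λ ())) (zeroʳ _)) (trans (*-congˡ (z 1F λ ())) (zeroʳ _)))
    (+-identityʳ _))) (+-identityˡ _)

  within-column : ∀ {k c} → Within k c → ∀ v → lin v (λ l → tenth * ⟦ c l ⟧) ≈ v k * (tenth * ⟦ c k ⟧) × 0ℤ ℤ.< c k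
  within-column {k} {c} h v = lin-single v _ k zeros , positive
    where
    zeros : ∀ l → l ≢ k → tenth * ⟦ c l ⟧ ≈ 0#
    zeros l l≢k with h l
    ... | inj₁ (e , _) = ⊥-elim (l≢k e)
    ... | inj₂ (_ , e) = trans (*-congˡ (reflexive (≡.cong ⟦_⟧ e))) (zeroʳ _)
    positive : 0ℤ ℤ.< c k
    positive with h k
    ... | inj₁ (_ , p) = p
    ... | inj₂ (n , _) = ⊥-elim (n ≡.refl)

  -- On the part, the weight of the parent is a positive multiple of the weight of the part, as both
  -- vanish on the same line.
  onBoundary-part : ∀ {S T} i {k k′} → Within k (column (pieceMatrix i) k′) →
                    OnBoundary S T k′ → OnBoundary S (part i T) k
  onBoundary-part i {k} {k′} h b xS c = *-≤-cancelˡ (⟨⟩-pos pos) (≤-resp (trans eq (*-comm _ _))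
      (b xS (coordinates-tri ⟪ pieceMatrix i ⟫ (part-affine i) c)))
    where
    eq = proj₁ (within-column h (w c))
    pos = proj₂ (within-column h (w c))

  NeighbourIn : ∀ {n} → Triangle → Vec (Fin 5) n → Segment → Set
  NeighbourIn {n} S a s = ∃₂ λ m (b : Vec (Fin 5) n) →
    segment (moves m) ≡ s × tileAt b S ≈ₜ tri ⟪ neighbour (moves m) ⟫ (tileAt a S)

  whole-boundary : ∀ {S} → NonDegenerate S → ∀ k → OnBoundary S S k
  whole-boundary {S} nd k xS c = let d , 0≤d = inTriangle⁻ {S} xS in
    ≤-resp (coordinates-unique nd d c ≈ₚ-refl k) (0≤d k)

  -- Climbing to the parent: a segment interior to the parent has its neighbour among the pieces of
  -- that parent; any other one is traced to a segment of the parent, whose neighbour is then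
  -- dissected.
  boundary-or-neighbour : ∀ {n} (a : Vec (Fin 5) n) {S} → NonDegenerate S → ∀ s →
    OnBoundary S (tileAt a S) (opposite s) ⊎ NeighbourIn S a s
  boundary-or-neighbour [] {S} nd s = inj₁ (whole-boundary nd (opposite s))
  boundary-or-neighbour (i ∷ a) {S} nd s with pieces-segments i s
  ... | inj₁ (j , m , e , eq) = inj₂ (m , j ∷ a , e , ≈ₜ-sym (≈ₜ-trans
          (tri-≐ (neighbour (moves m)) (pieceMatrix i) (pieceMatrix j) identity eq (tileAt a S))
          (tri-cong ⟪ pieceMatrix j ⟫ (tri-identity (tileAt a S)))))
  ... | inj₂ (s′ , within , f) with boundary-or-neighbour a nd s′
  ...   | inj₁ b = inj₁ (onBoundary-part i within b)
  ...   | inj₂ (m′ , b , e′ , t) with j , m , e , eq ← f m′ e′ = inj₂ (m , j ∷ b , e , ≈ₜ-trans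
          (tri-cong ⟪ pieceMatrix j ⟫ t)
          (≈ₜ-sym (tri-≐ (neighbour (moves m)) (pieceMatrix i) (pieceMatrix j) (neighbour (moves m′)) eq (tileAt a S))))

  -- Restricting to total weight 1 admits maps with a translation part.
  PreservesCombinations : (Point → Point) → Set
  PreservesCombinations f = ∀ T v → total v ≈ 1# → f (comb T v) ≈ₚ comb (mapT f T) v

  expand-preserves : PreservesCombinations expand
  expand-preserves (△ (px , py) (qx , qy) (rx , ry)) v _ =
      solve 9 (λ a b c px py qx qy rx ry →
        con (+ 2) :* (a :* px :+ b :* qx :+ c :* rx) :+ (a :* py :+ b :* qy :+ c :* ry)
        := a :* (con (+ 2) :* px :+ py) :+ b :* (con (+ 2) :* qx :+ qy) :+ c :* (con (+ 2) :* rx :+ ry))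
        refl (v 0F) (v 1F) (v 2F) px py qx qy rx ry
    , solve 9 (λ a b c px py qx qy rx ry →
        :- (a :* px :+ b :* qx :+ c :* rx) :+ con (+ 2) :* (a :* py :+ b :* qy :+ c :* ry)
        := a :* (:- px :+ con (+ 2) :* py) :+ b :* (:- qx :+ con (+ 2) :* qy) :+ c :* (:- rx :+ con (+ 2) :* ry))
        refl (v 0F) (v 1F) (v 2F) px py qx qy rx ry

  apply-preserves : ∀ g → PreservesCombinations (Isometry.apply g)
  apply-preserves g (△ (px , py) (qx , qy) (rx , ry)) v s =
      coordinate (proj₁ e₁) (proj₁ e₂) (proj₁ τ) , coordinate (proj₂ e₁) (proj₂ e₂) (proj₂ τ)
    where
    open Isometry g
    coordinate : ∀ e f t →
      (v 0F * px + v 1F * qx + v 2F * rx) * e + (v 0F * py + v 1F * qy + v 2F * ry) * f + t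
      ≈ v 0F * (px * e + py * f + t) + v 1F * (qx * e + qy * f + t) + v 2F * (rx * e + ry * f + t)
    coordinate e f t = linear₁ (- t) s (solve 12 (λ a b c px py qx qy rx ry e f t →
        (a :* px :+ b :* qx :+ c :* rx) :* e :+ (a :* py :+ b :* qy :+ c :* ry) :* f :+ t :+ :- t :* con (+ 1)
        := a :* (px :* e :+ py :* f :+ t) :+ b :* (qx :* e :+ qy :* f :+ t) :+ c :* (rx :* e :+ ry :* f :+ t)
           :+ :- t :* (a :+ b :+ c))
      refl (v 0F) (v 1F) (v 2F) px py qx qy rx ry e f t)

  expand-cong : ∀ {p q} → p ≈ₚ q → expand p ≈ₚ expand q
  expand-cong (a , b) = +-cong (*-congˡ a) b , +-cong (-‿cong a) (*-congˡ b)

  apply-cong : ∀ g {p q} → p ≈ₚ q → Isometry.apply g p ≈ₚ Isometry.apply g q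
  apply-cong g (a , b) = ⊕-cong (⊕-cong (·-cong a ≈ₚ-refl) (·-cong b ≈ₚ-refl)) ≈ₚ-refl

  mapT-cong : ∀ {f} → (∀ {p q} → p ≈ₚ q → f p ≈ₚ f q) → ∀ {T U} → T ≈ₜ U → mapT f T ≈ₜ mapT f U
  mapT-cong c t = forFin3 (c (t 0F)) (c (t 1F)) (c (t 2F))

  opaque
    unfolding tri

    mapT-tri : ∀ {f} → PreservesCombinations f → ∀ A → Affine A → ∀ T → mapT f (tri A T) ≈ₜ tri A (mapT f T)
    mapT-tri p A s T = forFin3 (p T (A 0F) (s 0F)) (p T (A 1F) (s 1F)) (p T (A 2F) (s 2F))

  mapT-tileAt : ∀ {f} → PreservesCombinations f → ∀ {n} (a : Vec (Fin 5) n) S → mapT f (tileAt a S) ≈ₜ tileAt a (mapT f S)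
  mapT-tileAt p []      S = ≈ₜ-refl
  mapT-tileAt p (i ∷ a) S = ≈ₜ-trans (mapT-tri p ⟪ pieceMatrix i ⟫ (part-affine i) (tileAt a S))
    (tri-cong ⟪ pieceMatrix i ⟫ (mapT-tileAt p a S))

  integerPoint : (Fin 2 → ℤ) → Point
  integerPoint k = ⟦ k 0F ⟧ , ⟦ k 1F ⟧

  4#≈⟦4⟧ : 4# ≈ ⟦ + 4 ⟧
  4#≈⟦4⟧ = sym (+-assoc 2# 1# 1#)

  pieces-integral : ∀ i l → corner (piece i) l ≈ₚ integerPoint (pieceCoordinates i l)
  pieces-integral 0F = forFin3 ≈ₚ-refl ≈ₚ-refl ≈ₚ-refl
  pieces-integral 1F = forFin3 ≈ₚ-refl ≈ₚ-refl ≈ₚ-refl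
  pieces-integral 2F = forFin3 ≈ₚ-refl ≈ₚ-refl ≈ₚ-refl
  pieces-integral 3F = forFin3 ≈ₚ-refl ≈ₚ-refl ≈ₚ-refl
  pieces-integral 4F = forFin3 ≈ₚ-refl ≈ₚ-refl (refl , 4#≈⟦4⟧)

  piece≈part : ∀ i → piece i ≈ₜ part i placedK
  piece≈part i l = ≈ₚ-trans (pieces-integral i l) (≈ₚ-sym (≈ₚ-trans (corner-tri ⟪ pieceMatrix i ⟫ placedK l)
      ( trans (lin-congʳ ⟨ pieceMatrix i l ⟩ {λ k → proj₁ (corner placedK k)} {λ k → ⟦ placedRow 0F k ⟧} (forFin3 refl refl refl)) (evaluate 0F)
      , trans (lin-congʳ ⟨ pieceMatrix i l ⟩ {λ k → proj₂ (corner placedK k)} {λ k → ⟦ placedRow 1F k ⟧} (forFin3 refl refl 4#≈⟦4⟧)) (evaluate 1F))))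
    where
    evaluate : ∀ k → lin ⟨ pieceMatrix i l ⟩ (λ j → ⟦ placedRow k j ⟧) ≈ ⟦ pieceCoordinates i l k ⟧
    evaluate k = lin-integral (pieceMatrix i l) (placedRow k) (pieces-placed i l k)

  -- The placement `h` preserves barycentric coordinates, so it disappears once the pieces are
  -- expressed in the coordinates of the expanded tile.
  ∈ω⇒part : ∀ {U T} → U ∈ω T → ∃[ i ] U ≈ₜ part i (mapT expand T)
  ∈ω⇒part {U} {T} (h , placed , i , U≈) = i , ≈ₜ-trans U≈ (≈ₜ-trans (mapT-cong (apply-cong h) (piece≈part i))
    (≈ₜ-trans (mapT-tri (apply-preserves h) ⟪ pieceMatrix i ⟫ (part-affine i) placedK)
      (tri-cong ⟪ pieceMatrix i ⟫ placed)))

  expanded : ℕ → Triangle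
  expanded zero    = K
  expanded (suc n) = mapT expand (expanded n)

  -- The substitution alternates expansion and dissection. As `expand` commutes with subdivision,
  -- all expansions can be moved to the front, and the patch becomes one large triangle subdivided
  -- `n` times.
  ωⁿK⇒tileAt : ∀ n {U} → ωⁿK n U → ∃[ a ] U ≈ₜ tileAt {n} a (expanded n)
  ωⁿK⇒tileAt zero    U≈K = [] , U≈K
  ωⁿK⇒tileAt (suc n) {U} (T , T∈ , U∈) = piece-of (ωⁿK⇒tileAt n T∈) (∈ω⇒part {U} {T} U∈)
    where
    piece-of : (∃[ a ] T ≈ₜ tileAt {n} a (expanded n)) → (∃[ i ] U ≈ₜ part i (mapT expand T)) →
               ∃[ a ] U ≈ₜ tileAt {suc n} a (expanded (suc n))
    piece-of (a , T≈) (i , U≈) = i ∷ a , ≈ₜ-trans U≈ (tri-cong ⟪ pieceMatrix i ⟫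
      (≈ₜ-trans (mapT-cong expand-cong T≈) (mapT-tileAt expand-preserves a (expanded n))))

  area-expand : ∀ T → area (mapT expand T) ≈ ⟦ + 5 ⟧ * area T
  area-expand (△ (px , py) (qx , qy) (rx , ry)) = solve 6 (λ px py qx qy rx ry →
      let X = λ x y → con (+ 2) :* x :+ y ; Y = λ x y → :- x :+ con (+ 2) :* y in
      (X qx qy :- X px py) :* (Y rx ry :- Y px py) :- (Y qx qy :- Y px py) :* (X rx ry :- X px py)
      := con (+ 5) :* ((qx :- px) :* (ry :- py) :- (qy :- py) :* (rx :- px)))
    refl px py qx qy rx ry

  nonDegenerate-K : NonDegenerate K
  nonDegenerate-K p = 0<⇒≉0 (0<⟦⟧ 1) (trans (solve 0
    (con (+ 2) := (con (+ 1) :- con (+ 0)) :* (con (+ 2) :- con (+ 0)) :- (con (+ 0) :- con (+ 0)) :* (con (+ 0) :- con (+ 0))) refl) p)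

  nonDegenerate-expanded : ∀ n → NonDegenerate (expanded n)
  nonDegenerate-expanded zero    = nonDegenerate-K
  nonDegenerate-expanded (suc n) p = nonDegenerate-expanded n
    (*-≈0-cancelˡ (0<⇒≉0 (0<⟦⟧ 4)) (trans (sym (area-expand (expanded n))) p))

  -- Lagrange's identity: the determinant of an orthogonal matrix has square 1.
  area-move : ∀ g T → area (moveT g T) * area (moveT g T) ≈ area T * area T
  area-move g T@(△ (px , py) (qx , qy) (rx , ry)) = begin
    area (moveT g T) * area (moveT g T)  ≈⟨ *-cong area≈ area≈ ⟩
    δ * A * (δ * A)                      ≈⟨ solve 2 (λ d a → d :* a :* (d :* a) := d :* d :* (a :* a)) refl δ A ⟩
    δ * δ * (A * A)                      ≈⟨ *-congʳ δ²≈1 ⟩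
    1# * (A * A)                         ≈⟨ *-identityˡ _ ⟩
    A * A                                ∎
    where
    open Isometry g renaming (_∙_ to _·ₚ_)
    a = proj₁ e₁
    b = proj₂ e₁
    c = proj₁ e₂
    d = proj₂ e₂
    A = area T
    δ = a * d + - (b * c)
    area≈ : area (moveT g T) ≈ δ * A
    area≈ = solve 12 (λ px py qx qy rx ry a b c d s t →
        let X = λ x y → x :* a :+ y :* c :+ s ; Y = λ x y → x :* b :+ y :* d :+ t in
        (X qx qy :- X px py) :* (Y rx ry :- Y px py) :- (Y qx qy :- Y px py) :* (X rx ry :- X px py)
        := (a :* d :- b :* c) :* ((qx :- px) :* (ry :- py) :- (qy :- py) :* (rx :- px)))
      refl px py qx qy rx ry a b c d (proj₁ τ) (proj₂ τ)
    δ²≈1 : δ * δ ≈ 1#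
    δ²≈1 = begin
      δ * δ                                              ≈⟨ solve 4 (λ a b c d → (a :* d :- b :* c) :* (a :* d :- b :* c)
          := (a :* a :+ b :* b) :* (c :* c :+ d :* d) :- (a :* c :+ b :* d) :* (a :* c :+ b :* d)) refl a b c d ⟩
      (e₁ ·ₚ e₁) * (e₂ ·ₚ e₂) + - ((e₁ ·ₚ e₂) * (e₁ ·ₚ e₂))
        ≈⟨ +-cong (*-cong e₁-unit e₂-unit) (-‿cong (*-cong orthogonal orthogonal)) ⟩
      1# * 1# + - (0# * 0#)                              ≈⟨ solve 0 (con (+ 1) :* con (+ 1) :- con (+ 0) :* con (+ 0) := con (+ 1)) refl ⟩
      1#                                                 ∎

  nonDegenerate-move : ∀ g {T} → NonDegenerate T → NonDegenerate (moveT g T)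
  nonDegenerate-move g {T} nd p = nd (*-≈0-cancelˡ nd (trans (sym (area-move g T)) (trans (*-congʳ p) (zeroˡ _))))

-- Neighbours of a tile, and vertices on its sides

module Tilings (ℝ : CompleteOrderedField) (P : Pred (Pinwheel.Triangle ℝ) _)
               (pinwheel : Pinwheel.IsPinwheelTiling ℝ P) where
  open CompleteOrderedField ℝ
  open FieldProperties ℝ
  open Barycentric ℝ
  open Patches ℝ
  open Pinwheel ℝ hiding (IsVertex)
  open Triangle
  open IsPinwheelTiling pinwheel
  open IsTiling isTiling

  IsVertex : Pred Point _
  IsVertex = Pinwheel.IsVertex ℝ P

  nonDegenerate : ∀ {T} → P T → NonDegenerate T
  nonDegenerate {T} PT with g , e ← copies T PT = nonDegenerate-resp (≈ₜ-sym e) (nonDegenerate-move g nonDegenerate-K)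

  same-tile : ∀ {N V z y} → P N → P V → (c : Coordinates N z) (d : Coordinates N y) →
    (∀ i → 0# < w c i ⊎ (w c i ≈ 0# × 0# < w d i)) → InTriangle V z → InInterior V y → V ≈ₜ N
  same-tile {N} {V} PN PV c d cone zV yV = let x , xN , xV = interiors-meet {N} {V} c d cone zV yV in packs V N x PV PN xV xN

  centre : Triangle → Point
  centre T = comb T centreWeights

  centre-interior : ∀ T → InInterior T (centre T)
  centre-interior T = inInterior⁺ (centre-coordinates T) 0<centreWeights

  -- Around the triangles of a finite list, P contains all tiles of some patch.
  record Locally (T : Triangle) (L : List Triangle) : Set where
    field
      {size}  : ℕ
      S       : Triangle
      nd      : NonDegenerate S
      address : Vec (Fin 5) size
      T≈      : T ≈ₜ tileAt address S
      inP     : All (λ C → ∀ (b : Vec (Fin 5) size) → C ≈ₜ tileAt b S → P C) L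
      inS     : All (λ C → InTriangle S (centre C)) L

  cover : Triangle → Triangle
  cover C = proj₁ (covers (centre C))

  cover-P : ∀ C → P (cover C)
  cover-P C = proj₁ (proj₂ (covers (centre C)))

  cover-∋ : ∀ C → InTriangle (cover C) (centre C)
  cover-∋ C = proj₂ (proj₂ (covers (centre C)))

  -- The patch is taken to contain `T` and a tile of `P` over the centre of each listed triangle. If
  -- such a triangle is itself a tile of the patch, it overlaps the one over its centre, and tiles
  -- of one patch that overlap are equal.
  locally : ∀ {T} → P T → ∀ L → Locally T L
  locally {T} PT L
    with n , g , all-F ← patches (T ∷ List.map cover L) (PT ∷ All.map⁺ (All.universal cover-P L)) = record
    { S       = S
    ; nd      = nd
    ; address = proj₁ (inPatch (All.head all-F))
    ; T≈      = proj₂ (inPatch (All.head all-F))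
    ; inP     = All.map (λ {C} → transferP {C}) (All.map⁻ (All.tail all-F))
    ; inS     = All.map (λ {C} → transferS {C}) (All.map⁻ (All.tail all-F))
    }
    where
    S : Triangle
    S = moveT g (expanded n)
    nd : NonDegenerate S
    nd = nonDegenerate-move g (nonDegenerate-expanded n)
    inPatch : ∀ {C} → (∃[ U ] ωⁿK n U × C ≈ₜ moveT g U) → ∃[ a ] C ≈ₜ tileAt {n} a S
    inPatch (U , U∈ , e) with a , f ← ωⁿK⇒tileAt n U∈ =
      a , ≈ₜ-trans e (≈ₜ-trans (mapT-cong (apply-cong g) f) (mapT-tileAt (apply-preserves g) a (expanded n)))
    transferS : ∀ {C} → (∃[ U ] ωⁿK n U × cover C ≈ₜ moveT g U) → InTriangle S (centre C)
    transferS {C} h = let a , e = inPatch h in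
      tileAt⊆ a {S} (inTriangle-resp {cover C} {tileAt a S} e ≈ₚ-refl (cover-∋ C))
    transferP : ∀ {C} → (∃[ U ] ωⁿK n U × cover C ≈ₜ moveT g U) → ∀ (b : Vec (Fin 5) n) → C ≈ₜ tileAt b S → P C
    transferP {C} h b C≈ = respects (≈ₜ-trans e (≈ₜ-trans same (≈ₜ-sym C≈))) (cover-P C)
      where
      a = proj₁ (inPatch h)
      e : cover C ≈ₜ tileAt a S
      e = proj₂ (inPatch h)
      common : ∃[ x ] InInterior (tileAt b S) x × InInterior (tileAt a S) x
      common = interiors-meet {tileAt b S} {tileAt a S} (coordinates-resp C≈ ≈ₚ-refl (centre-coordinates C))
        (coordinates (nonDegenerate-tileAt b nd) (centre (tileAt a S))) (λ i → inj₁ (0<centreWeights i))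
        (inTriangle-resp {cover C} {tileAt a S} e ≈ₚ-refl (cover-∋ C)) (centre-interior (tileAt a S))
      same : tileAt a S ≈ₜ tileAt b S
      same i = reflexiveₚ (≡.cong (λ c → corner (tileAt c S) i)
        (tiles-disjoint a b {S} nd (proj₂ (proj₂ common)) (proj₁ (proj₂ common))))
        where
        reflexiveₚ : ∀ {p q} → p ≡ q → p ≈ₚ q
        reflexiveₚ ≡.refl = ≈ₚ-refl

  neighbourOf : Fin 12 → Triangle → Triangle
  neighbourOf m T = tri ⟪ neighbour (moves m) ⟫ T

  neighbourOf-affine : ∀ m → Affine ⟪ neighbour (moves m) ⟫
  neighbourOf-affine m = ⟪⟫-affine {neighbour (moves m)} (neighbours-affine m)

  neighbours : Triangle → List Triangle
  neighbours T = List.tabulate (λ m → neighbourOf m T)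

  beyond-column : ∀ {k c} → Beyond k c → ∀ v → lin v (λ l → tenth * ⟦ c l ⟧) ≈ v k * (tenth * ⟦ c k ⟧) × tenth * ⟦ c k ⟧ < 0#
  beyond-column {k} {c} h v = lin-single v _ k zeros , negative
    where
    zeros : ∀ l → l ≢ k → tenth * ⟦ c l ⟧ ≈ 0#
    zeros l l≢k with h l
    ... | inj₁ (e , _) = ⊥-elim (l≢k e)
    ... | inj₂ (_ , e) = trans (*-congˡ (reflexive (≡.cong ⟦_⟧ e))) (zeroʳ _)
    negative : tenth * ⟦ c k ⟧ < 0#
    negative with h k
    ... | inj₁ (_ , p) = *-neg 0<tenth (⟦⟧<0 p)
    ... | inj₂ (n , _) = ⊥-elim (n ≡.refl)

  -- The centre of the neighbour lies in `S` but beyond the segment, where the weight opposite to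
  -- the segment is negative.
  not-boundary : ∀ {S T U} m → T ≈ₜ U → InTriangle S (centre (neighbourOf m T)) →
                 ¬ OnBoundary S U (opposite (segment (moves m)))
  not-boundary {S} {T} m e inS b = 0<⇒≮0 (b inS (coordinates-resp e ≈ₚ-refl
      (coordinates-tri ⟪ neighbour (moves m) ⟫ (neighbourOf-affine m) (centre-coordinates (neighbourOf m T)))))
    (<-respˡ-≈ (sym (proj₁ col)) (*-neg (0<centreWeights (apex (moves m))) (proj₂ col)))
    where col = beyond-column (moves-beyond m) centreWeights

  neighbour-exists : ∀ {T} → P T → ∀ s → ∃[ m ] segment (moves m) ≡ s × P (neighbourOf m T)
  neighbour-exists {T} PT s = [ on-boundary , inside ]′ (boundary-or-neighbour address {S} nd s)
    where
    open Locally (locally PT (neighbours T))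
    inside : NeighbourIn S address s → ∃[ m ] segment (moves m) ≡ s × P (neighbourOf m T)
    inside (m , b , e , t) = m , e , All.tabulate⁻ {f = λ m → neighbourOf m T} inP m b (≈ₜ-trans (tri-cong ⟪ neighbour (moves m) ⟫ T≈) (≈ₜ-sym t))
    on-boundary : OnBoundary S (tileAt address S) (opposite s) → ∃[ m ] segment (moves m) ≡ s × P (neighbourOf m T)
    on-boundary b = ⊥-elim (not-boundary {S} {T} {tileAt address S} m T≈ (All.tabulate⁻ {f = λ m → neighbourOf m T} inS m)
      (≡.subst (λ s → OnBoundary S (tileAt address S) (opposite s)) (≡.sym (proj₂ (segments-moves s))) b))
      -- Some candidate across `s`, whether or not it is a tile: its centre lies in `S`, which
      -- refutes the boundary case.
      where m = proj₁ (segments-moves s)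

  mirrorImage : Triangle → Triangle
  mirrorImage = tri ⟪ mirror ⟫

  -- Which piece of its parent `T` is becomes known only with the patch, after the list of triangles
  -- has been fixed; hence the list contains the triangles for all five possibilities.
  images reflections : Triangle → Fin 5 → Triangle
  images T i      = tri ⟪ toMirrored i ⟫ T
  reflections T i = mirrorImage (images T i)

  mirrored-pair : ∀ {T} → P T → ∃[ A ] P A × P (mirrorImage A)
  mirrored-pair {T} PT = go (locally PT (neighbours T ++ (List.tabulate (images T) ++ List.tabulate (reflections T))))
    where
    go : Locally T (neighbours T ++ (List.tabulate (images T) ++ List.tabulate (reflections T))) → ∃[ A ] P A × P (mirrorImage A)
    -- A patch of a single tile has no parent in it. It cannot arise, for it would not contain the
    -- centre of the neighbour of `T` by move 0.
    go record { S = S ; nd = nd ; address = [] ; T≈ = T≈ ; inS = inS } =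
      ⊥-elim (not-boundary {S} {T} {S} 0F T≈ (All.tabulate⁻ {f = λ m → neighbourOf m T} (All.++⁻ˡ (neighbours T) inS) 0F) (whole-boundary {S} nd (opposite shortLeg)))
    go record { S = S ; address = i ∷ a ; T≈ = T≈ ; inP = inP } = images T i
      , All.tabulate⁻ {f = images T} (All.++⁻ˡ (List.tabulate (images T)) inP′) i (j ∷ a) image≈
      , All.tabulate⁻ {f = reflections T} (All.++⁻ʳ (List.tabulate (images T)) inP′) i (k ∷ a) (≈ₜ-trans (tri-cong ⟪ mirror ⟫ image≈)
          (≈ₜ-trans (tri-≐ mirror (pieceMatrix j) (pieceMatrix k) identity eq′ (tileAt a S))
            (tri-cong ⟪ pieceMatrix k ⟫ (tri-identity (tileAt a S)))))
      where
      j = proj₁ (pieces-mirrored i)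
      k = proj₁ (proj₂ (pieces-mirrored i))
      eq : toMirrored i ⊠ pieceMatrix i ≐ pieceMatrix j ⊠ identity
      eq = proj₁ (proj₂ (proj₂ (pieces-mirrored i)))
      eq′ : mirror ⊠ pieceMatrix j ≐ pieceMatrix k ⊠ identity
      eq′ = proj₂ (proj₂ (proj₂ (pieces-mirrored i)))
      inP′ = All.++⁻ʳ (neighbours T) inP
      image≈ : images T i ≈ₜ part j (tileAt a S)
      image≈ = ≈ₜ-trans (tri-cong ⟪ toMirrored i ⟫ T≈)
        (≈ₜ-trans (tri-≐ (toMirrored i) (pieceMatrix i) (pieceMatrix j) identity eq (tileAt a S))
          (tri-cong ⟪ pieceMatrix j ⟫ (tri-identity (tileAt a S))))

  mirrorImage-right : ∀ T → right T ≈ₚ right (mirrorImage T)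
  mirrorImage-right T = ≈ₚ-trans (corner≈comb T 0F) (≈ₚ-sym (corner-tri ⟪ mirror ⟫ T 0F))

  mirrorImage-long : ∀ T → long T ≈ₚ long (mirrorImage T)
  mirrorImage-long T = ≈ₚ-trans (corner≈comb T 2F) (≈ₚ-sym (corner-tri ⟪ mirror ⟫ T 2F))

  spotAt : Triangle → Fin 4 → Point
  spotAt T k = comb T ⟨ spot k ⟩

  spot-coordinates : ∀ T k → Coordinates T (spotAt T k)
  spot-coordinates T k = record { w = ⟨ spot k ⟩ ; sum≈1 = ⟨⟩-total {spot k} (spots-affine k) ; at = ≈ₚ-refl }

  cornerSpot : Fin 3 → Fin 4
  cornerSpot = Fin.inject₁

  corner≈spot : ∀ T i → corner T i ≈ₚ spotAt T (cornerSpot i)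
  corner≈spot T = forFin3 (corner≈comb T 0F) (corner≈comb T 1F) (corner≈comb T 2F)

  spotAt-cong : ∀ {T U} k → T ≈ₜ U → spotAt T k ≈ₚ spotAt U k
  spotAt-cong k t = comb-congˡ ⟨ spot k ⟩ t

  spotAt-injective : ∀ {T} → NonDegenerate T → ∀ i j → spotAt T i ≈ₚ spotAt T j → i ≡ j
  spotAt-injective {T} nd i j e = spots-distinct i j λ l → ⟦⟧-injective _ _ (*-cancelˡ (0<⇒≉0 0<tenth)
    (coordinates-unique nd (spot-coordinates T i) (spot-coordinates T j) e l))

  neighbour-spot : ∀ T M (a b : Row) → (∀ j → (a ⊡ M) j ≡ (b ⊡ identity) j) → comb (tri ⟪ M ⟫ T) ⟨ a ⟩ ≈ₚ comb T ⟨ b ⟩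
  neighbour-spot T M a b e = ≈ₚ-trans (comb-⟨⟩-cong a M b identity e T) (comb-congˡ ⟨ b ⟩ (tri-identity T))

  start≈ : ∀ m T → spotAt (neighbourOf m T) (startSpot (moves m)) ≈ₚ spotAt T (startOf (segment (moves m)))
  start≈ m T = neighbour-spot T (neighbour (moves m)) (spot (startSpot (moves m))) (spot (startOf (segment (moves m)))) (startSpots m)

  end≈ : ∀ m T → spotAt (neighbourOf m T) (endSpot (moves m)) ≈ₚ spotAt T (endOf (segment (moves m)))
  end≈ m T = neighbour-spot T (neighbour (moves m)) (spot (endSpot (moves m))) (spot (endOf (segment (moves m)))) (endSpots m)

  InsideSide : Fin 3 → Weights → Set
  InsideSide k v = ∀ i → (i ≡ k × v i ≈ 0#) ⊎ (i ≢ k × 0# < v i)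

  strictlyBetween-coordinates : ∀ {T k p q a b z} → Normalised a → Normalised b → Meets a b k →
    p ≈ₚ comb T ⟨ a ⟩ → q ≈ₚ comb T ⟨ b ⟩ → StrictlyBetween p q z → Σ[ c ∈ Coordinates T z ] InsideSide k (w c)
  strictlyBetween-coordinates {T} {k} {p} {q} {a} {b} {z} na nb meets p≈ q≈ (s , t , 0<s , 0<t , s+t , z≈) = c , inside
    where
    s≈ : s ≈ 1# + - t
    s≈ = linear₁ 1# s+t (solve 2 (λ s t → s :+ con (+ 1) :* con (+ 1) := con (+ 1) :- t :+ con (+ 1) :* (s :+ t)) refl s t)
    0<1-t : 0# < 1# + - t
    0<1-t = <-respʳ-≈ s≈ 0<s
    c : Coordinates T z
    c = coordinates-resp ≈ₜ-refl (≈ₚ-sym (≈ₚ-trans z≈ (⊕-cong (·-cong s≈ ≈ₚ-refl) ≈ₚ-refl))) (mix-coordinates t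
      (record { w = ⟨ a ⟩ ; sum≈1 = ⟨⟩-total {a} na ; at = p≈ }) (record { w = ⟨ b ⟩ ; sum≈1 = ⟨⟩-total {b} nb ; at = q≈ }))
    inside : InsideSide k (λ i → mix t (⟨ a ⟩ i) (⟨ b ⟩ i))
    inside i with meets i
    ... | inj₁ (e , ea , eb) = inj₁ (e , trans (+-cong (*-congˡ (zero′ ea)) (*-congˡ (zero′ eb)))
            (trans (+-cong (zeroʳ _) (zeroʳ _)) (+-identityʳ _)))
      where zero′ : ∀ {n} → n ≡ 0ℤ → tenth * ⟦ n ⟧ ≈ 0#
            zero′ e = trans (*-congˡ (reflexive (≡.cong ⟦_⟧ e))) (zeroʳ _)
    ... | inj₂ (n , _ , pb , inj₁ pa) = inj₂ (n , 0<+≤ (*-pos 0<1-t (⟨⟩-pos pa)) (0≤* (inj₁ 0<t) (⟨⟩-nonneg pb)))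
    ... | inj₂ (n , pa , _ , inj₂ pb) = inj₂ (n , 0≤+< (0≤* (inj₁ 0<1-t) (⟨⟩-nonneg pa)) (*-pos 0<t (⟨⟩-pos pb)))

  -- Corner `i` has weight zero at every other index; an index distinct from both `i` and `k`
  -- contradicts positivity inside the side.
  inside-not-corner : ∀ {T z k} → NonDegenerate T → (c : Coordinates T z) → InsideSide k (w c) → ∀ i → ¬ (z ≈ₚ corner T i)
  inside-not-corner {T} {z} {k} nd c inside i e = 0<⇒≉0 (positive (inside l))
      (trans (coordinates-unique nd c (corner-coordinates T i) e l) (off-diagonal i l (proj₁ (proj₂ (third i k)))))
    where
    l = proj₁ (third i k)
    positive : (l ≡ k × w c l ≈ 0#) ⊎ (l ≢ k × 0# < w c l) → 0# < w c l
    positive (inj₁ (l≡k , _)) = ⊥-elim (proj₂ (proj₂ (third i k)) l≡k)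
    positive (inj₂ (_ , p))   = p
    off-diagonal : ∀ i l → l ≢ i → vertexWeights i l ≈ 0#
    off-diagonal 0F 0F n = ⊥-elim (n ≡.refl)
    off-diagonal 0F 1F n = refl
    off-diagonal 0F 2F n = refl
    off-diagonal 1F 0F n = refl
    off-diagonal 1F 1F n = ⊥-elim (n ≡.refl)
    off-diagonal 1F 2F n = refl
    off-diagonal 2F 0F n = refl
    off-diagonal 2F 1F n = refl
    off-diagonal 2F 2F n = ⊥-elim (n ≡.refl)

  corner-in : ∀ T i → InTriangle T (corner T i)
  corner-in T i = inTriangle⁺ (corner-coordinates T i) (nonneg i)
    where
    nonneg : ∀ i j → 0# ≤ vertexWeights i j
    nonneg = forFin3 (forFin3 (inj₁ 0<1) (inj₂ refl) (inj₂ refl)) (forFin3 (inj₂ refl) (inj₁ 0<1) (inj₂ refl))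
               (forFin3 (inj₂ refl) (inj₂ refl) (inj₁ 0<1))

  ≉0⇒sign : ∀ {x} → ¬ (x ≈ 0#) → 0# < x ⊎ x < 0#
  ≉0⇒sign {x} n with compare 0# x
  ... | tri< p _ _ = inj₁ p
  ... | tri≈ _ p _ = ⊥-elim (n (sym p))
  ... | tri> _ _ p = inj₂ p

  <0-factor : ∀ {x y} → y < 0# → x * y < 0# → 0# < x
  <0-factor {x} {y} y<0 xy<0 = *-pos-cancelˡ (<0⇒0<- y<0)
    (<-respʳ-≈ (solve 2 (λ x y → :- (x :* y) := :- y :* x) refl x y) (<0⇒0<- xy<0))

  transfer : ∀ {T y} M → (∀ l → Normalised (M l)) → NonDegenerate T → (c : Coordinates T y) (d : Coordinates (tri ⟪ M ⟫ T) y) →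
             ∀ j → w c j ≈ lin (w d) (λ l → tenth * ⟦ column M j l ⟧)
  transfer M aff nd c d j = coordinates-unique nd c (coordinates-tri ⟪ M ⟫ (⟪⟫-affine {M} aff) d) ≈ₚ-refl j

  beyond-positive : ∀ {T y k k′} M → (∀ l → Normalised (M l)) → NonDegenerate T → Beyond k′ (column M k) →
    (c : Coordinates T y) (d : Coordinates (tri ⟪ M ⟫ T) y) → w c k < 0# → 0# < w d k′
  beyond-positive {k = k} M aff nd b c d c<0 = <0-factor (proj₂ col) (<-respˡ-≈ (trans (transfer M aff nd c d k) (proj₁ col)) c<0)
    where col = beyond-column b (w d)

  -- T and N cover a neighbourhood of z, so V overlaps one of them.
  two-sided : ∀ {T V z k k′} M → (∀ l → Normalised (M l)) → P T → P (tri ⟪ M ⟫ T) → P V → Beyond k′ (column M k) →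
    (c : Coordinates T z) → InsideSide k (w c) → (d : Coordinates (tri ⟪ M ⟫ T) z) → InsideSide k′ (w d) →
    InTriangle V z → V ≈ₜ T ⊎ V ≈ₜ tri ⟪ M ⟫ T
  two-sided {T} {V} {z} {k} {k′} M aff PT PN PV beyond c ic d id zV = go (interior-off-line (nonDegenerate PT) (nonDegenerate PV) k)
    where
    go : (∃[ y ] InInterior V y × ¬ (barycentric (nonDegenerate PT) y k ≈ 0#)) → V ≈ₜ T ⊎ V ≈ₜ tri ⟪ M ⟫ T
    go (y , yV , y≉0) = [ front , back ]′ (≉0⇒sign y≉0)
      where
      f = coordinates (nonDegenerate PT) y
      e = coordinates (nonDegenerate PN) y
      front : 0# < w f k → V ≈ₜ T ⊎ V ≈ₜ tri ⟪ M ⟫ T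
      front 0<y = inj₁ (same-tile PT PV c f (λ i → cone i (ic i)) zV yV)
        where
        cone : ∀ i → (i ≡ k × w c i ≈ 0#) ⊎ (i ≢ k × 0# < w c i) → 0# < w c i ⊎ (w c i ≈ 0# × 0# < w f i)
        cone i (inj₁ (≡.refl , p)) = inj₂ (p , 0<y)
        cone i (inj₂ (_ , p))      = inj₁ p
      back : w f k < 0# → V ≈ₜ T ⊎ V ≈ₜ tri ⟪ M ⟫ T
      back y<0 = inj₂ (same-tile PN PV d e (λ i → cone i (id i)) zV yV)
        where
        0<e : 0# < w e k′
        0<e = beyond-positive M aff (nonDegenerate PT) beyond f e y<0
        cone : ∀ i → (i ≡ k′ × w d i ≈ 0#) ⊎ (i ≢ k′ × 0# < w d i) → 0# < w d i ⊎ (w d i ≈ 0# × 0# < w e i)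
        cone i (inj₁ (≡.refl , p)) = inj₂ (p , 0<e)
        cone i (inj₂ (_ , p))      = inj₁ p

  -- A tile with a corner at `z` would be one of the two tiles, but `z` lies inside a side of each.
  two-sided-no-vertex : ∀ {T z k k′} M → (∀ l → Normalised (M l)) → P T → P (tri ⟪ M ⟫ T) → Beyond k′ (column M k) →
    (c : Coordinates T z) → InsideSide k (w c) → (d : Coordinates (tri ⟪ M ⟫ T) z) → InsideSide k′ (w d) → ¬ IsVertex z
  two-sided-no-vertex M aff PT PN beyond c ic d id (V , PV , i , z≈) =
    [ (λ V≈T → inside-not-corner (nonDegenerate PT) c ic i (≈ₚ-trans z≈ (V≈T i)))
    , (λ V≈N → inside-not-corner (nonDegenerate PN) d id i (≈ₚ-trans z≈ (V≈N i)))
    ]′ (two-sided M aff PT PN PV beyond c ic d id (inTriangle-resp (≈ₜ-refl {V}) (≈ₚ-sym z≈) (corner-in V i)))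

  no-vertex-in-segment : ∀ {T} → P T → ∀ s {z} → StrictlyBetween (spotAt T (startOf s)) (spotAt T (endOf s)) z → ¬ IsVertex z
  no-vertex-in-segment {T} PT s zs = go (neighbour-exists PT s) zs
    where
    go : ∀ {s z} → (∃[ m ] segment (moves m) ≡ s × P (neighbourOf m T)) → StrictlyBetween (spotAt T (startOf s)) (spotAt T (endOf s)) z → ¬ IsVertex z
    go {s} (m , ≡.refl , PN) zs =
      two-sided-no-vertex (neighbour (moves m)) (neighbours-affine m) PT PN (moves-beyond m) (proj₁ cT) (proj₂ cT) (proj₁ cN) (proj₂ cN)
      where
      cT = strictlyBetween-coordinates {T} (spots-affine (startOf s)) (spots-affine (endOf s)) (segments-meet s) ≈ₚ-refl ≈ₚ-refl zs
      cN = strictlyBetween-coordinates {neighbourOf m T} (spots-affine (startSpot (moves m))) (spots-affine (endSpot (moves m)))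
             (moves-meet m) (≈ₚ-sym (start≈ m T)) (≈ₚ-sym (end≈ m T)) zs

  -- The mirror image shares the whole leg, so the argument for segments covers the leg without
  -- halving it, midpoint included.
  no-vertex-in-longLeg : ∀ {T} → P T → P (mirrorImage T) → ∀ {z} → StrictlyBetween (right T) (long T) z → ¬ IsVertex z
  no-vertex-in-longLeg {T} PT PN zs =
    two-sided-no-vertex mirror (neighbours-affine 3F) PT PN (moves-beyond 3F) (proj₁ cT) (proj₂ cT) (proj₁ cN) (proj₂ cN)
    where
    cT = strictlyBetween-coordinates {T} (spots-affine 0F) (spots-affine 2F) longLeg-meets (corner≈spot T 0F) (corner≈spot T 2F) zs
    cN = strictlyBetween-coordinates {mirrorImage T} (spots-affine 0F) (spots-affine 2F) longLeg-meets
           (≈ₚ-trans (mirrorImage-right T) (corner≈spot (mirrorImage T) 0F))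
           (≈ₚ-trans (mirrorImage-long T) (corner≈spot (mirrorImage T) 2F)) zs

-- Right angles of tiles with an undivided long leg

module SpecialVertices (ℝ : CompleteOrderedField) (P : Pred (Pinwheel.Triangle ℝ) _)
               (pinwheel : Pinwheel.IsPinwheelTiling ℝ P) where
  open CompleteOrderedField ℝ
  open FieldProperties ℝ
  open Barycentric ℝ
  open Patches ℝ
  open Tilings ℝ P pinwheel
  open Pinwheel ℝ hiding (IsVertex)
  open Triangle

  Undivided : Triangle → Set
  Undivided T = ¬ IsVertex (spotAt T mid)

  isVertex-resp : ∀ {x y} → x ≈ₚ y → IsVertex x → IsVertex y
  isVertex-resp e (T , PT , i , x≈) = T , PT , i , ≈ₚ-trans (≈ₚ-sym e) x≈

  corner-at-mid : ∀ {T} m k → endSpot (moves m) ≡ cornerSpot k → endOf (segment (moves m)) ≡ mid →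
                  P (neighbourOf m T) → IsVertex (spotAt T mid)
  corner-at-mid {T} m k e e′ PN = neighbourOf m T , PN , k , ≈ₚ-sym (≈ₚ-trans (corner≈spot (neighbourOf m T) k)
    (≡.subst₂ (λ a b → spotAt (neighbourOf m T) a ≈ₚ spotAt T b) e e′ (end≈ m T)))

  -- Of the four moves across the inner half, all but the mirror image put a corner of the neighbour
  -- at the midpoint of the long leg.
  undivided-mirror : ∀ {T} → P T → Undivided T → P (mirrorImage T)
  undivided-mirror {T} PT u = let m , e , PN = neighbour-exists PT innerHalf in go m e PN
    where
    go : ∀ m → segment (moves m) ≡ innerHalf → P (neighbourOf m T) → P (mirrorImage T)
    go 3F _ PN = PN
    go 4F _ PN = ⊥-elim (u (corner-at-mid {T} 4F 0F ≡.refl ≡.refl PN))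
    go 5F _ PN = ⊥-elim (u (corner-at-mid {T} 5F 2F ≡.refl ≡.refl PN))
    go 6F _ PN = ⊥-elim (u (corner-at-mid {T} 6F 0F ≡.refl ≡.refl PN))
    go 0F () _
    go 1F () _
    go 2F () _
    go 7F () _
    go 8F () _
    go 9F () _
    go (Fin.suc 9F) () _
    go (Fin.suc (Fin.suc 9F)) () _

  Special : Point → Set
  Special x = ∃[ T ] P T × Undivided T × x ≈ₚ right T

  -- In the second case the long leg of `V` passes through `u`. The tile attached to it records that
  -- the right angle of `V` is the short end of a tile, which keeps that right angle from being
  -- special.
  AtRightAngle : Point → Triangle → Set
  AtRightAngle u V = right V ≈ₚ u ⊎ (spotAt V mid ≈ₚ u × ∃[ T ] P T × short T ≈ₚ right V)

  atRightAngle-resp : ∀ {u V W} → V ≈ₜ W → AtRightAngle u V → AtRightAngle u W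
  atRightAngle-resp e (inj₁ p) = inj₁ (≈ₚ-trans (≈ₚ-sym (e 0F)) p)
  atRightAngle-resp e (inj₂ (p , T , PT , q)) =
    inj₂ (≈ₚ-trans (≈ₚ-sym (spotAt-cong 3F e)) p , T , PT , ≈ₚ-trans q (e 0F))

  -- For the reflections in the legs: each preserves one weight, the corresponding column being ten
  -- times a unit vector.
  off-column : ∀ (n : Row) k → (∀ l → l ≢ k → n l ≡ 0ℤ) → n k ≡ + 10 → ∀ v → lin v (λ l → tenth * ⟦ n l ⟧) ≈ v k
  off-column n k z e v = trans (lin-single v (λ l → tenth * ⟦ n l ⟧) k (λ l l≢k → trans (*-congˡ (reflexive (≡.cong ⟦_⟧ (z l l≢k)))) (zeroʳ _)))
    (trans (*-congˡ (trans (*-congˡ (reflexive (≡.cong ⟦_⟧ e))) tenth*10)) (*-identityʳ _))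

  -- Here the long leg of the neighbour N of T passes through the right angle of T.
  flat-tile : ∀ {T V u y} m → segment (moves m) ≡ shortLeg → startSpot (moves m) ≡ mid → apex (moves m) ≡ 1F →
    P T → P (neighbourOf m T) → u ≈ₚ right T → P V → InTriangle V u → InInterior V y →
    (c : Coordinates T y) → w c 2F < 0# → V ≈ₜ neighbourOf m T × spotAt (neighbourOf m T) mid ≈ₚ u
  flat-tile {T} {V} {u} {y} m on-short at-mid apex≡ PT PN u≈ PV uV yV c c₂<0 =
    same-tile PN PV (spot-coordinates N mid) d
      (forFin3 (inj₁ (⟨⟩-pos {+ 5} (ℤ.+<+ (ℕ.s≤s ℕ.z≤n)))) (inj₂ (zeroʳ _ , 0<d₁)) (inj₁ (⟨⟩-pos {+ 5} (ℤ.+<+ (ℕ.s≤s ℕ.z≤n)))))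
      (inTriangle-resp (≈ₜ-refl {V}) (≈ₚ-sym mid≈) uV) yV , mid≈
    where
    N = neighbourOf m T
    d = coordinates (nonDegenerate PN) y
    mid≈ : spotAt N mid ≈ₚ u
    mid≈ = ≈ₚ-trans (≡.subst₂ (λ a b → spotAt N a ≈ₚ spotAt T (startOf b)) at-mid on-short (start≈ m T))
      (≈ₚ-trans (≈ₚ-sym (corner≈spot T 0F)) (≈ₚ-sym u≈))
    0<d₁ : 0# < w d 1F
    0<d₁ = beyond-positive (neighbour (moves m)) (neighbours-affine m) (nonDegenerate PT)
      (≡.subst₂ (λ a b → Beyond a (column (neighbour (moves m)) (opposite b))) apex≡ on-short (moves-beyond m)) c d c₂<0

  -- The legs of T bound four quadrants at u; each is filled near u by a single tile.
  module _ {T V u y} (PT : P T) (und : Undivided T) (u≈ : u ≈ₚ right T) (PV : P V) (uV : InTriangle V u) (yV : InInterior V y)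
           (c : Coordinates T y) (0<c₁ : 0# < w c 1F) where

    front-quadrant : 0# < w c 2F → AtRightAngle u V
    front-quadrant 0<c₂ = inj₁ (≈ₚ-trans (same-tile PT PV (corner-coordinates T 0F) c
          (forFin3 (inj₁ 0<1) (inj₂ (refl , 0<c₁)) (inj₂ (refl , 0<c₂))) (inTriangle-resp (≈ₜ-refl {V}) u≈ uV) yV 0F) (≈ₚ-sym u≈))

    mirrored-quadrant : w c 2F < 0# → P (neighbourOf 0F T) → AtRightAngle u V
    mirrored-quadrant c₂<0 PN = inj₁ (≈ₚ-trans (same-tile PN PV (corner-coordinates N 0F) d
            (forFin3 (inj₁ 0<1) (inj₂ (refl , 0<d₁)) (inj₂ (refl , 0<d₂))) (inTriangle-resp (≈ₜ-refl {V}) u≈rightN uV) yV 0F)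
            (≈ₚ-sym u≈rightN))
      where
      N = neighbourOf 0F T
      u≈rightN : u ≈ₚ right N
      u≈rightN = ≈ₚ-trans u≈ (≈ₚ-trans (corner≈spot T 0F) (≈ₚ-trans (≈ₚ-sym (start≈ 0F T)) (≈ₚ-sym (corner≈spot N 0F))))
      d = coordinates (nonDegenerate PN) y
      0<d₁ : 0# < w d 1F
      0<d₁ = <-respʳ-≈ (trans (transfer (neighbour (moves 0F)) (neighbours-affine 0F) (nonDegenerate PT) c d 1F)
        (off-column (column (neighbour (moves 0F)) 1F) 1F
          (forFin3 {Q = λ l → l ≢ 1F → neighbour (moves 0F) l 1F ≡ 0ℤ} (λ _ → ≡.refl) (λ n → ⊥-elim (n ≡.refl)) (λ _ → ≡.refl)) ≡.refl (w d))) 0<c₁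
      0<d₂ : 0# < w d 2F
      0<d₂ = beyond-positive (neighbour (moves 0F)) (neighbours-affine 0F) (nonDegenerate PT) (moves-beyond 0F) c d c₂<0

    later-moves : ∀ m → segment (moves (Fin.suc (Fin.suc (Fin.suc m)))) ≢ shortLeg
    later-moves = from-yes (all? λ m → ¬? (segment (moves (Fin.suc (Fin.suc (Fin.suc m)))) Fin.≟ shortLeg))

    back-quadrant : w c 2F < 0# → ∀ m → segment (moves m) ≡ shortLeg → P (neighbourOf m T) → AtRightAngle u V
    back-quadrant c₂<0 0F _ PN = mirrored-quadrant c₂<0 PN
    -- The neighbour has its right angle at the short end of `T`.
    back-quadrant c₂<0 1F _ PN = atRightAngle-resp (≈ₜ-sym (proj₁ flat)) (inj₂ (proj₂ flat , T , PT
      , ≈ₚ-trans (corner≈spot T 1F) (≈ₚ-trans (≈ₚ-sym (end≈ 1F T)) (≈ₚ-sym (corner≈spot (neighbourOf 1F T) 0F)))))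
      where flat = flat-tile 1F ≡.refl ≡.refl ≡.refl PT PN u≈ PV uV yV c c₂<0
    -- The right angle of the neighbour is the short end of `T` reflected in `u`, and this is the
    -- short end of the mirror image.
    back-quadrant c₂<0 2F _ PN = atRightAngle-resp (≈ₜ-sym (proj₁ flat)) (inj₂ (proj₂ flat , mirrorImage T , undivided-mirror PT und
      , ≈ₚ-trans (corner-tri ⟪ mirror ⟫ T 1F) (≈ₚ-sym (corner-tri ⟪ neighbour (moves 2F) ⟫ T 0F))))
      where flat = flat-tile 2F ≡.refl ≡.refl ≡.refl PT PN u≈ PV uV yV c c₂<0
    back-quadrant c₂<0 (Fin.suc (Fin.suc (Fin.suc m))) e _ = ⊥-elim (later-moves m e)

    quadrant : ¬ (w c 2F ≈ 0#) → AtRightAngle u V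
    quadrant c₂≉0 = [ front-quadrant , (λ c₂<0 → let m , e , PN = neighbour-exists PT shortLeg in back-quadrant c₂<0 m e PN) ]′ (≉0⇒sign c₂≉0)

  undivided-mirrorImage : ∀ {T} → Undivided T → Undivided (mirrorImage T)
  undivided-mirrorImage {T} u v = u (isVertex-resp (end≈ 3F T) v)

  -- An interior point of `V` off the lines of both legs of `T` falls into one of the four quadrants
  -- at `u`. If it is beyond the long leg, the mirror image, with the same right angle and the same
  -- undivided leg, takes the role of `T`.
  special-atRightAngle : ∀ {u V} → Special u → P V → InTriangle V u → AtRightAngle u V
  special-atRightAngle {u} {V} (T , PT , und , u≈) PV uV =
    let y , yV , c₁≉0 , c₂≉0 = interior-off-lines (nonDegenerate PT) (nonDegenerate PV) 1F 2F in
    [ (λ 0<c₁ → quadrant PT und u≈ PV uV yV (coordinates (nonDegenerate PT) y) 0<c₁ c₂≉0) , other-side y yV c₂≉0 ]′ (≉0⇒sign c₁≉0)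
    where
    PT′ : P (mirrorImage T)
    PT′ = undivided-mirror PT und
    other-side : ∀ y → InInterior V y → ¬ (barycentric (nonDegenerate PT) y 2F ≈ 0#) → barycentric (nonDegenerate PT) y 1F < 0# → AtRightAngle u V
    other-side y yV c₂≉0 c₁<0 = quadrant {mirrorImage T} {V} {u} {y} PT′ (undivided-mirrorImage {T} und)
        (≈ₚ-trans u≈ (mirrorImage-right T)) PV uV yV d 0<d₁ d₂≉0
      where
      c : Coordinates T y
      c = coordinates (nonDegenerate PT) y
      d : Coordinates (mirrorImage T) y
      d = coordinates (nonDegenerate PT′) y
      0<d₁ : 0# < w d 1F
      0<d₁ = beyond-positive mirror (neighbours-affine 3F) (nonDegenerate PT) (moves-beyond 3F) c d c₁<0
      c₂≈d₂ : w c 2F ≈ w d 2F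
      c₂≈d₂ = trans (transfer mirror (neighbours-affine 3F) (nonDegenerate PT) c d 2F)
        (off-column (column mirror 2F) 2F (forFin3 {Q = λ l → l ≢ 2F → mirror l 2F ≡ 0ℤ} (λ _ → ≡.refl) (λ _ → ≡.refl) (λ n → ⊥-elim (n ≡.refl))) ≡.refl (w d))
      d₂≉0 : ¬ (w d 2F ≈ 0#)
      d₂≉0 d₂≈0 = c₂≉0 (trans c₂≈d₂ d₂≈0)

  -- A tile at a special vertex has its right angle or its midpoint there, and both differ from its
  -- short end.
  special-not-short : ∀ {u T} → Special u → P T → ¬ (short T ≈ₚ u)
  special-not-short {u} {T} su PT e = [ (λ r≈ → not-spot 0F (λ ()) (≈ₚ-trans (≈ₚ-sym (corner≈spot T 0F)) r≈))
                                      , (λ m≈ → not-spot mid (λ ()) (proj₁ m≈)) ]′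
      (special-atRightAngle {u} {T} su PT (inTriangle-resp {T} {T} ≈ₜ-refl e (corner-in T 1F)))
    where
    not-spot : ∀ k → k ≢ 1F → ¬ (spotAt T k ≈ₚ u)
    not-spot k k≢1 k≈ = k≢1 (spotAt-injective {T} (nonDegenerate PT) k 1F (≈ₚ-trans k≈ (≈ₚ-trans (≈ₚ-sym e) (corner≈spot T 1F))))

  -- If the right angle of `V` were at one of the points and its midpoint at the other, the former
  -- would be the short end of a tile. Applied to the tile that carries an edge, this gives the
  -- independence of the special vertices.
  special-unique : ∀ {u v V} → Special u → Special v → P V → InTriangle V u → InTriangle V v → u ≈ₚ v
  special-unique {u} {v} {V} su sv PV uV vV = go (special-atRightAngle {u} {V} su PV uV) (special-atRightAngle {v} {V} sv PV vV)
    where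
    go : AtRightAngle u V → AtRightAngle v V → u ≈ₚ v
    go (inj₁ r≈u) (inj₁ r≈v) = ≈ₚ-trans (≈ₚ-sym r≈u) r≈v
    go (inj₁ r≈u) (inj₂ (_ , T , PT , s≈r)) = ⊥-elim (special-not-short {u} {T} su PT (≈ₚ-trans s≈r r≈u))
    go (inj₂ (_ , T , PT , s≈r)) (inj₁ r≈v) = ⊥-elim (special-not-short {v} {T} sv PT (≈ₚ-trans s≈r r≈v))
    go (inj₂ (m≈u , _)) (inj₂ (m≈v , _)) = ≈ₚ-trans (≈ₚ-sym m≈u) m≈v

  -- Classification of the edges

  InSegment-sym : ∀ {p q x} → InSegment p q x → InSegment q p x
  InSegment-sym (s , t , 0≤s , 0≤t , e , x≈) = t , s , 0≤t , 0≤s , trans (+-comm t s) e , ≈ₚ-trans x≈ (+-comm _ _ , +-comm _ _)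

  InSegment-resp : ∀ {p q p′ q′ x} → p ≈ₚ p′ → q ≈ₚ q′ → InSegment p q x → InSegment p′ q′ x
  InSegment-resp ep eq (s , t , 0≤s , 0≤t , e , x≈) = s , t , 0≤s , 0≤t , e , ≈ₚ-trans x≈ (⊕-cong (·-cong refl ep) (·-cong refl eq))

  StrictlyBetween-resp : ∀ {p q p′ q′ x x′} → p ≈ₚ p′ → q ≈ₚ q′ → x ≈ₚ x′ → StrictlyBetween p q x → StrictlyBetween p′ q′ x′
  StrictlyBetween-resp ep eq ex (s , t , 0<s , 0<t , e , x≈) =
    s , t , 0<s , 0<t , e , ≈ₚ-trans (≈ₚ-sym ex) (≈ₚ-trans x≈ (⊕-cong (·-cong refl ep) (·-cong refl eq)))

  segment-cases : ∀ {p q x} → InSegment p q x → x ≈ₚ p ⊎ x ≈ₚ q ⊎ StrictlyBetween p q x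
  segment-cases (s , t , inj₁ 0<s , inj₁ 0<t , e , x≈) = inj₂ (inj₂ (s , t , 0<s , 0<t , e , x≈))
  segment-cases {p} {q} (s , t , 0≤s , inj₂ 0≈t , e , x≈) =
    inj₁ (≈ₚ-trans x≈ (eval (proj₁ p) (proj₁ q) , eval (proj₂ p) (proj₂ q)))
    where
    eval : ∀ a b → s * a + t * b ≈ a
    eval a b = linear₂ a (a + - b) e 0≈t (solve 4 (λ s t a b → s :* a :+ t :* b :+ (a :* con (+ 1) :+ (a :- b) :* t)
      := a :+ (a :* (s :+ t) :+ (a :- b) :* con (+ 0))) refl s t a b)
  segment-cases {p} {q} (s , t , inj₂ 0≈s , inj₁ _ , e , x≈) =
    inj₂ (inj₁ (≈ₚ-trans x≈ (eval (proj₁ p) (proj₁ q) , eval (proj₂ p) (proj₂ q))))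
    where
    eval : ∀ a b → s * a + t * b ≈ b
    eval a b = linear₂ b (b + - a) e 0≈s (solve 4 (λ s t a b → s :* a :+ t :* b :+ (b :* con (+ 1) :+ (b :- a) :* s)
      := b :+ (b :* (s :+ t) :+ (b :- a) :* con (+ 0))) refl s t a b)

  vertex-on-segment : ∀ {T x} → P T → ∀ s → IsVertex x → InSegment (spotAt T (startOf s)) (spotAt T (endOf s)) x →
                      x ≈ₚ spotAt T (startOf s) ⊎ x ≈ₚ spotAt T (endOf s)
  vertex-on-segment {T} {x} PT s vx xs = go (segment-cases {spotAt T (startOf s)} {spotAt T (endOf s)} {x} xs)
    where
    go : x ≈ₚ spotAt T (startOf s) ⊎ x ≈ₚ spotAt T (endOf s) ⊎ StrictlyBetween (spotAt T (startOf s)) (spotAt T (endOf s)) x →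
         x ≈ₚ spotAt T (startOf s) ⊎ x ≈ₚ spotAt T (endOf s)
    go (inj₁ p)        = inj₁ p
    go (inj₂ (inj₁ p)) = inj₂ p
    go (inj₂ (inj₂ b)) = ⊥-elim (no-vertex-in-segment {T} PT s {x} b vx)

  mid≈ : ∀ T → spotAt T mid ≈ₚ half · spotAt T 0F ⊕ half · spotAt T 2F
  mid≈ T = eval (λ i → proj₁ (corner T i)) , eval (λ i → proj₂ (corner T i))
    where
    eval : ∀ f → lin ⟨ spot mid ⟩ f ≈ half * lin ⟨ spot 0F ⟩ f + half * lin ⟨ spot 2F ⟩ f
    eval f = trans (sym (*-identityˡ _)) (trans (*-congʳ (sym half+half))
      (solve 5 (λ t h a b c → (h :+ h) :* (t :* con (+ 5) :* a :+ t :* con (+ 0) :* b :+ t :* con (+ 5) :* c)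
         := h :* (t :* con (+ 10) :* a :+ t :* con (+ 0) :* b :+ t :* con (+ 0) :* c)
            :+ h :* (t :* con (+ 0) :* a :+ t :* con (+ 0) :* b :+ t :* con (+ 10) :* c))
       refl tenth half (f 0F) (f 1F) (f 2F)))

  -- The leg consists of two segments. The larger of the weights `s` and `t` tells in which half the
  -- point lies; relative to that half, the midpoint receives twice the smaller weight.
  vertex-on-longLeg : ∀ {T x} → P T → IsVertex x → InSegment (spotAt T 0F) (spotAt T 2F) x →
                      x ≈ₚ spotAt T 0F ⊎ x ≈ₚ spotAt T 2F ⊎ x ≈ₚ spotAt T mid
  vertex-on-longLeg {T} {x} PT vx xs = go (segment-cases {spotAt T 0F} {spotAt T 2F} {x} xs)
    where
    Goal : Set
    Goal = x ≈ₚ spotAt T 0F ⊎ x ≈ₚ spotAt T 2F ⊎ x ≈ₚ spotAt T mid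
    between : StrictlyBetween (spotAt T 0F) (spotAt T 2F) x → Goal
    between (s , t , 0<s , 0<t , e , x≈) = compared (compare s t)
      where
      inner-eval : ∀ a b → (s + - t) * a + (t + t) * (half * a + half * b) ≈ s * a + t * b
      inner-eval a b = linear₁ (t * (a + b)) half+half (solve 5 (λ s t h a b →
        (s :- t) :* a :+ (t :+ t) :* (h :* a :+ h :* b) :+ t :* (a :+ b) :* con (+ 1)
        := s :* a :+ t :* b :+ t :* (a :+ b) :* (h :+ h)) refl s t half a b)
      outer-eval : ∀ a b → (s + s) * (half * a + half * b) + (t + - s) * b ≈ s * a + t * b
      outer-eval a b = linear₁ (s * (a + b)) half+half (solve 5 (λ s t h a b →
        (s :+ s) :* (h :* a :+ h :* b) :+ (t :- s) :* b :+ s :* (a :+ b) :* con (+ 1)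
        := s :* a :+ t :* b :+ s :* (a :+ b) :* (h :+ h)) refl s t half a b)
      in-inner : t < s → StrictlyBetween (spotAt T 0F) (spotAt T mid) x
      in-inner t<s = s + - t , t + t , <⇒0<- t<s , 0<+ 0<t 0<t , trans (solve 2 (λ s t → s :- t :+ (t :+ t) := s :+ t) refl s t) e
        , ≈ₚ-trans x≈ (≈ₚ-sym (≈ₚ-trans (⊕-cong ≈ₚ-refl (·-cong refl (mid≈ T))) (inner-eval _ _ , inner-eval _ _)))
      in-outer : s < t → StrictlyBetween (spotAt T mid) (spotAt T 2F) x
      in-outer s<t = s + s , t + - s , 0<+ 0<s 0<s , <⇒0<- s<t , trans (solve 2 (λ s t → s :+ s :+ (t :- s) := s :+ t) refl s t) e
        , ≈ₚ-trans x≈ (≈ₚ-sym (≈ₚ-trans (⊕-cong (·-cong refl (mid≈ T)) ≈ₚ-refl) (outer-eval _ _ , outer-eval _ _)))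
      in-middle : s ≈ t → x ≈ₚ spotAt T mid
      in-middle s≈t = ≈ₚ-trans x≈ (≈ₚ-trans (⊕-cong (·-cong s≈half ≈ₚ-refl) (·-cong (trans (sym s≈t) s≈half) ≈ₚ-refl)) (≈ₚ-sym (mid≈ T)))
        where
        s≈half : s ≈ half
        s≈half = *-cancelˡ (0<⇒≉0 (0<⟦⟧ 1)) (trans (linear₂ 1# 1# e s≈t
          (solve 2 (λ s t → con (+ 2) :* s :+ (con (+ 1) :* con (+ 1) :+ con (+ 1) :* t) := con (+ 1) :+ (con (+ 1) :* (s :+ t) :+ con (+ 1) :* s)) refl s t))
          (sym 2*half))
      compared : Tri (s < t) (s ≈ t) (t < s) → Goal
      compared (tri< s<t _ _) = ⊥-elim (no-vertex-in-segment {T} PT outerHalf {x} (in-outer s<t) vx)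
      compared (tri≈ _ s≈t _) = inj₂ (inj₂ (in-middle s≈t))
      compared (tri> _ _ t<s) = ⊥-elim (no-vertex-in-segment {T} PT innerHalf {x} (in-inner t<s) vx)
    go : x ≈ₚ spotAt T 0F ⊎ x ≈ₚ spotAt T 2F ⊎ StrictlyBetween (spotAt T 0F) (spotAt T 2F) x → Goal
    go (inj₁ p)        = inj₁ p
    go (inj₂ (inj₁ p)) = inj₂ (inj₁ p)
    go (inj₂ (inj₂ b)) = between b

  -- The odd squared lengths, in contrast to 4 for a whole long leg.
  OddPair : Fin 4 → Fin 4 → Set
  OddPair a b = quadranceK a b ≡ + 1 ⊎ quadranceK a b ≡ + 5

  -- An undivided long leg preserves parity, so what must be known about it is which end is the
  -- right angle: that end takes the third colour.
  data Edge (x y : Point) : Set where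
    odd      : ∀ {T} a b → P T → OddPair a b → x ≈ₚ spotAt T a → y ≈ₚ spotAt T b → Edge x y
    longLeg  : ∀ {T} → P T → Undivided T → x ≈ₚ right T → Edge x y
    longLeg′ : ∀ {T} → P T → Undivided T → y ≈ₚ right T → Edge x y

  edge-on-segment : ∀ {T x y} → P T → ∀ s → OddPair (startOf s) (endOf s) → OddPair (endOf s) (startOf s) → IsVertex x → IsVertex y →
    InSegment (spotAt T (startOf s)) (spotAt T (endOf s)) x → InSegment (spotAt T (startOf s)) (spotAt T (endOf s)) y →
    ¬ (x ≈ₚ y) → Edge x y
  edge-on-segment {T} {x} {y} PT s o o′ vx vy xs ys x≉y = go (vertex-on-segment {T} {x} PT s vx xs) (vertex-on-segment {T} {y} PT s vy ys)
    where
    p₀ p₁ : Point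
    p₀ = spotAt T (startOf s)
    p₁ = spotAt T (endOf s)
    go : x ≈ₚ p₀ ⊎ x ≈ₚ p₁ → y ≈ₚ p₀ ⊎ y ≈ₚ p₁ → Edge x y
    go (inj₁ p) (inj₁ q) = ⊥-elim (x≉y (≈ₚ-trans p (≈ₚ-sym q)))
    go (inj₁ p) (inj₂ q) = odd (startOf s) (endOf s) PT o p q
    go (inj₂ p) (inj₁ q) = odd (endOf s) (startOf s) PT o′ p q
    go (inj₂ p) (inj₂ q) = ⊥-elim (x≉y (≈ₚ-trans p (≈ₚ-sym q)))

  between-mid : ∀ T → StrictlyBetween (spotAt T 0F) (spotAt T 2F) (spotAt T mid)
  between-mid T = half , half , 0<half , 0<half , half+half , mid≈ T

  StrictlyBetween-sym : ∀ {p q x} → StrictlyBetween p q x → StrictlyBetween q p x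
  StrictlyBetween-sym (s , t , 0<s , 0<t , e , x≈) = t , s , 0<t , 0<s , trans (+-comm t s) e , ≈ₚ-trans x≈ (+-comm _ _ , +-comm _ _)

  edge-on-longLeg : ∀ {T x y} → P T → IsVertex x → IsVertex y →
    InSegment (spotAt T 0F) (spotAt T 2F) x → InSegment (spotAt T 0F) (spotAt T 2F) y → Consecutive P x y → Edge x y
  edge-on-longLeg {T} {x} {y} PT vx vy xs ys (x≉y , none) = go (vertex-on-longLeg {T} {x} PT vx xs) (vertex-on-longLeg {T} {y} PT vy ys)
    where
    OnSpot : Point → Set
    OnSpot z = z ≈ₚ spotAt T 0F ⊎ z ≈ₚ spotAt T 2F ⊎ z ≈ₚ spotAt T mid
    m : Point
    m = spotAt T mid
    go : OnSpot x → OnSpot y → Edge x y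
    go (inj₁ p)        (inj₁ q)        = ⊥-elim (x≉y (≈ₚ-trans p (≈ₚ-sym q)))
    go (inj₂ (inj₁ p)) (inj₂ (inj₁ q)) = ⊥-elim (x≉y (≈ₚ-trans p (≈ₚ-sym q)))
    go (inj₂ (inj₂ p)) (inj₂ (inj₂ q)) = ⊥-elim (x≉y (≈ₚ-trans p (≈ₚ-sym q)))
    go (inj₁ p)        (inj₂ (inj₂ q)) = odd 0F 3F PT (inj₁ ≡.refl) p q
    go (inj₂ (inj₂ p)) (inj₁ q)        = odd 3F 0F PT (inj₁ ≡.refl) p q
    go (inj₂ (inj₁ p)) (inj₂ (inj₂ q)) = odd 2F 3F PT (inj₁ ≡.refl) p q
    go (inj₂ (inj₂ p)) (inj₂ (inj₁ q)) = odd 3F 2F PT (inj₁ ≡.refl) p q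
    -- A vertex at the midpoint would lie strictly between the consecutive vertices `x` and `y`, so
    -- the leg is undivided.
    go (inj₁ p) (inj₂ (inj₁ q)) = longLeg PT
      (λ v → none m v (StrictlyBetween-resp {x′ = m} (≈ₚ-sym p) (≈ₚ-sym q) ≈ₚ-refl (between-mid T)))
      (≈ₚ-trans p (≈ₚ-sym (corner≈spot T 0F)))
    go (inj₂ (inj₁ p)) (inj₁ q) = longLeg′ PT
      (λ v → none m v (StrictlyBetween-resp {x′ = m} (≈ₚ-sym p) (≈ₚ-sym q) ≈ₚ-refl (StrictlyBetween-sym (between-mid T))))
      (≈ₚ-trans q (≈ₚ-sym (corner≈spot T 0F)))

  edge : ∀ {x y} → IsVertex x → IsVertex y → OnCommonSide P x y → Consecutive P x y → Edge x y
  edge {x} {y} vx vy (T , PT , i , j , i≢j , xs , ys) cons = go i j i≢j xs ys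
    where
    go : ∀ i j → i ≢ j → InSegment (corner T i) (corner T j) x → InSegment (corner T i) (corner T j) y → Edge x y
    toSpots : ∀ i j {z} → InSegment (corner T i) (corner T j) z → InSegment (spotAt T (cornerSpot i)) (spotAt T (cornerSpot j)) z
    toSpots i j = InSegment-resp (corner≈spot T i) (corner≈spot T j)
    go 0F 0F n _ _ = ⊥-elim (n ≡.refl)
    go 1F 1F n _ _ = ⊥-elim (n ≡.refl)
    go 2F 2F n _ _ = ⊥-elim (n ≡.refl)
    go 0F 1F _ p q = edge-on-segment PT shortLeg (inj₁ ≡.refl) (inj₁ ≡.refl) vx vy (toSpots 0F 1F p) (toSpots 0F 1F q) (proj₁ cons)
    go 1F 2F _ p q = edge-on-segment PT hypotenuse (inj₂ ≡.refl) (inj₂ ≡.refl) vx vy (toSpots 1F 2F p) (toSpots 1F 2F q) (proj₁ cons)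
    go 0F 2F _ p q = edge-on-longLeg PT vx vy (toSpots 0F 2F p) (toSpots 0F 2F q) cons
    go 1F 0F n p q = go 0F 1F (λ ()) (InSegment-sym p) (InSegment-sym q)
    go 2F 1F n p q = go 1F 2F (λ ()) (InSegment-sym p) (InSegment-sym q)
    go 2F 0F n p q = go 0F 2F (λ ()) (InSegment-sym p) (InSegment-sym q)

  module _ {T} (PT : P T) (PN : P (mirrorImage T)) where

    -- The triangle behind the lower bound: the short leg and the hypotenuse are single segments,
    -- and the long leg is a whole side of the mirror image as well.
    corners-adjacent : ∀ i j → i Fin.< j →
      OnCommonSide P (corner T i) (corner T j) × Consecutive P (corner T i) (corner T j)
    corners-adjacent i j i<j = (T , PT , i , j , i≢j , start-in , end-in) , distinct , λ z vz b → between i j i<j b vz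
      where
      i≢j : i ≢ j
      i≢j = Fin.<⇒≢ i<j
      start-in : InSegment (corner T i) (corner T j) (corner T i)
      start-in = 1# , 0# , inj₁ 0<1 , inj₂ refl , +-identityʳ 1# , eval _ _ , eval _ _
        where eval : ∀ a b → a ≈ 1# * a + 0# * b
              eval a b = solve 2 (λ a b → a := con (+ 1) :* a :+ con (+ 0) :* b) refl a b
      end-in : InSegment (corner T i) (corner T j) (corner T j)
      end-in = 0# , 1# , inj₂ refl , inj₁ 0<1 , +-identityˡ 1# , eval _ _ , eval _ _
        where eval : ∀ a b → b ≈ 0# * a + 1# * b
              eval a b = solve 2 (λ a b → b := con (+ 0) :* a :+ con (+ 1) :* b) refl a b
      distinct : ¬ (corner T i ≈ₚ corner T j)
      distinct e = i≢j (Fin.inject₁-injective (spotAt-injective (nonDegenerate PT) (cornerSpot i) (cornerSpot j)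
        (≈ₚ-trans (≈ₚ-sym (corner≈spot T i)) (≈ₚ-trans e (corner≈spot T j)))))
      between : ∀ i j → i Fin.< j → ∀ {z} → StrictlyBetween (corner T i) (corner T j) z → ¬ IsVertex z
      between 0F 1F _ b = no-vertex-in-segment PT shortLeg (StrictlyBetween-resp (corner≈spot T 0F) (corner≈spot T 1F) ≈ₚ-refl b)
      between 1F 2F _ b = no-vertex-in-segment PT hypotenuse (StrictlyBetween-resp (corner≈spot T 1F) (corner≈spot T 2F) ≈ₚ-refl b)
      between 0F 2F _ b = no-vertex-in-longLeg PT PN b
      between 0F 0F () _
      between 1F 0F () _
      between 1F 1F (ℕ.s≤s ()) _
      between 2F 0F () _
      between 2F 1F (ℕ.s≤s ()) _
      between 2F 2F (ℕ.s≤s (ℕ.s≤s ())) _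

-- Parity of rationals with odd denominators

odd# : ℤ → ℤ
odd# k = + 1 ℤ.+ + 2 ℤ.* k

odd#-* : ∀ j k → odd# j ℤ.* odd# k ≡ odd# (j ℤ.+ k ℤ.+ + 2 ℤ.* j ℤ.* k)
odd#-* = expanded-product
  where
  expanded-product : ∀ j k → (+ 1 ℤ.+ + 2 ℤ.* j) ℤ.* (+ 1 ℤ.+ + 2 ℤ.* k) ≡ + 1 ℤ.+ + 2 ℤ.* (j ℤ.+ k ℤ.+ + 2 ℤ.* j ℤ.* k)
  expanded-product = solve-∀

odd#≢even : ∀ k m → odd# k ≢ + 2 ℤ.* m
odd#≢even k m e = not-one ℤ.∣ m ℤ.- k ∣ (≡.trans (≡.sym (ℤ.abs-* (+ 2) (m ℤ.- k)))
    (≡.cong ℤ.∣_∣ (≡.trans (rearrange m k) (≡.trans (≡.cong (λ j → j ℤ.- + 2 ℤ.* k) (≡.sym e)) (cancel k)))))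
  where
  rearrange : ∀ m k → + 2 ℤ.* (m ℤ.- k) ≡ + 2 ℤ.* m ℤ.- + 2 ℤ.* k
  rearrange = solve-∀
  cancel : ∀ k → + 1 ℤ.+ + 2 ℤ.* k ℤ.- + 2 ℤ.* k ≡ + 1
  cancel = solve-∀
  not-one : ∀ n → 2 ℕ.* n ≢ 1
  not-one (suc zero) ()
  not-one (suc (suc n)) ()

even-or-odd : ∀ m → ∃[ n ] (m ≡ + 2 ℤ.* n ⊎ m ≡ odd# n)
even-or-odd m with m ℤ.%ℕ 2 in r | ℤ.n%ℕd<d m 2 | ℤ.a≡a%ℕn+[a/ℕn]*n m 2
... | 0 | _ | e = m ℤ./ℕ 2 , inj₁ (≡.trans e (≡.trans (ℤ.+-identityˡ _) (ℤ.*-comm (m ℤ./ℕ 2) (+ 2))))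
... | 1 | _ | e = m ℤ./ℕ 2 , inj₂ (≡.trans e (≡.cong (λ k → + 1 ℤ.+ k) (ℤ.*-comm (m ℤ./ℕ 2) (+ 2))))
... | suc (suc _) | ℕ.s≤s (ℕ.s≤s ()) | _

module Parity (ℝ : CompleteOrderedField) where
  open CompleteOrderedField ℝ
  open FieldProperties ℝ
  open Barycentric ℝ
  open Patches ℝ
  open Pinwheel ℝ
  open Triangle
  open import Relation.Binary.Reasoning.Setoid setoid

  -- The ring of rationals with odd denominators.
  Local : Carrier → Set
  Local x = ∃₂ λ k m → ⟦ odd# k ⟧ * x ≈ ⟦ m ⟧

  Even : Carrier → Set
  Even x = ∃[ y ] Local y × x ≈ 2# * y

  local-resp : ∀ {x y} → x ≈ y → Local x → Local y
  local-resp e (k , m , p) = k , m , trans (*-congˡ (sym e)) p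

  even-resp : ∀ {x y} → x ≈ y → Even x → Even y
  even-resp e (z , l , p) = z , l , trans (sym e) p

  ⟦odd#⟧-* : ∀ j k → ⟦ odd# (j ℤ.+ k ℤ.+ + 2 ℤ.* j ℤ.* k) ⟧ ≈ ⟦ odd# j ⟧ * ⟦ odd# k ⟧
  ⟦odd#⟧-* j k = trans (reflexive (≡.cong ⟦_⟧ (≡.sym (odd#-* j k)))) (⟦⟧-* (odd# j) (odd# k))

  local-⟦⟧ : ∀ i → Local ⟦ i ⟧
  local-⟦⟧ i = + 0 , i , *-identityˡ _

  local-* : ∀ {x y} → Local x → Local y → Local (x * y)
  local-* {x} {y} (j , m , p) (k , n , q) = j ℤ.+ k ℤ.+ + 2 ℤ.* j ℤ.* k , m ℤ.* n , (begin
    ⟦ odd# (j ℤ.+ k ℤ.+ + 2 ℤ.* j ℤ.* k) ⟧ * (x * y)  ≈⟨ *-congʳ (⟦odd#⟧-* j k) ⟩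
    ⟦ odd# j ⟧ * ⟦ odd# k ⟧ * (x * y)                  ≈⟨ solve 4 (λ a b x y → a :* b :* (x :* y) := a :* x :* (b :* y)) refl ⟦ odd# j ⟧ ⟦ odd# k ⟧ x y ⟩
    ⟦ odd# j ⟧ * x * (⟦ odd# k ⟧ * y)                  ≈⟨ *-cong p q ⟩
    ⟦ m ⟧ * ⟦ n ⟧                                       ≈⟨ ⟦⟧-* m n ⟨
    ⟦ m ℤ.* n ⟧                                         ∎)

  local-+ : ∀ {x y} → Local x → Local y → Local (x + y)
  local-+ {x} {y} (j , m , p) (k , n , q) =
    j ℤ.+ k ℤ.+ + 2 ℤ.* j ℤ.* k , odd# k ℤ.* m ℤ.+ odd# j ℤ.* n , (begin
    ⟦ odd# (j ℤ.+ k ℤ.+ + 2 ℤ.* j ℤ.* k) ⟧ * (x + y)    ≈⟨ *-congʳ (⟦odd#⟧-* j k) ⟩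
    ⟦ odd# j ⟧ * ⟦ odd# k ⟧ * (x + y)
      ≈⟨ solve 4 (λ a b x y → a :* b :* (x :+ y) := b :* (a :* x) :+ a :* (b :* y)) refl ⟦ odd# j ⟧ ⟦ odd# k ⟧ x y ⟩
    ⟦ odd# k ⟧ * (⟦ odd# j ⟧ * x) + ⟦ odd# j ⟧ * (⟦ odd# k ⟧ * y)  ≈⟨ +-cong (*-congˡ p) (*-congˡ q) ⟩
    ⟦ odd# k ⟧ * ⟦ m ⟧ + ⟦ odd# j ⟧ * ⟦ n ⟧
      ≈⟨ trans (⟦⟧-+ (odd# k ℤ.* m) (odd# j ℤ.* n)) (+-cong (⟦⟧-* (odd# k) m) (⟦⟧-* (odd# j) n)) ⟨
    ⟦ odd# k ℤ.* m ℤ.+ odd# j ℤ.* n ⟧                   ∎)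

  local-neg : ∀ {x} → Local x → Local (- x)
  local-neg {x} l = local-resp (solve 1 (λ x → :- con (+ 1) :* x := :- x) refl x) (local-* (local-⟦⟧ -[1+ 0 ]) l)

  local-- : ∀ {x y} → Local x → Local y → Local (x + - y)
  local-- p q = local-+ p (local-neg q)

  fifth : Carrier
  fifth = 2# * tenth

  local-fifth : Local fifth
  local-fifth = + 2 , + 1 , trans (solve 1 (λ t → con (+ 5) :* (con (+ 2) :* t) := con (+ 10) :* t) refl tenth) 10*tenth

  even-+ : ∀ {x y} → Even x → Even y → Even (x + y)
  even-+ (a , la , p) (b , lb , q) = a + b , local-+ la lb , trans (+-cong p q) (sym (distribˡ 2# a b))

  even-neg : ∀ {x} → Even x → Even (- x)
  even-neg (a , la , p) = - a , local-neg la , trans (-‿cong p) (solve 1 (λ a → :- (con (+ 2) :* a) := con (+ 2) :* (:- a)) refl a)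

  1-not-even : ¬ Even 1#
  1-not-even (y , (k , m , p) , e) = odd#≢even k m (⟦⟧-injective (odd# k) (+ 2 ℤ.* m) (begin
    ⟦ odd# k ⟧             ≈⟨ *-identityʳ _ ⟨
    ⟦ odd# k ⟧ * 1#        ≈⟨ *-congˡ e ⟩
    ⟦ odd# k ⟧ * (2# * y)  ≈⟨ solve 2 (λ a y → a :* (con (+ 2) :* y) := con (+ 2) :* (a :* y)) refl ⟦ odd# k ⟧ y ⟩
    2# * (⟦ odd# k ⟧ * y)  ≈⟨ *-congˡ p ⟩
    2# * ⟦ m ⟧             ≈⟨ ⟦⟧-* (+ 2) m ⟨
    ⟦ + 2 ℤ.* m ⟧          ∎))

  -- The denominator is odd, so the class modulo 2 is that of the numerator.
  even-or-1+even : ∀ {x} → Local x → Even x ⊎ Even (1# + x)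
  even-or-1+even {x} (k , m , p) with even-or-odd m
  ... | n , inj₁ e = inj₁ (half * x , (k , n , halved) , trans (sym (*-identityˡ x)) (trans (*-congʳ (sym 2*half)) (*-assoc _ _ _)))
    where
    halved : ⟦ odd# k ⟧ * (half * x) ≈ ⟦ n ⟧
    halved = begin
      ⟦ odd# k ⟧ * (half * x)  ≈⟨ solve 3 (λ a h x → a :* (h :* x) := h :* (a :* x)) refl ⟦ odd# k ⟧ half x ⟩
      half * (⟦ odd# k ⟧ * x)  ≈⟨ *-congˡ (trans p (trans (reflexive (≡.cong ⟦_⟧ e)) (⟦⟧-* (+ 2) n))) ⟩
      half * (2# * ⟦ n ⟧)      ≈⟨ solve 2 (λ h n → h :* (con (+ 2) :* n) := con (+ 2) :* h :* n) refl half ⟦ n ⟧ ⟩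
      2# * half * ⟦ n ⟧        ≈⟨ *-congʳ 2*half ⟩
      1# * ⟦ n ⟧               ≈⟨ *-identityˡ _ ⟩
      ⟦ n ⟧                    ∎
  ... | n , inj₂ e = inj₂ (half * (1# + x) , (k , + 1 ℤ.+ k ℤ.+ n , halved)
                          , trans (sym (*-identityˡ _)) (trans (*-congʳ (sym 2*half)) (*-assoc _ _ _)))
    where
    sum≡ : ∀ k n → + 1 ℤ.+ + 2 ℤ.* k ℤ.+ (+ 1 ℤ.+ + 2 ℤ.* n) ≡ + 2 ℤ.* (+ 1 ℤ.+ k ℤ.+ n)
    sum≡ = solve-∀
    halved : ⟦ odd# k ⟧ * (half * (1# + x)) ≈ ⟦ + 1 ℤ.+ k ℤ.+ n ⟧
    halved = begin
      ⟦ odd# k ⟧ * (half * (1# + x))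
        ≈⟨ solve 3 (λ a h x → a :* (h :* (con (+ 1) :+ x)) := h :* (a :+ a :* x)) refl ⟦ odd# k ⟧ half x ⟩
      half * (⟦ odd# k ⟧ + ⟦ odd# k ⟧ * x)     ≈⟨ *-congˡ (+-congˡ (trans p (reflexive (≡.cong ⟦_⟧ e)))) ⟩
      half * (⟦ odd# k ⟧ + ⟦ odd# n ⟧)         ≈⟨ *-congˡ (trans (sym (⟦⟧-+ (odd# k) (odd# n))) (trans (reflexive (≡.cong ⟦_⟧ (sum≡ k n))) (⟦⟧-* (+ 2) (+ 1 ℤ.+ k ℤ.+ n)))) ⟩
      half * (2# * ⟦ + 1 ℤ.+ k ℤ.+ n ⟧)        ≈⟨ solve 2 (λ h n → h :* (con (+ 2) :* n) := con (+ 2) :* h :* n) refl half _ ⟩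
      2# * half * ⟦ + 1 ℤ.+ k ℤ.+ n ⟧          ≈⟨ *-congʳ 2*half ⟩
      1# * ⟦ + 1 ℤ.+ k ℤ.+ n ⟧                 ≈⟨ *-identityˡ _ ⟩
      ⟦ + 1 ℤ.+ k ℤ.+ n ⟧                      ∎

  -- f lists one coordinate of the three corners; the long leg is even.
  LocalCorners : (Fin 3 → Carrier) → Set
  LocalCorners f = (∀ l → Local (f l)) × ∃[ h ] Local h × f 2F ≈ f 0F + 2# * h

  LocalTriangle : Triangle → Set
  LocalTriangle T = LocalCorners (λ l → proj₁ (corner T l)) × LocalCorners (λ l → proj₂ (corner T l))

  localCorners-resp : ∀ {f g} → (∀ l → f l ≈ g l) → LocalCorners f → LocalCorners g
  localCorners-resp e (p , h , q , r) = (λ l → local-resp (e l) (p l)) , h , q , trans (sym (e 2F)) (trans r (+-congʳ (e 0F)))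

  localTriangle-resp : ∀ {T U} → T ≈ₜ U → LocalTriangle T → LocalTriangle U
  localTriangle-resp e (p , q) = localCorners-resp (λ l → proj₁ (e l)) p , localCorners-resp (λ l → proj₂ (e l)) q

  -- Weights in tenths only need fifths here, because the long leg and the weights of
  -- the short end are even.
  lin-legs : ∀ a f h → Normalised a → a 1F ≡ + 2 ℤ.* halve (a 1F) → f 2F ≈ f 0F + 2# * h →
             lin ⟨ a ⟩ f ≈ f 0F + fifth * (⟦ halve (a 1F) ⟧ * (f 1F + - f 0F) + ⟦ a 2F ⟧ * h)
  lin-legs a f h n e r = linear₂ (f 0F) (tenth * ⟦ a 2F ⟧) (⟨⟩-total {a} n) r
    (trans (+-congʳ (+-congʳ (+-congˡ (*-congʳ (*-congˡ even)))))
     (trans (solve 8 (λ t a₀ x a₂ f₀ f₁ f₂ h →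
        t :* a₀ :* f₀ :+ t :* (con (+ 2) :* x) :* f₁ :+ t :* a₂ :* f₂ :+ (f₀ :* con (+ 1) :+ t :* a₂ :* (f₀ :+ con (+ 2) :* h))
        := f₀ :+ con (+ 2) :* t :* (x :* (f₁ :- f₀) :+ a₂ :* h)
           :+ (f₀ :* (t :* a₀ :+ t :* (con (+ 2) :* x) :+ t :* a₂) :+ t :* a₂ :* f₂))
        refl tenth ⟦ a 0F ⟧ ⟦ halve (a 1F) ⟧ ⟦ a 2F ⟧ (f 0F) (f 1F) (f 2F) h)
      (+-congˡ (+-congʳ (*-congˡ (+-congʳ (+-congˡ (*-congˡ (sym even)))))))))
    where
    even : ⟦ a 1F ⟧ ≈ 2# * ⟦ halve (a 1F) ⟧
    even = trans (reflexive (≡.cong ⟦_⟧ e)) (⟦⟧-* (+ 2) (halve (a 1F)))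

  localCorners-piece : ∀ i {f} → LocalCorners f → LocalCorners (λ l → lin ⟨ pieceMatrix i l ⟩ f)
  localCorners-piece i {f} (p , h , lh , r) = (λ l → local-resp (sym (legs l)) (local-+ (p 0F) (local-* local-fifth
        (local-+ (local-* (local-⟦⟧ (X l)) (local-- (p 1F) (p 0F))) (local-* (local-⟦⟧ (pieceMatrix i l 2F)) lh)))))
    , fifth * (⟦ α ⟧ * (f 1F + - f 0F) + ⟦ β ⟧ * h)
    , local-* local-fifth (local-+ (local-* (local-⟦⟧ α) (local-- (p 1F) (p 0F))) (local-* (local-⟦⟧ β) lh))
    , (begin
      lin ⟨ pieceMatrix i 2F ⟩ f  ≈⟨ legs 2F ⟩
      f 0F + fifth * (⟦ X 2F ⟧ * u + ⟦ pieceMatrix i 2F 2F ⟧ * h)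
        ≈⟨ +-congˡ (*-congˡ (+-cong (*-congʳ X≈) (*-congʳ Y≈))) ⟩
      f 0F + fifth * ((⟦ X 0F ⟧ + 2# * ⟦ α ⟧) * u + (⟦ pieceMatrix i 0F 2F ⟧ + 2# * ⟦ β ⟧) * h)
        ≈⟨ solve 8 (λ f t x a u y b h → f :+ t :* ((x :+ con (+ 2) :* a) :* u :+ (y :+ con (+ 2) :* b) :* h)
             := f :+ t :* (x :* u :+ y :* h) :+ con (+ 2) :* (t :* (a :* u :+ b :* h)))
             refl (f 0F) fifth ⟦ X 0F ⟧ ⟦ α ⟧ u ⟦ pieceMatrix i 0F 2F ⟧ ⟦ β ⟧ h ⟩
      f 0F + fifth * (⟦ X 0F ⟧ * u + ⟦ pieceMatrix i 0F 2F ⟧ * h) + 2# * (fifth * (⟦ α ⟧ * u + ⟦ β ⟧ * h))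
        ≈⟨ +-congʳ (legs 0F) ⟨
      lin ⟨ pieceMatrix i 0F ⟩ f + 2# * (fifth * (⟦ α ⟧ * u + ⟦ β ⟧ * h)) ∎)
    where
    u = f 1F + - f 0F
    X : Fin 3 → ℤ
    X l = halve (pieceMatrix i l 1F)
    -- The coordinate along the long leg of the piece is twice `fifth * (α u + β h)`. The short
    -- weights are divided by four and the long ones by two, since `2# * h` is already the long leg
    -- of the parent.
    α = quarter (pieceMatrix i 2F 1F ℤ.- pieceMatrix i 0F 1F)
    β = halve (pieceMatrix i 2F 2F ℤ.- pieceMatrix i 0F 2F)
    legs : ∀ l → lin ⟨ pieceMatrix i l ⟩ f ≈ f 0F + fifth * (⟦ X l ⟧ * u + ⟦ pieceMatrix i l 2F ⟧ * h)
    legs l = lin-legs (pieceMatrix i l) f h (pieces-affine i l) (pieces-halves i l) r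
    double : ∀ x a → + 2 ℤ.* x ℤ.+ + 4 ℤ.* a ≡ + 2 ℤ.* (x ℤ.+ + 2 ℤ.* a)
    double = solve-∀
    X≡ : X 2F ≡ X 0F ℤ.+ + 2 ℤ.* α
    X≡ = ℤ.*-cancelˡ-≡ (+ 2) (X 2F) (X 0F ℤ.+ + 2 ℤ.* α) (≡.trans (≡.sym (pieces-halves i 2F))
           (≡.trans (proj₁ (pieces-longLeg i)) (≡.trans (≡.cong (λ j → j ℤ.+ + 4 ℤ.* α) (pieces-halves i 0F)) (double (X 0F) α))))
    X≈ : ⟦ X 2F ⟧ ≈ ⟦ X 0F ⟧ + 2# * ⟦ α ⟧
    X≈ = trans (reflexive (≡.cong ⟦_⟧ X≡)) (trans (⟦⟧-+ (X 0F) (+ 2 ℤ.* α)) (+-congˡ (⟦⟧-* (+ 2) α)))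
    Y≈ : ⟦ pieceMatrix i 2F 2F ⟧ ≈ ⟦ pieceMatrix i 0F 2F ⟧ + 2# * ⟦ β ⟧
    Y≈ = trans (reflexive (≡.cong ⟦_⟧ (proj₂ (pieces-longLeg i)))) (trans (⟦⟧-+ (pieceMatrix i 0F 2F) (+ 2 ℤ.* β)) (+-congˡ (⟦⟧-* (+ 2) β)))

  localTriangle-part : ∀ i {T} → LocalTriangle T → LocalTriangle (part i T)
  localTriangle-part i {T} (p , q) = localCorners-resp (λ l → sym (proj₁ (corner-tri ⟪ pieceMatrix i ⟫ T l))) (localCorners-piece i p)
    , localCorners-resp (λ l → sym (proj₂ (corner-tri ⟪ pieceMatrix i ⟫ T l))) (localCorners-piece i q)

  localCorners-combination : ∀ i j {f g} → LocalCorners f → LocalCorners g → LocalCorners (λ l → ⟦ i ⟧ * f l + ⟦ j ⟧ * g l)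
  localCorners-combination i j {f} {g} (p , h , lh , r) (p′ , h′ , lh′ , r′) =
      (λ l → local-+ (local-* (local-⟦⟧ i) (p l)) (local-* (local-⟦⟧ j) (p′ l)))
    , ⟦ i ⟧ * h + ⟦ j ⟧ * h′ , local-+ (local-* (local-⟦⟧ i) lh) (local-* (local-⟦⟧ j) lh′)
    , trans (+-cong (*-congˡ r) (*-congˡ r′)) (solve 6 (λ i j f g h h′ →
        i :* (f :+ con (+ 2) :* h) :+ j :* (g :+ con (+ 2) :* h′) := i :* f :+ j :* g :+ con (+ 2) :* (i :* h :+ j :* h′))
        refl ⟦ i ⟧ ⟦ j ⟧ (f 0F) (g 0F) h h′)

  localTriangle-expand : ∀ {T} → LocalTriangle T → LocalTriangle (mapT expand T)
  localTriangle-expand (p , q) =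
      localCorners-resp (forFin3 (+-congˡ (*-identityˡ _)) (+-congˡ (*-identityˡ _)) (+-congˡ (*-identityˡ _)))
        (localCorners-combination (+ 2) (+ 1) p q)
    , localCorners-resp (forFin3 (+-congʳ -1*) (+-congʳ -1*) (+-congʳ -1*)) (localCorners-combination -[1+ 0 ] (+ 2) p q)
    where
    -1* : ∀ {x} → - 1# * x ≈ - x
    -1* {x} = solve 1 (λ x → :- con (+ 1) :* x := :- x) refl x

  localTriangle-ωⁿK : ∀ n {U} → ωⁿK n U → LocalTriangle U
  localTriangle-ωⁿK zero {U} U≈K = localTriangle-resp (≈ₜ-sym U≈K)
    ( (forFin3 (local-⟦⟧ (+ 0)) (local-⟦⟧ (+ 1)) (local-⟦⟧ (+ 0)) , ⟦ + 0 ⟧ , local-⟦⟧ (+ 0)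
      , solve 0 (con (+ 0) := con (+ 0) :+ con (+ 2) :* con (+ 0)) refl)
    , (forFin3 (local-⟦⟧ (+ 0)) (local-⟦⟧ (+ 0)) (local-⟦⟧ (+ 2)) , ⟦ + 1 ⟧ , local-⟦⟧ (+ 1)
      , solve 0 (con (+ 2) := con (+ 0) :+ con (+ 2) :* con (+ 1)) refl))
  localTriangle-ωⁿK (suc n) {U} (T , T∈ , U∈) = piece-of (localTriangle-ωⁿK n {T} T∈) (∈ω⇒part {U} {T} U∈)
    where
    piece-of : LocalTriangle T → (∃[ i ] U ≈ₜ part i (mapT expand T)) → LocalTriangle U
    piece-of l (i , U≈) = localTriangle-resp {part i (mapT expand T)} {U} (≈ₜ-sym U≈)
      (localTriangle-part i {mapT expand T} (localTriangle-expand {T} l))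

  -- The dot product of the differences `p - q` and `r - s`, which is unchanged by isometries,
  -- translations included.
  inner : Point → Point → Point → Point → Carrier
  inner (a , b) (c , d) (e , f) (g , h) = (a + - c) * (e + - g) + (b + - d) * (f + - h)

  inner-cong : ∀ {p p′ q q′ r r′ s s′} → p ≈ₚ p′ → q ≈ₚ q′ → r ≈ₚ r′ → s ≈ₚ s′ → inner p q r s ≈ inner p′ q′ r′ s′
  inner-cong (a , b) (c , d) (e , f) (g , h) = +-cong (*-cong (+-cong a (-‿cong c)) (+-cong e (-‿cong g)))
    (*-cong (+-cong b (-‿cong d)) (+-cong f (-‿cong h)))

  quadrance : Point → Point → Carrier
  quadrance p q = inner p q p q

  inner-apply : ∀ g p q r s → inner (Isometry.apply g p) (Isometry.apply g q) (Isometry.apply g r) (Isometry.apply g s) ≈ inner p q r s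
  inner-apply g (a , b) (c , d) (e , f) (i , j) = linear₁ 1# (+-cong (+-cong (*-congˡ {x * u} e₁-unit) (*-congˡ {y * v} e₂-unit)) (*-congˡ {x * v + y * u} orthogonal))
      (solve 14 (λ a b c d e f i j k l m n s t →
        let X = λ x y → x :* k :+ y :* m :+ s ; Y = λ x y → x :* l :+ y :* n :+ t
            x = a :- c ; y = b :- d ; u = e :- i ; v = f :- j in
        (X a b :- X c d) :* (X e f :- X i j) :+ (Y a b :- Y c d) :* (Y e f :- Y i j)
          :+ con (+ 1) :* (x :* u :* con (+ 1) :+ y :* v :* con (+ 1) :+ (x :* v :+ y :* u) :* con (+ 0))
        := x :* u :+ y :* v
          :+ con (+ 1) :* (x :* u :* (k :* k :+ l :* l) :+ y :* v :* (m :* m :+ n :* n) :+ (x :* v :+ y :* u) :* (k :* m :+ l :* n)))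
       refl a b c d e f i j (proj₁ e₁) (proj₂ e₁) (proj₁ e₂) (proj₂ e₂) (proj₁ τ) (proj₂ τ))
    where
    open Isometry g
    x = a + - c
    y = b + - d
    u = e + - i
    v = f + - j

  LocalPoint : Point → Set
  LocalPoint (x , y) = Local x × Local y

  local-inner : ∀ {p q r s} → LocalPoint p → LocalPoint q → LocalPoint r → LocalPoint s → Local (inner p q r s)
  local-inner (a , b) (c , d) (e , f) (g , h) = local-+ (local-* (local-- a c) (local-- e g)) (local-* (local-- b d) (local-- f h))

-- The colouring and the lower bound

module Colouring (em : ExcludedMiddle 0ℓ) (ℝ : CompleteOrderedField) (P : Pred (Pinwheel.Triangle ℝ) 0ℓ)
                 (pinwheel : Pinwheel.IsPinwheelTiling ℝ P) where
  open CompleteOrderedField ℝ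
  open FieldProperties ℝ
  open Barycentric ℝ
  open Patches ℝ
  open Parity ℝ
  open Tilings ℝ P pinwheel
  open SpecialVertices ℝ P pinwheel
  open Pinwheel ℝ hiding (IsVertex)
  open Triangle
  open IsPinwheelTiling pinwheel
  open IsTiling isTiling

  -- One patch contains tiles at all three vertices. In its frame their coordinates are local, and
  -- the inner products do not depend on the frame; another triple of vertices may use another
  -- patch.
  local-vertices : ∀ {x y z} → IsVertex x → IsVertex y → IsVertex z → Local (inner x y z x) × Local (quadrance x y)
  local-vertices {x} {y} {z} (A , PA , i , x≈) (B , PB , j , y≈) (C , PC , k , z≈) =
      local-inner₃ (patches (A ∷ B ∷ C ∷ []) (PA ∷ PB ∷ PC ∷ []))
    where
    InPatch : ℕ → Isometry → Triangle → Set
    InPatch n g T = ∃[ U ] ωⁿK n U × T ≈ₜ moveT g U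
    preimage : ∀ {n g T p} l → p ≈ₚ corner T l → InPatch n g T → ∃[ q ] LocalPoint q × p ≈ₚ Isometry.apply g q
    preimage {n} {g} {T} l p≈ (U , U∈ , T≈) = corner U l , (proj₁ (proj₁ loc) l , proj₁ (proj₂ loc) l)
        , ≈ₚ-trans p≈ (≈ₚ-trans (T≈ l) (cornerMove l))
      where
      loc : LocalTriangle U
      loc = localTriangle-ωⁿK n {U} U∈
      cornerMove : ∀ l → corner (moveT g U) l ≈ₚ Isometry.apply g (corner U l)
      cornerMove = forFin3 ≈ₚ-refl ≈ₚ-refl ≈ₚ-refl
    local-inner₃ : (∃[ n ] ∃[ g ] All (InPatch n g) (A ∷ B ∷ C ∷ [])) → Local (inner x y z x) × Local (quadrance x y)
    local-inner₃ (n , g , A∈ ∷ B∈ ∷ C∈ ∷ []) = from (preimage {n} {g} {A} i x≈ A∈) (preimage {n} {g} {B} j y≈ B∈) (preimage {n} {g} {C} k z≈ C∈)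
      where
      Preimage : Point → Set
      Preimage p = ∃[ q ] LocalPoint q × p ≈ₚ Isometry.apply g q
      from : Preimage x → Preimage y → Preimage z → Local (inner x y z x) × Local (quadrance x y)
      from (a , la , ex) (b , lb , ey) (c , lc , ez) =
          local-resp (sym (trans (inner-cong ex ey ez ex) (inner-apply g a b c a))) (local-inner {a} {b} {c} {a} la lb lc la)
        , local-resp (sym (trans (inner-cong ex ey ex ey) (inner-apply g a b a b))) (local-inner {a} {b} {a} {b} la lb la lb)

  spotK≈ : ∀ k → spotAt K k ≈ₚ integerPoint (spotK k)
  spotK≈ k = trans (lin-congʳ ⟨ spot k ⟩ {λ l → proj₁ (corner K l)} {λ l → ⟦ rowK 0F l ⟧} (forFin3 refl refl refl)) (lin-integral (spot k) (rowK 0F) (spots-K k 0F))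
    , trans (lin-congʳ ⟨ spot k ⟩ {λ l → proj₂ (corner K l)} {λ l → ⟦ rowK 1F l ⟧} (forFin3 refl refl refl)) (lin-integral (spot k) (rowK 1F) (spots-K k 1F))

  quadrance-spots : ∀ {T} → P T → ∀ a b → quadrance (spotAt T a) (spotAt T b) ≈ ⟦ quadranceK a b ⟧
  quadrance-spots {T} PT a b =
    trans (inner-cong (place a) (place b) (place a) (place b)) (trans (inner-apply g (pt a) (pt b) (pt a) (pt b)) (integral (spotK a) (spotK b)))
    where
    g : Isometry
    g = proj₁ (copies T PT)
    e : T ≈ₜ moveT g K
    e = proj₂ (copies T PT)
    pt : Fin 4 → Point
    pt k = integerPoint (spotK k)
    place : ∀ k → spotAt T k ≈ₚ Isometry.apply g (pt k)
    place k = ≈ₚ-trans (spotAt-cong k e) (≈ₚ-trans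
      (≈ₚ-sym (apply-preserves g K ⟨ spot k ⟩ (sum≈1 (spot-coordinates K k)))) (apply-cong g (spotK≈ k)))
    integral : ∀ m n → quadrance (integerPoint m) (integerPoint n) ≈
               ⟦ (m 0F ℤ.- n 0F) ℤ.* (m 0F ℤ.- n 0F) ℤ.+ (m 1F ℤ.- n 1F) ℤ.* (m 1F ℤ.- n 1F) ⟧
    integral m n = sym (trans (⟦⟧-+ (x ℤ.* x) (y ℤ.* y)) (+-cong (trans (⟦⟧-* x x) (*-cong dx dx)) (trans (⟦⟧-* y y) (*-cong dy dy))))
      where
      x = m 0F ℤ.- n 0F
      y = m 1F ℤ.- n 1F
      dx : ⟦ x ⟧ ≈ ⟦ m 0F ⟧ + - ⟦ n 0F ⟧
      dx = trans (⟦⟧-+ (m 0F) (ℤ.- n 0F)) (+-congˡ (⟦⟧-neg (n 0F)))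
      dy : ⟦ y ⟧ ≈ ⟦ m 1F ⟧ + - ⟦ n 1F ⟧
      dy = trans (⟦⟧-+ (m 1F) (ℤ.- n 1F)) (+-congˡ (⟦⟧-neg (n 1F)))

  odd-not-even : ∀ {n} → n ≡ + 1 ⊎ n ≡ + 5 → ¬ Even ⟦ n ⟧
  odd-not-even (inj₁ ≡.refl) = 1-not-even
  odd-not-even (inj₂ ≡.refl) h = 1-not-even (even-resp (solve 0 (con (+ 5) :- con (+ 2) :* con (+ 2) := con (+ 1)) refl)
    (even-+ h (even-neg (⟦ + 2 ⟧ , local-⟦⟧ (+ 2) , refl))))

  baseTile : ∃[ T ] P T
  baseTile = let T , PT , _ = covers (0# , 0#) in T , PT

  -- A vertex of the tiling rather than the point (0,0), since squared distances are known to be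
  -- local only between vertices.
  origin : Point
  origin = right (proj₁ baseTile)

  origin-vertex : IsVertex origin
  origin-vertex = proj₁ baseTile , proj₂ baseTile , 0F , ≈ₚ-refl

  EvenVertex : Point → Set
  EvenVertex x = Even (quadrance x origin)

  -- With o the origin, |y - o|² - |x - o|² = |x - y|² + 2 (x - o)·(y - x). The inner product is
  -- local, so the difference has the parity of |x - y|², which is 1 or 5.
  odd-edge : ∀ {T x y} → IsVertex x → IsVertex y → P T → ∀ a b → OddPair a b → x ≈ₚ spotAt T a → y ≈ₚ spotAt T b →
             ¬ Even (quadrance y origin + - quadrance x origin)
  odd-edge {T} {x@(x₁ , x₂)} {y@(y₁ , y₂)} vx vy PT a b o x≈ y≈ h = odd-not-even o (even-resp (begin
    quadrance y origin + - quadrance x origin + - (2# * inner x origin y x)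
      ≈⟨ solve 6 (λ a b c d e f → ((c :- e) :* (c :- e) :+ (d :- f) :* (d :- f)) :- ((a :- e) :* (a :- e) :+ (b :- f) :* (b :- f))
            :- con (+ 2) :* ((a :- e) :* (c :- a) :+ (b :- f) :* (d :- b)) := (a :- c) :* (a :- c) :+ (b :- d) :* (b :- d))
           refl x₁ x₂ y₁ y₂ (proj₁ origin) (proj₂ origin) ⟩
    quadrance x y                            ≈⟨ inner-cong x≈ y≈ x≈ y≈ ⟩
    quadrance (spotAt T a) (spotAt T b)      ≈⟨ quadrance-spots PT a b ⟩
    ⟦ quadranceK a b ⟧                       ∎)
    (even-+ h (even-neg (_ , proj₁ (local-vertices vx origin-vertex vy) , refl))))
    where open import Relation.Binary.Reasoning.Setoid setoid

  parity-flips : ∀ {T x y} → IsVertex x → IsVertex y → P T → ∀ a b → OddPair a b → x ≈ₚ spotAt T a → y ≈ₚ spotAt T b →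
                 (EvenVertex x × ¬ EvenVertex y) ⊎ (¬ EvenVertex x × EvenVertex y)
  parity-flips {T} {x} {y} vx vy PT a b o x≈ y≈ = cases (em {EvenVertex x}) (em {EvenVertex y})
    where
    differ = odd-edge vx vy PT a b o x≈ y≈
    cases : Dec (EvenVertex x) → Dec (EvenVertex y) → (EvenVertex x × ¬ EvenVertex y) ⊎ (¬ EvenVertex x × EvenVertex y)
    cases (yes p) (no q)  = inj₁ (p , q)
    cases (no p)  (yes q) = inj₂ (p , q)
    cases (yes p) (yes q) = ⊥-elim (differ (even-+ q (even-neg p)))
    cases (no p)  (no q)
      with even-or-1+even (proj₂ (local-vertices vx origin-vertex vx)) | even-or-1+even (proj₂ (local-vertices vy origin-vertex vy))
    ... | inj₁ r | _      = ⊥-elim (p r)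
    ... | inj₂ _ | inj₁ s = ⊥-elim (q s)
    -- Both values become even on adding 1, so their difference is even.
    ... | inj₂ r | inj₂ s = ⊥-elim (differ (even-resp
            (solve 2 (λ y x → con (+ 1) :+ y :- (con (+ 1) :+ x) := y :- x) refl (quadrance y origin) (quadrance x origin))
            (even-+ s (even-neg r))))

  select : ∀ {A B : Set} → Dec A → Dec B → Fin 3
  select (yes _) _       = 2F
  select (no _)  (yes _) = 0F
  select (no _)  (no _)  = 1F

  -- Excluded middle returns unrelated decisions for the propositions at two equal points, so the
  -- comparison goes through the equivalence of the propositions.
  select-cong : ∀ {A B A′ B′ : Set} → (A → A′) → (A′ → A) → (B → B′) → (B′ → B) →
                (a : Dec A) (b : Dec B) (a′ : Dec A′) (b′ : Dec B′) → select a b ≡ select a′ b′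
  select-cong f f′ g g′ (yes _) _       (yes _) _       = ≡.refl
  select-cong f f′ g g′ (yes a) _       (no n)  _       = ⊥-elim (n (f a))
  select-cong f f′ g g′ (no n)  _       (yes a) _       = ⊥-elim (n (f′ a))
  select-cong f f′ g g′ (no _)  (yes _) (no _)  (yes _) = ≡.refl
  select-cong f f′ g g′ (no _)  (yes b) (no _)  (no n)  = ⊥-elim (n (g b))
  select-cong f f′ g g′ (no _)  (no n)  (no _)  (yes b) = ⊥-elim (n (g′ b))
  select-cong f f′ g g′ (no _)  (no _)  (no _)  (no _)  = ≡.refl

  select-≢ : ∀ {A B A′ B′ : Set} → ¬ (A × A′) → ((¬ A × ¬ A′) → (B × ¬ B′) ⊎ (¬ B × B′)) →
             (a : Dec A) (b : Dec B) (a′ : Dec A′) (b′ : Dec B′) → select a b ≢ select a′ b′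
  select-≢ f g (yes a) _       (yes a′) _        _ = f (a , a′)
  select-≢ f g (no a)  (yes b) (no a′)  (yes b′) _ = [ (λ (_ , q) → q b′) , (λ (p , _) → p b) ]′ (g (a , a′))
  select-≢ f g (no a)  (no b)  (no a′)  (no b′)  _ = [ (λ (p , _) → b p) , (λ (_ , q) → b′ q) ]′ (g (a , a′))
  select-≢ f g (yes _) _       (no _)   (yes _)  ()
  select-≢ f g (yes _) _       (no _)   (no _)   ()
  select-≢ f g (no _)  (yes _) (yes _)  _        ()
  select-≢ f g (no _)  (no _)  (yes _)  _        ()
  select-≢ f g (no _)  (yes _) (no _)   (no _)   ()
  select-≢ f g (no _)  (no _)  (no _)   (yes _)  ()

  colour : Point → Fin 3
  colour x = select (em {Special x}) (em {EvenVertex x})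

  special-resp : ∀ {x y} → x ≈ₚ y → Special x → Special y
  special-resp e (T , PT , u , x≈) = T , PT , u , ≈ₚ-trans (≈ₚ-sym e) x≈

  evenVertex-resp : ∀ {x y} → x ≈ₚ y → EvenVertex x → EvenVertex y
  evenVertex-resp e = even-resp (inner-cong e ≈ₚ-refl e ≈ₚ-refl)

  colour-cong : ∀ {x y} → x ≈ₚ y → colour x ≡ colour y
  colour-cong {x} {y} e = select-cong (special-resp e) (special-resp (≈ₚ-sym e)) (evenVertex-resp e) (evenVertex-resp (≈ₚ-sym e))
    (em {Special x}) (em {EvenVertex x}) (em {Special y}) (em {EvenVertex y})

  inSegment⊆inTriangle : ∀ {T x} i j → InSegment (corner T i) (corner T j) x → InTriangle T x
  inSegment⊆inTriangle {T} i j (s , t , 0≤s , 0≤t , e , x≈) = inTriangle-resp ≈ₜ-refl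
      (≈ₚ-sym (≈ₚ-trans x≈ (⊕-cong (·-cong s≈ ≈ₚ-refl) ≈ₚ-refl)))
      (inTriangle⁺ (mix-coordinates t (proj₁ ci) (proj₁ cj)) λ k →
        0≤+ (0≤* (≤-resp s≈ 0≤s) (proj₂ ci k)) (0≤* 0≤t (proj₂ cj k)))
    where
    s≈ : s ≈ 1# + - t
    s≈ = linear₁ 1# e (solve 2 (λ s t → s :+ con (+ 1) :* con (+ 1) := con (+ 1) :- t :+ con (+ 1) :* (s :+ t)) refl s t)
    ci = inTriangle⁻ {T} (corner-in T i)
    cj = inTriangle⁻ {T} (corner-in T j)

  colour-proper : ∀ {x y} → IsVertex x → IsVertex y → OnCommonSide P x y → Consecutive P x y → colour x ≢ colour y
  colour-proper {x} {y} vx vy side@(T , PT , i , j , _ , xs , ys) cons = select-≢ independent (λ (sx , sy) → flips sx sy (edge vx vy side cons))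
      (em {Special x}) (em {EvenVertex x}) (em {Special y}) (em {EvenVertex y})
    where
    independent : ¬ (Special x × Special y)
    independent (sx , sy) = proj₁ cons (special-unique sx sy PT (inSegment⊆inTriangle i j xs) (inSegment⊆inTriangle i j ys))
    flips : ¬ Special x → ¬ Special y → Edge x y → (EvenVertex x × ¬ EvenVertex y) ⊎ (¬ EvenVertex x × EvenVertex y)
    flips _  _  (odd a b PU o x≈ y≈)   = parity-flips vx vy PU a b o x≈ y≈
    flips sx _  (longLeg PU u x≈)      = ⊥-elim (sx (_ , PU , u , x≈))
    flips _  sy (longLeg′ PU u y≈)     = ⊥-elim (sy (_ , PU , u , y≈))

  colourable : Colourable (tilingGraph P) 3
  colourable = record { to = λ u → colour (proj₁ u) ; cong = λ {u} {v} → colour-cong {proj₁ u} {proj₁ v} }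
    , λ (x , vx) (y , vy) (side , cons) → colour-proper vx vy side cons

  not-colourable : ∀ m → m ℕ.< 3 → ¬ Colourable (tilingGraph P) m
  not-colourable m m<3 (c , proper) = monochromatic (Fin.pigeonhole m<3 (λ i → c ⟨$⟩ vertex i))
    where
    pair : ∃[ A ] P A × P (mirrorImage A)
    pair = mirrored-pair {proj₁ baseTile} (proj₂ baseTile)
    A : Triangle
    A = proj₁ pair
    vertex : Fin 3 → ∃ IsVertex
    vertex i = corner A i , A , proj₁ (proj₂ pair) , i , ≈ₚ-refl
    monochromatic : (∃₂ λ i j → i Fin.< j × c ⟨$⟩ vertex i ≡ c ⟨$⟩ vertex j) → ⊥
    monochromatic (i , j , i<j , e) = proper (vertex i) (vertex j) (corners-adjacent {A} (proj₁ (proj₂ pair)) (proj₂ (proj₂ pair)) i j i<j) e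

theorem6p2 : ExcludedMiddle 0ℓ →
    (ℝ : CompleteOrderedField) →
    (P : Pred (Pinwheel.Triangle ℝ) 0ℓ) →
    Pinwheel.IsPinwheelTiling ℝ P →
    HasChromaticNumber (Pinwheel.tilingGraph ℝ P) 3
theorem6p2 em ℝ P pinwheel = colourable , not-colourable
  where open Colouring em ℝ P pinwheel
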